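{- There exist absolute constants $C, c > 0$ and $n_0$ such that for all $n \geq n_0$ and all $k$ the following holds. Let $\lambda$ be any value with $\lambda < \sqrt[3]{n}$, and let $\mathbf{c} = (c_1,\dots,c_k)$ be any initial $k$-color configuration on $n$ nodes (with $c_1 \geq c_2 \geq \dots \geq c_k$) such that $c_1 \geq n/\lambda$ and $s(\mathbf{c}) = c_1 - c_2 \geq 24\sqrt{2\lambda\, n\log n}$. Then, with probability at least $1 - n^{ -c}$, the 3-majority protocol started from $\mathbf{c}$ reaches the configuration in which all $n$ nodes have the plurality color $1$ within at most $C\lambda \log n$ rounds. (That is, the process converges to the plurality color in $\mathcal{O}(\lambda \log n)$ time with high probability.)
   Context: A $k$-color configuration on $n$ nodes is a $k$-tuple $\mathbf{c}=(c_1,\dots,c_k)$ of non-negative integers with $\sum_{j} c_j = n$, where $c_j$ is the number of nodes with color $j\in[k]=\{1,\dots,k\}$. Colors are indexed so that in the initial configuration $c_1\geq c_2\geq\dots\geq c_k$; color $1$ is the plurality color and $s(\mathbf{c})=c_1-c_2$ is the bias. 3-majority protocol (on the clique, synchronous rounds): at every round, every node, independently of the others, picks three nodes uniformly at random (including itself and with repetitions) and recolors itself according to the majority of the colors it sees; if it sees three different colors, it chooses the first one. All nodes update simultaneously, using the colors at the beginning of the round. "With high probability" means with probability at least $1-n^{ -c}$ for some constant $c>0$ and all sufficiently large $n$. $\log$ is the natural logarithm. -}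

module Defs where

open import Data.Bool.Base using (if_then_else_; _∨_)
open import Data.Fin.Base as Fin using (Fin; zero; suc)
open import Data.Fin.Properties using (all?; _≟_)
open import Data.Integer.Base as ℤ using (+_; -[1+_])
import Data.Integer.Properties as ℤₚ
open import Data.List.Base using (List; []; _∷_; length; filter; allFin; cartesianProduct; cartesianProductWith)
open import Data.List.Properties using (length-++; length-map)
open import Data.Nat.Base as ℕ using (ℕ; zero; suc)
import Data.Nat.Properties as ℕₚ
open import Data.Product.Base using (∃-syntax; _×_; _,_; proj₁; proj₂)
import Data.List.Base
import Data.Rational.Base
open import Data.Rational.Base as ℚ using (ℚ; mkℚ; 0ℚ; 1ℚ; ½; _/_; 1/_; ∣_∣; *≤*)
import Data.Rational.Properties as ℚₚ
open import Data.Rational.Solver using (module +-*-Solver)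
import Data.Rational.Unnormalised.Base as ℚᵘ
import Data.Rational.Unnormalised.Properties as ℚᵘₚ
open import Data.Sum.Base using (_⊎_)
open import Data.Vec.Base as Vec using (Vec; []; _∷_; lookup; sum; head)
open import Level using (0ℓ)
open import Relation.Binary.PropositionalEquality
open import Relation.Nullary using (does)
open import Relation.Nullary.Decidable using (_⊎-dec_)
open import Relation.Unary using (Pred; Decidable)

-- Used only to check that the operations on ℝ below preserve the Cauchy condition.
module RationalLemmas where
  open Data.Rational.Base using (_+_; _*_; -_; _-_; _≤_; _<_)
  open +-*-Solver
  open ℚₚ.≤-Reasoning

  ι : ℕ → ℚ
  ι n = + n / 1

  ι-suc : ∀ n → ι (suc n) ≡ 1ℚ + ι n
  ι-suc n = ℚₚ.toℚᵘ-injective (ℚᵘₚ.≃-trans (ℚₚ.toℚᵘ-fromℚᵘ (ℚᵘ.mkℚᵘ (+ suc n) 0))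
    (ℚᵘₚ.≃-trans eq (ℚᵘₚ.≃-sym (ℚᵘₚ.≃-trans (ℚₚ.toℚᵘ-homo-+ 1ℚ (ι n))
      (ℚᵘₚ.+-congʳ ℚᵘ.1ℚᵘ (ℚₚ.toℚᵘ-fromℚᵘ (ℚᵘ.mkℚᵘ (+ n) 0)))))))
    where
    eq : ℚᵘ.mkℚᵘ (+ suc n) 0 ℚᵘ.≃ ℚᵘ.1ℚᵘ ℚᵘ.+ ℚᵘ.mkℚᵘ (+ n) 0
    eq = ℚᵘ.*≡* (cong (ℤ._* + 1) (sym (cong (λ z → + 1 ℤ.+ z) (ℤₚ.*-identityʳ (+ n)))))

  ι-inv : ∀ n → ι (suc n) * (+ 1 / suc n) ≡ 1ℚ
  ι-inv n = ℚₚ.toℚᵘ-injective (ℚᵘₚ.≃-trans (ℚₚ.toℚᵘ-homo-* (ι (suc n)) (+ 1 / suc n))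
    (ℚᵘₚ.≃-trans (ℚᵘₚ.*-cong (ℚₚ.toℚᵘ-fromℚᵘ (ℚᵘ.mkℚᵘ (+ suc n) 0)) (ℚₚ.toℚᵘ-fromℚᵘ (ℚᵘ.mkℚᵘ (+ 1) n)))
      (ℚᵘ.*≡* eq)))
    where
    eq : (+ suc n ℤ.* + 1) ℤ.* + 1 ≡ + 1 ℤ.* (+ (1 ℕ.* suc n))
    eq = trans (ℤₚ.*-identityʳ _) (trans (ℤₚ.*-identityʳ _)
           (trans (cong +_ (sym (ℕₚ.*-identityˡ (suc n)))) (sym (ℤₚ.*-identityˡ _))))

  ι-nonNeg : ∀ n → 0ℚ ≤ ι n
  ι-nonNeg zero    = ℚₚ.≤-refl
  ι-nonNeg (suc n) = begin
    0ℚ       ≡⟨⟩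
    0ℚ + 0ℚ  ≤⟨ ℚₚ.+-mono-≤ (ℚₚ.nonNegative⁻¹ 1ℚ) (ι-nonNeg n) ⟩
    1ℚ + ι n ≡⟨ ι-suc n ⟨
    ι (suc n) ∎

  ι-mono : ∀ m d → ι m ≤ ι (d ℕ.+ m)
  ι-mono m zero    = ℚₚ.≤-refl
  ι-mono m (suc d) = begin
    ι m                  ≤⟨ ι-mono m d ⟩
    ι (d ℕ.+ m)          ≡⟨ ℚₚ.+-identityˡ _ ⟨
    0ℚ + ι (d ℕ.+ m)     ≤⟨ ℚₚ.+-monoˡ-≤ (ι (d ℕ.+ m)) (ℚₚ.nonNegative⁻¹ 1ℚ) ⟩
    1ℚ + ι (d ℕ.+ m)     ≡⟨ ι-suc (d ℕ.+ m) ⟨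
    ι (suc d ℕ.+ m)      ∎

  archimedean : ∀ q → ∃[ n ] q ≤ ι n
  archimedean q@(mkℚ (+ a) d c) = a , ℚₚ.toℚᵘ-cancel-≤ (ℚᵘₚ.≤-respʳ-≃
    (ℚᵘₚ.≃-sym (ℚₚ.toℚᵘ-fromℚᵘ (ℚᵘ.mkℚᵘ (+ a) 0)))
    (ℚᵘ.*≤* (ℤₚ.*-monoˡ-≤-nonNeg (+ a) (ℤ.+≤+ (ℕ.s≤s ℕ.z≤n)))))
  archimedean q@(mkℚ -[1+ a ] d c) = 0 , ℚₚ.nonPositive⁻¹ q

  *-monoʳ : ∀ {a b c} → 0ℚ ≤ c → a ≤ b → a * c ≤ b * c
  *-monoʳ {c = c} 0≤c = ℚₚ.*-monoʳ-≤-nonNeg c {{ℚ.nonNegative 0≤c}}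

  *-monoˡ : ∀ {a b c} → 0ℚ ≤ c → a ≤ b → c * a ≤ c * b
  *-monoˡ {c = c} 0≤c = ℚₚ.*-monoˡ-≤-nonNeg c {{ℚ.nonNegative 0≤c}}

  *-pos : ∀ {a b} → 0ℚ < a → 0ℚ < b → 0ℚ < a * b
  *-pos {a} {b} 0<a 0<b =
    ℚₚ.positive⁻¹ (a * b) {{ℚₚ.pos*pos⇒pos a {{ℚ.positive 0<a}} b {{ℚ.positive 0<b}}}}

  half>0 : ∀ {ε} → 0ℚ < ε → 0ℚ < ½ * ε
  half>0 = *-pos (ℚₚ.positive⁻¹ ½)

  halves : ∀ ε → ½ * ε + ½ * ε ≡ ε
  halves ε = trans (sym (ℚₚ.*-distribʳ-+ ε ½ ½)) (ℚₚ.*-identityˡ ε)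

  ∣∣-sym : ∀ a b → ∣ a - b ∣ ≡ ∣ b - a ∣
  ∣∣-sym a b = trans (sym (ℚₚ.∣-p∣≡∣p∣ (a - b)))
    (cong ∣_∣ (solve 2 (λ a b → :- (a :- b) := b :- a) refl a b))

  triangle : ∀ a b c → ∣ a - c ∣ ≤ ∣ a - b ∣ + ∣ b - c ∣
  triangle a b c = begin
    ∣ a - c ∣             ≡⟨ cong ∣_∣ (solve 3 (λ a b c → a :- c := (a :- b) :+ (b :- c)) refl a b c) ⟩
    ∣ (a - b) + (b - c) ∣ ≤⟨ ℚₚ.∣p+q∣≤∣p∣+∣q∣ (a - b) (b - c) ⟩
    ∣ a - b ∣ + ∣ b - c ∣ ∎

  near-bound : ∀ a b → ∣ a ∣ ≤ ∣ a - b ∣ + ∣ b ∣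
  near-bound a b = begin
    ∣ a ∣           ≡⟨ cong ∣_∣ (solve 2 (λ a b → a := (a :- b) :+ b) refl a b) ⟩
    ∣ (a - b) + b ∣ ≤⟨ ℚₚ.∣p+q∣≤∣p∣+∣q∣ (a - b) b ⟩
    ∣ a - b ∣ + ∣ b ∣ ∎

  sum-close : ∀ a b c d → ∣ (a + b) - (c + d) ∣ ≤ ∣ a - c ∣ + ∣ b - d ∣
  sum-close a b c d = begin
    ∣ (a + b) - (c + d) ∣ ≡⟨ cong ∣_∣ (solve 4 (λ a b c d → (a :+ b) :- (c :+ d) := (a :- c) :+ (b :- d)) refl a b c d) ⟩
    ∣ (a - c) + (b - d) ∣ ≤⟨ ℚₚ.∣p+q∣≤∣p∣+∣q∣ (a - c) (b - d) ⟩
    ∣ a - c ∣ + ∣ b - d ∣ ∎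

  product-close : ∀ {a b c d B δ} → ∣ b ∣ ≤ B → ∣ c ∣ ≤ B → ∣ a - c ∣ ≤ δ → ∣ b - d ∣ ≤ δ →
                  ∣ a * b - c * d ∣ ≤ δ * B + B * δ
  product-close {a} {b} {c} {d} {B} {δ} b≤ c≤ ac bd = begin
    ∣ a * b - c * d ∣                     ≡⟨ cong ∣_∣ (solve 4 (λ a b c d → a :* b :- c :* d := (a :- c) :* b :+ c :* (b :- d)) refl a b c d) ⟩
    ∣ (a - c) * b + c * (b - d) ∣         ≤⟨ ℚₚ.∣p+q∣≤∣p∣+∣q∣ ((a - c) * b) (c * (b - d)) ⟩
    ∣ (a - c) * b ∣ + ∣ c * (b - d) ∣     ≡⟨ cong₂ _+_ (ℚₚ.∣p*q∣≡∣p∣*∣q∣ (a - c) b) (ℚₚ.∣p*q∣≡∣p∣*∣q∣ c (b - d)) ⟩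
    ∣ a - c ∣ * ∣ b ∣ + ∣ c ∣ * ∣ b - d ∣ ≤⟨ ℚₚ.+-mono-≤ (*-mono ac b≤ (ℚₚ.0≤∣p∣ b) 0≤δ) (*-mono c≤ bd (ℚₚ.0≤∣p∣ (b - d)) 0≤B) ⟩
    δ * B + B * δ                         ∎
    where
    *-mono : ∀ {p q r s} → p ≤ q → r ≤ s → 0ℚ ≤ r → 0ℚ ≤ q → p * r ≤ q * s
    *-mono p≤q r≤s 0≤r 0≤q = ℚₚ.≤-trans (*-monoʳ 0≤r p≤q) (*-monoˡ 0≤q r≤s)
    0≤δ = ℚₚ.≤-trans (ℚₚ.0≤∣p∣ (a - c)) ac
    0≤B = ℚₚ.≤-trans (ℚₚ.0≤∣p∣ b) b≤

  product-cauchy : ∀ {a b c d Bx By δ ε} → 0ℚ < Bx → 0ℚ < By → δ * (Bx + By) ≡ ½ * ε →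
                   ∣ b ∣ ≤ By → ∣ c ∣ ≤ Bx → ∣ a - c ∣ ≤ δ → ∣ b - d ∣ ≤ δ →
                   ∣ a * b - c * d ∣ ≤ ε
  product-cauchy {a} {b} {c} {d} {Bx} {By} {δ} {ε} 0<Bx 0<By δB≡ b≤ c≤ ac bd = begin
    ∣ a * b - c * d ∣ ≤⟨ product-close {a} {b} {c} {d} {Bx + By} {δ} (ℚₚ.≤-trans b≤ By≤) (ℚₚ.≤-trans c≤ Bx≤) ac bd ⟩
    δ * (Bx + By) + (Bx + By) * δ ≡⟨ cong₂ _+_ δB≡ (trans (ℚₚ.*-comm (Bx + By) δ) δB≡) ⟩
    ½ * ε + ½ * ε     ≡⟨ halves ε ⟩
    ε                 ∎
    where
    By≤ : By ≤ Bx + By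
    By≤ = subst (_≤ Bx + By) (ℚₚ.+-identityˡ By) (ℚₚ.+-monoˡ-≤ By (ℚₚ.<⇒≤ 0<Bx))
    Bx≤ : Bx ≤ Bx + By
    Bx≤ = subst (_≤ Bx + By) (ℚₚ.+-identityʳ Bx) (ℚₚ.+-monoʳ-≤ Bx (ℚₚ.<⇒≤ 0<By))

  divide : ∀ B ε → 0ℚ < B → 0ℚ < ε → ∃[ δ ] 0ℚ < δ × δ * B ≡ ε
  divide B ε 0<B 0<ε = ε * inv , *-pos 0<ε (ℚₚ.positive⁻¹ inv {{ℚₚ.1/pos⇒pos B}}) ,
    trans (ℚₚ.*-assoc ε inv B) (trans (cong (ε *_) (ℚₚ.*-inverseˡ B)) (ℚₚ.*-identityʳ ε))
    where
    instance
      B-pos = ℚ.positive 0<B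
      B-nonZero = ℚₚ.pos⇒nonZero B
    inv = 1/ B

open RationalLemmas

-- Real numbers: Cauchy sequences of rationals, with termwise operations and
-- equality _≃_ (the difference tends to 0).

record ℝ : Set where
  constructor mkℝ
  field
    seq    : ℕ → ℚ
    cauchy : ∀ ε → 0ℚ ℚ.< ε →
             ∃[ N ] ∀ m n → N ℕ.≤ m → N ℕ.≤ n → ∣ seq m ℚ.- seq n ∣ ℚ.≤ ε

open ℝ public

infix  4 _≃_ _≤_ _<_
infixl 6 _+_ _-_
infixl 7 _*_
infix  8 -_
infixr 9 _^_

_≃_ : ℝ → ℝ → Set
x ≃ y = ∀ ε → 0ℚ ℚ.< ε → ∃[ N ] ∀ n → N ℕ.≤ n → ∣ seq x n ℚ.- seq y n ∣ ℚ.≤ ε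

_≤_ : ℝ → ℝ → Set
x ≤ y = ∀ ε → 0ℚ ℚ.< ε → ∃[ N ] ∀ n → N ℕ.≤ n → seq x n ℚ.≤ seq y n ℚ.+ ε

_<_ : ℝ → ℝ → Set
x < y = ∃[ ε ] 0ℚ ℚ.< ε × ∃[ N ] ∀ n → N ℕ.≤ n → seq x n ℚ.+ ε ℚ.≤ seq y n

fromℚ : ℚ → ℝ
fromℚ q = mkℝ (λ _ → q) λ ε 0<ε → 0 , λ _ _ _ _ →
  subst (ℚ._≤ ε) (sym (cong ∣_∣ (ℚₚ.+-inverseʳ q))) (ℚₚ.<⇒≤ 0<ε)

fromℕ : ℕ → ℝ
fromℕ n = fromℚ (+ n / 1)

_+_ : ℝ → ℝ → ℝ
seq    (x + y) n     = seq x n ℚ.+ seq y n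
cauchy (x + y) ε 0<ε = N₁ ℕ.⊔ N₂ , λ m n N≤m N≤n → ℚₚ.≤-trans
    (sum-close (seq x m) (seq y m) (seq x n) (seq y n))
    (subst (_ ℚ.≤_) (halves ε) (ℚₚ.+-mono-≤
      (p₁ m n (ℕₚ.m⊔n≤o⇒m≤o N₁ N₂ N≤m) (ℕₚ.m⊔n≤o⇒m≤o N₁ N₂ N≤n))
      (p₂ m n (ℕₚ.m⊔n≤o⇒n≤o N₁ N₂ N≤m) (ℕₚ.m⊔n≤o⇒n≤o N₁ N₂ N≤n))))
  where
  c₁ = cauchy x (½ ℚ.* ε) (half>0 0<ε) ; N₁ = proj₁ c₁ ; p₁ = proj₂ c₁
  c₂ = cauchy y (½ ℚ.* ε) (half>0 0<ε) ; N₂ = proj₁ c₂ ; p₂ = proj₂ c₂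

-_ : ℝ → ℝ
seq    (- x) n     = ℚ.- seq x n
cauchy (- x) ε 0<ε = proj₁ c , λ m n N≤m N≤n →
    subst (ℚ._≤ ε) (trans (∣∣-sym (seq x m) (seq x n)) (cong ∣_∣ (eq (seq x m) (seq x n))))
      (proj₂ c m n N≤m N≤n)
  where
  c = cauchy x ε 0<ε
  open +-*-Solver
  eq : ∀ a b → b ℚ.- a ≡ (ℚ.- a) ℚ.- (ℚ.- b)
  eq = solve 2 (λ a b → b :- a := :- a :- (:- b)) refl

_-_ : ℝ → ℝ → ℝ
x - y = x + (- y)

bounded : ∀ x → ∃[ B ] 0ℚ ℚ.< B × ∃[ N ] ∀ n → N ℕ.≤ n → ∣ seq x n ∣ ℚ.≤ B
bounded x = 1ℚ ℚ.+ ∣ seq x N ∣ , ℚₚ.+-mono-<-≤ (ℚₚ.positive⁻¹ 1ℚ) (ℚₚ.0≤∣p∣ (seq x N)) , N ,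
    λ n N≤n → ℚₚ.≤-trans (near-bound (seq x n) (seq x N))
      (ℚₚ.+-monoˡ-≤ ∣ seq x N ∣ (proj₂ c n N N≤n ℕₚ.≤-refl))
  where
  c = cauchy x 1ℚ (ℚₚ.positive⁻¹ 1ℚ)
  N = proj₁ c

*-cauchy : ∀ x y ε → 0ℚ ℚ.< ε →
           (∃[ Bx ] 0ℚ ℚ.< Bx × ∃[ N ] ∀ n → N ℕ.≤ n → ∣ seq x n ∣ ℚ.≤ Bx) →
           (∃[ By ] 0ℚ ℚ.< By × ∃[ N ] ∀ n → N ℕ.≤ n → ∣ seq y n ∣ ℚ.≤ By) →
           ∃[ N ] ∀ m n → N ℕ.≤ m → N ℕ.≤ n →
           ∣ seq x m ℚ.* seq y m ℚ.- seq x n ℚ.* seq y n ∣ ℚ.≤ ε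
*-cauchy x y ε 0<ε (Bx , 0<Bx , Mx , bx) (By , 0<By , My , by) =
  choose (divide (Bx ℚ.+ By) (½ ℚ.* ε) (ℚₚ.+-mono-< 0<Bx 0<By) (half>0 0<ε))
  where
  choose : ∃[ δ ] 0ℚ ℚ.< δ × δ ℚ.* (Bx ℚ.+ By) ≡ ½ ℚ.* ε →
           ∃[ N ] ∀ m n → N ℕ.≤ m → N ℕ.≤ n →
           ∣ seq x m ℚ.* seq y m ℚ.- seq x n ℚ.* seq y n ∣ ℚ.≤ ε
  choose (δ , 0<δ , δB≡) = M ℕ.⊔ N , λ m n ≤m ≤n →
    product-cauchy {seq x m} {seq y m} {seq x n} {seq y n} {Bx} {By} {δ} {ε} 0<Bx 0<By δB≡
      (by m (ℕₚ.m⊔n≤o⇒n≤o Mx My (l ≤m)))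
      (bx n (ℕₚ.m⊔n≤o⇒m≤o Mx My (l ≤n)))
      (proj₂ cx m n (ℕₚ.m⊔n≤o⇒m≤o (proj₁ cx) (proj₁ cy) (r ≤m)) (ℕₚ.m⊔n≤o⇒m≤o (proj₁ cx) (proj₁ cy) (r ≤n)))
      (proj₂ cy m n (ℕₚ.m⊔n≤o⇒n≤o (proj₁ cx) (proj₁ cy) (r ≤m)) (ℕₚ.m⊔n≤o⇒n≤o (proj₁ cx) (proj₁ cy) (r ≤n)))
    where
    cx = cauchy x δ 0<δ
    cy = cauchy y δ 0<δ
    M = Mx ℕ.⊔ My
    N = proj₁ cx ℕ.⊔ proj₁ cy
    l : ∀ {k} → M ℕ.⊔ N ℕ.≤ k → M ℕ.≤ k
    l = ℕₚ.m⊔n≤o⇒m≤o M N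
    r : ∀ {k} → M ℕ.⊔ N ℕ.≤ k → N ℕ.≤ k
    r = ℕₚ.m⊔n≤o⇒n≤o M N

_*_ : ℝ → ℝ → ℝ
seq    (x * y) n     = seq x n ℚ.* seq y n
cauchy (x * y) ε 0<ε = *-cauchy x y ε 0<ε (bounded x) (bounded y)

_^_ : ℝ → ℕ → ℝ
x ^ zero  = fromℕ 1
x ^ suc m = x * x ^ m

-- expTerm q j = qʲ/j!  and  expSum q m = Σ_{j<m} qʲ/j!

expTerm : ℚ → ℕ → ℚ
expTerm q zero    = 1ℚ
expTerm q (suc j) = expTerm q j ℚ.* (q ℚ.* (+ 1 / suc j))

expSum : ℚ → ℕ → ℚ
expSum q zero    = 0ℚ
expSum q (suc m) = expSum q m ℚ.+ expTerm q m

module ExpLemmas where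
  open Data.Rational.Base using () renaming (_+_ to _⊕_; _*_ to _⊛_; _-_ to _⊖_; _≤_ to _≼_; _<_ to _≺_)
  open +-*-Solver
  open ℚₚ.≤-Reasoning

  recip≥0 : ∀ j → 0ℚ ≼ + 1 / suc j
  recip≥0 j = ℚₚ.nonNegative⁻¹ (+ 1 / suc j) {{ℚₚ.normalize-nonNeg 1 (suc j)}}

  ratio-abs : ∀ q j → ∣ q ⊛ (+ 1 / suc j) ∣ ≡ ∣ q ∣ ⊛ (+ 1 / suc j)
  ratio-abs q j = trans (ℚₚ.∣p*q∣≡∣p∣*∣q∣ q (+ 1 / suc j))
    (cong (∣ q ∣ ⊛_) (ℚₚ.0≤p⇒∣p∣≡p (recip≥0 j)))

  term-suc : ∀ q j → ∣ expTerm q (suc j) ∣ ≡ ∣ expTerm q j ∣ ⊛ (∣ q ∣ ⊛ (+ 1 / suc j))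
  term-suc q j = trans (ℚₚ.∣p*q∣≡∣p∣*∣q∣ (expTerm q j) _) (cong (∣ expTerm q j ∣ ⊛_) (ratio-abs q j))

  term-bound : ∀ b j → ∃[ K ] ∀ q → ∣ q ∣ ≼ ι b → ∣ expTerm q j ∣ ≼ K
  term-bound b zero    = 1ℚ , λ q _ → ℚₚ.≤-refl
  term-bound b (suc j) with term-bound b j
  ... | K , p = K ⊛ (ι b ⊛ (+ 1 / suc j)) , λ q q≤ → begin
    ∣ expTerm q (suc j) ∣                   ≡⟨ term-suc q j ⟩
    ∣ expTerm q j ∣ ⊛ (∣ q ∣ ⊛ (+ 1 / suc j)) ≤⟨ *-monoˡ (ℚₚ.0≤∣p∣ (expTerm q j)) (*-monoʳ (recip≥0 j) q≤) ⟩
    ∣ expTerm q j ∣ ⊛ (ι b ⊛ (+ 1 / suc j)) ≤⟨ *-monoʳ (nn j) (p q q≤) ⟩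
    K ⊛ (ι b ⊛ (+ 1 / suc j))               ∎
    where
    nn : ∀ j → 0ℚ ≼ ι b ⊛ (+ 1 / suc j)
    nn j = subst (_≼ ι b ⊛ (+ 1 / suc j)) (ℚₚ.*-zeroʳ (ι b)) (*-monoˡ (ι-nonNeg b) (recip≥0 j))

  -- Beyond index b+b the terms at least halve at each step.
  module _ (b : ℕ) (q : ℚ) (q≤ : ∣ q ∣ ≼ ι b) where
    T : ℕ → ℚ
    T i = ∣ expTerm q (i ℕ.+ (b ℕ.+ b)) ∣

    ι-double : ∀ b → ι (b ℕ.+ b) ≡ ι b ⊕ ι b
    ι-double b = go b
      where
      go : ∀ a → ι (a ℕ.+ b) ≡ ι a ⊕ ι b
      go zero    = sym (ℚₚ.+-identityˡ (ι b))
      go (suc a) = trans (ι-suc (a ℕ.+ b)) (trans (cong (1ℚ ⊕_) (go a))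
        (trans (sym (ℚₚ.+-assoc 1ℚ (ι a) (ι b))) (cong (_⊕ ι b) (sym (ι-suc a)))))

    ratio≤½ : ∀ i → ∣ q ∣ ⊛ (+ 1 / suc (i ℕ.+ (b ℕ.+ b))) ≼ ½
    ratio≤½ i = begin
      ∣ q ∣ ⊛ r             ≤⟨ *-monoʳ (recip≥0 j) q≤ ⟩
      ι b ⊛ r               ≡⟨ cong (_⊛ r) (trans (sym (halves (ι b))) (trans (sym (ℚₚ.*-distribˡ-+ ½ (ι b) (ι b))) (cong (½ ⊛_) (sym (ι-double b))))) ⟩
      ½ ⊛ ι (b ℕ.+ b) ⊛ r   ≤⟨ *-monoʳ (recip≥0 j) (*-monoˡ (ℚₚ.nonNegative⁻¹ ½) (ι-mono (b ℕ.+ b) (suc i))) ⟩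
      ½ ⊛ ι (suc j) ⊛ r     ≡⟨ ℚₚ.*-assoc ½ (ι (suc j)) r ⟩
      ½ ⊛ (ι (suc j) ⊛ r)   ≡⟨ cong (½ ⊛_) (ι-inv j) ⟩
      ½ ⊛ 1ℚ                ≡⟨⟩
      ½                     ∎
      where
      j = i ℕ.+ (b ℕ.+ b)
      r = + 1 / suc j

    T-half : ∀ i → T (suc i) ≼ T i ⊛ ½
    T-half i = begin
      T (suc i) ≡⟨ term-suc q (i ℕ.+ (b ℕ.+ b)) ⟩
      T i ⊛ (∣ q ∣ ⊛ (+ 1 / suc (i ℕ.+ (b ℕ.+ b)))) ≤⟨ *-monoˡ (ℚₚ.0≤∣p∣ (expTerm q (i ℕ.+ (b ℕ.+ b)))) (ratio≤½ i) ⟩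
      T i ⊛ ½ ∎

    T-decay : ∀ i → T i ⊛ ι (suc i) ≼ T 0
    T-decay zero    = ℚₚ.≤-reflexive (ℚₚ.*-identityʳ (T 0))
    T-decay (suc i) = begin
      T (suc i) ⊛ ι (suc (suc i))  ≤⟨ *-monoʳ (ι-nonNeg (suc (suc i))) (T-half i) ⟩
      T i ⊛ ½ ⊛ ι (suc (suc i))    ≡⟨ ℚₚ.*-assoc (T i) ½ _ ⟩
      T i ⊛ (½ ⊛ ι (suc (suc i)))  ≤⟨ *-monoˡ (ℚₚ.0≤∣p∣ (expTerm q (i ℕ.+ (b ℕ.+ b)))) half ⟩
      T i ⊛ ι (suc i)              ≤⟨ T-decay i ⟩
      T 0                          ∎
      where
      a = ι (suc i)
      1≤a : 1ℚ ≼ a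
      1≤a = subst (λ z → ι 1 ≼ ι z) (ℕₚ.+-comm i 1) (ι-mono 1 i)
      half : ½ ⊛ ι (suc (suc i)) ≼ a
      half = begin
        ½ ⊛ ι (suc (suc i)) ≡⟨ cong (½ ⊛_) (ι-suc (suc i)) ⟩
        ½ ⊛ (1ℚ ⊕ a)        ≤⟨ *-monoˡ (ℚₚ.nonNegative⁻¹ ½) (ℚₚ.+-monoˡ-≤ a 1≤a) ⟩
        ½ ⊛ (a ⊕ a)         ≡⟨ trans (ℚₚ.*-distribˡ-+ ½ a a) (halves a) ⟩
        a                   ∎

    S : ℕ → ℚ
    S i = expSum q (i ℕ.+ (b ℕ.+ b))

    tail-step : ∀ i d → ∣ S (d ℕ.+ i) ⊖ S i ∣ ⊕ (T (d ℕ.+ i) ⊕ T (d ℕ.+ i)) ≼ T i ⊕ T i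
    tail-step i zero = ℚₚ.≤-reflexive (trans (cong (λ z → ∣ z ∣ ⊕ (T i ⊕ T i)) (ℚₚ.+-inverseʳ (S i)))
      (ℚₚ.+-identityˡ _))
    tail-step i (suc d) = begin
      ∣ S (suc e) ⊖ S i ∣ ⊕ (T (suc e) ⊕ T (suc e))
        ≤⟨ ℚₚ.+-mono-≤ (triangle (S (suc e)) (S e) (S i)) (ℚₚ.+-mono-≤ (T-half e) (T-half e)) ⟩
      (∣ S (suc e) ⊖ S e ∣ ⊕ ∣ S e ⊖ S i ∣) ⊕ (T e ⊛ ½ ⊕ T e ⊛ ½)
        ≡⟨ cong₂ (λ u v → (u ⊕ ∣ S e ⊖ S i ∣) ⊕ v) step
             (trans (cong₂ _⊕_ (ℚₚ.*-comm (T e) ½) (ℚₚ.*-comm (T e) ½)) (halves (T e))) ⟩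
      (T e ⊕ ∣ S e ⊖ S i ∣) ⊕ T e
        ≡⟨ solve 2 (λ t s → (t :+ s) :+ t := s :+ (t :+ t)) refl (T e) ∣ S e ⊖ S i ∣ ⟩
      ∣ S e ⊖ S i ∣ ⊕ (T e ⊕ T e)
        ≤⟨ tail-step i d ⟩
      T i ⊕ T i ∎
      where
      e = d ℕ.+ i
      step : ∣ S (suc e) ⊖ S e ∣ ≡ T e
      step = cong ∣_∣ (solve 2 (λ s t → (s :+ t) :- s := t) refl (S e) (expTerm q (e ℕ.+ (b ℕ.+ b))))

    tail-bound : ∀ i d → ∣ S (d ℕ.+ i) ⊖ S i ∣ ≼ T i ⊕ T i
    tail-bound i d = begin
      ∣ S (d ℕ.+ i) ⊖ S i ∣       ≡⟨ ℚₚ.+-identityʳ _ ⟨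
      ∣ S (d ℕ.+ i) ⊖ S i ∣ ⊕ 0ℚ  ≤⟨ ℚₚ.+-monoʳ-≤ ∣ S (d ℕ.+ i) ⊖ S i ∣ (ℚₚ.+-mono-≤ (T≥0 (d ℕ.+ i)) (T≥0 (d ℕ.+ i))) ⟩
      ∣ S (d ℕ.+ i) ⊖ S i ∣ ⊕ (T (d ℕ.+ i) ⊕ T (d ℕ.+ i)) ≤⟨ tail-step i d ⟩
      T i ⊕ T i ∎
      where
      T≥0 : ∀ i → 0ℚ ≼ T i
      T≥0 i = ℚₚ.0≤∣p∣ (expTerm q (i ℕ.+ (b ℕ.+ b)))

  uniform-tail : ∀ b ε → 0ℚ ≺ ε → ∃[ N ] ∀ q → ∣ q ∣ ≼ ι b → ∀ m → N ℕ.≤ m →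
                 ∣ expSum q m ⊖ expSum q N ∣ ≼ ε
  uniform-tail b ε 0<ε with term-bound b (b ℕ.+ b)
  ... | K , K-bound with divide (½ ⊛ ε) 1ℚ (half>0 0<ε) (ℚₚ.positive⁻¹ 1ℚ)
  ... | ρ , 0<ρ , ρε with archimedean (K ⊛ ρ)
  ... | i , Kρ≤i = i ℕ.+ (b ℕ.+ b) , λ q q≤ m N≤m →
    subst (λ z → ∣ expSum q z ⊖ expSum q (i ℕ.+ (b ℕ.+ b)) ∣ ≼ ε) (index m N≤m)
      (ℚₚ.≤-trans (tail-bound b q q≤ i (m ℕ.∸ (i ℕ.+ (b ℕ.+ b))))
        (subst (T b q q≤ i ⊕ T b q q≤ i ≼_) (halves ε) (ℚₚ.+-mono-≤ (small q q≤) (small q q≤))))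
    where
    index : ∀ m → i ℕ.+ (b ℕ.+ b) ℕ.≤ m → ((m ℕ.∸ (i ℕ.+ (b ℕ.+ b))) ℕ.+ i) ℕ.+ (b ℕ.+ b) ≡ m
    index m N≤m = trans (ℕₚ.+-assoc (m ℕ.∸ (i ℕ.+ (b ℕ.+ b))) i (b ℕ.+ b)) (ℕₚ.m∸n+n≡m N≤m)
    ε/2 = ½ ⊛ ε
    small : ∀ q (q≤ : ∣ q ∣ ≼ ι b) → T b q q≤ i ≼ ε/2
    small q q≤ = ℚₚ.*-cancelʳ-≤-pos (ι (suc i)) {{ℚₚ.normalize-pos (suc i) 1}} (begin
      T b q q≤ i ⊛ ι (suc i) ≤⟨ T-decay b q q≤ i ⟩
      T b q q≤ 0             ≤⟨ K-bound q q≤ ⟩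
      K                      ≡⟨ trans (ℚₚ.*-assoc K ρ ε/2) (trans (cong (K ⊛_) ρε) (ℚₚ.*-identityʳ K)) ⟨
      K ⊛ ρ ⊛ ε/2            ≤⟨ *-monoʳ (ℚₚ.<⇒≤ (half>0 0<ε)) (ℚₚ.≤-trans Kρ≤i (ι-mono i 1)) ⟩
      ι (suc i) ⊛ ε/2        ≡⟨ ℚₚ.*-comm (ι (suc i)) ε/2 ⟩
      ε/2 ⊛ ι (suc i)        ∎)

  termℝ : ℝ → ℕ → ℝ
  termℝ x zero    = fromℚ 1ℚ
  termℝ x (suc j) = termℝ x j * (x * fromℚ (+ 1 / suc j))

  sumℝ : ℝ → ℕ → ℝ
  sumℝ x zero    = fromℚ 0ℚ
  sumℝ x (suc m) = sumℝ x m + termℝ x m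

  seq-term : ∀ x j n → seq (termℝ x j) n ≡ expTerm (seq x n) j
  seq-term x zero    n = refl
  seq-term x (suc j) n = cong (_⊛ (seq x n ⊛ (+ 1 / suc j))) (seq-term x j n)

  seq-sum : ∀ x m n → seq (sumℝ x m) n ≡ expSum (seq x n) m
  seq-sum x zero    n = refl
  seq-sum x (suc m) n = cong₂ _⊕_ (seq-sum x m n) (seq-term x m n)

  four-terms : ∀ {a a′ b b′ ε} → ∣ a ⊖ a′ ∣ ≼ ½ ⊛ (½ ⊛ ε) → ∣ a′ ⊖ b′ ∣ ≼ ½ ⊛ ε →
               ∣ b ⊖ b′ ∣ ≼ ½ ⊛ (½ ⊛ ε) → ∣ a ⊖ b ∣ ≼ ε
  four-terms {a} {a′} {b} {b′} {ε} p q r = begin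
    ∣ a ⊖ b ∣                                  ≤⟨ triangle a a′ b ⟩
    ∣ a ⊖ a′ ∣ ⊕ ∣ a′ ⊖ b ∣                    ≤⟨ ℚₚ.+-mono-≤ p (triangle a′ b′ b) ⟩
    ε/4 ⊕ (∣ a′ ⊖ b′ ∣ ⊕ ∣ b′ ⊖ b ∣)           ≤⟨ ℚₚ.+-monoʳ-≤ ε/4 (ℚₚ.+-mono-≤ q (subst (_≼ ε/4) (∣∣-sym b b′) r)) ⟩
    ε/4 ⊕ (½ ⊛ ε ⊕ ε/4)                        ≡⟨ cong (ε/4 ⊕_) (ℚₚ.+-comm (½ ⊛ ε) ε/4) ⟩
    ε/4 ⊕ (ε/4 ⊕ ½ ⊛ ε)                        ≡⟨ ℚₚ.+-assoc ε/4 ε/4 (½ ⊛ ε) ⟨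
    (ε/4 ⊕ ε/4) ⊕ ½ ⊛ ε                        ≡⟨ cong (_⊕ ½ ⊛ ε) (halves (½ ⊛ ε)) ⟩
    ½ ⊛ ε ⊕ ½ ⊛ ε                              ≡⟨ halves ε ⟩
    ε                                          ∎
    where
    ε/4 = ½ ⊛ (½ ⊛ ε)

  exp-cauchy : ∀ x ε → 0ℚ ≺ ε → ∃[ N ] ∀ m n → N ℕ.≤ m → N ℕ.≤ n →
               ∣ expSum (seq x m) m ⊖ expSum (seq x n) n ∣ ≼ ε
  exp-cauchy x ε 0<ε = N , λ m n N≤m N≤n →
    four-terms {expSum (seq x m) m} {expSum (seq x m) N₁} {expSum (seq x n) n} {expSum (seq x n) N₁}
      (end m N≤m) (middle m n N≤m N≤n) (end n N≤n)
    where
    B  = proj₁ (bounded x)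
    N₀ = proj₁ (proj₂ (proj₂ (bounded x)))
    b  = proj₁ (archimedean B)
    ut : ∃[ N ] ∀ q → ∣ q ∣ ≼ ι b → ∀ m → N ℕ.≤ m → ∣ expSum q m ⊖ expSum q N ∣ ≼ ½ ⊛ (½ ⊛ ε)
    ut = uniform-tail b (½ ⊛ (½ ⊛ ε)) (half>0 (half>0 0<ε))
    N₁ = proj₁ ut
    mid = cauchy (sumℝ x N₁) (½ ⊛ ε) (half>0 0<ε)
    N₂ = proj₁ mid
    N = N₀ ℕ.⊔ (N₁ ℕ.⊔ N₂)
    r : ∀ {k} → N ℕ.≤ k → N₁ ℕ.⊔ N₂ ℕ.≤ k
    r = ℕₚ.m⊔n≤o⇒n≤o N₀ (N₁ ℕ.⊔ N₂)
    end : ∀ m → N ℕ.≤ m → ∣ expSum (seq x m) m ⊖ expSum (seq x m) N₁ ∣ ≼ ½ ⊛ (½ ⊛ ε)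
    end m N≤m = proj₂ ut (seq x m)
      (ℚₚ.≤-trans (proj₂ (proj₂ (proj₂ (bounded x))) m (ℕₚ.m⊔n≤o⇒m≤o N₀ (N₁ ℕ.⊔ N₂) N≤m))
                  (proj₂ (archimedean B)))
      m (ℕₚ.m⊔n≤o⇒m≤o N₁ N₂ (r N≤m))
    middle : ∀ m n → N ℕ.≤ m → N ℕ.≤ n →
             ∣ expSum (seq x m) N₁ ⊖ expSum (seq x n) N₁ ∣ ≼ ½ ⊛ ε
    middle m n N≤m N≤n = subst₂ (λ u v → ∣ u ⊖ v ∣ ≼ ½ ⊛ ε) (seq-sum x N₁ m) (seq-sum x N₁ n)
      (proj₂ mid m n (ℕₚ.m⊔n≤o⇒n≤o N₁ N₂ (r N≤m)) (ℕₚ.m⊔n≤o⇒n≤o N₁ N₂ (r N≤n)))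

-- Diagonal of the partial sums: they converge locally uniformly.
exp : ℝ → ℝ
seq    (exp x) m = expSum (seq x m) m
cauchy (exp x)   = ExpLemmas.exp-cauchy x

-- Quotients, roots and logarithms are given by their graphs.  On the arguments
-- they are applied to (positive divisors, non-negative radicands, positive
-- numbers) each of these relations holds for a first argument unique up to _≃_.

IsQuotient : ℝ → ℝ → ℝ → Set
IsQuotient q x y = q * y ≃ x

IsRoot : ℕ → ℝ → ℝ → Set
IsRoot m r x = fromℕ 0 ≤ r × r ^ m ≃ x

IsLog : ℝ → ℝ → Set
IsLog ℓ x = exp ℓ ≃ x

record Configuration (k n : ℕ) : Set where
  field
    counts : Vec ℕ k
    total  : sum counts ≡ n

open Configuration public

NonIncreasing : ∀ {k n} → Configuration k n → Set
NonIncreasing c = ∀ i j → i Fin.≤ j → lookup (counts c) j ℕ.≤ lookup (counts c) i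

largest : ∀ {k n} → Configuration (suc k) n → ℕ
largest c = head (counts c)

-- A single color has no competitor: its c₂ is taken to be 0.
second : ∀ {k n} → Configuration (suc k) n → ℕ
second {zero}  c = 0
second {suc k} c = head (Vec.tail (counts c))

bias : ∀ {k n} → Configuration (suc k) n → ℝ
bias c = fromℕ (largest c) - fromℕ (second c)

Coloring : ℕ → ℕ → Set
Coloring n k = Fin n → Fin k

colorCount : ∀ {n k} → Coloring n k → Fin k → ℕ
colorCount {n} x j = length (filter (λ v → x v ≟ j) (allFin n))

_HasConfiguration_ : ∀ {n k} → Coloring n k → Configuration k n → Set
x HasConfiguration c = ∀ j → colorCount x j ≡ lookup (counts c) j

majority : ∀ {k} → Fin k → Fin k → Fin k → Fin k
majority a b c =
  if does (a ≟ b) ∨ does (a ≟ c) then a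
  else if does (b ≟ c) then b
  else a

Picks : ℕ → Set
Picks n = Fin n × Fin n × Fin n

-- The random choices of one round: the three nodes picked by each node.
Round : ℕ → Set
Round n = Vec (Picks n) n

step : ∀ {n k} → Round n → Coloring n k → Coloring n k
step ω x v = let (a , b , c) = lookup ω v in majority (x a) (x b) (x c)

-- Color 1 is the index zero.
AllPlurality : ∀ {n k} → Coloring n (suc k) → Set
AllPlurality x = ∀ v → x v ≡ zero

-- The all-color-1 state is visited at some time 0 ≤ t ≤ T.
Reaches : ∀ {n k T} → Coloring n (suc k) → Vec (Round n) T → Set
Reaches x []       = AllPlurality x
Reaches x (ω ∷ ωs) = AllPlurality x ⊎ Reaches (step ω x) ωs

reaches? : ∀ {n k T} (x : Coloring n (suc k)) → Decidable (Reaches {T = T} x)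
reaches? x []       = all? (λ v → x v ≟ zero)
reaches? x (ω ∷ ωs) = all? (λ v → x v ≟ zero) ⊎-dec reaches? (step ω x) ωs

vectors : ∀ {A : Set} → List A → ∀ m → List (Vec A m)
vectors xs zero    = [] ∷ []
vectors xs (suc m) = cartesianProductWith _∷_ xs (vectors xs m)

picks : ∀ n → List (Picks n)
picks n = cartesianProduct (allFin n) (cartesianProduct (allFin n) (allFin n))

-- All sequences of choices for T rounds, each listed once; independent uniform
-- picks make them equally likely.
outcomes : ∀ n T → List (Vec (Round n) T)
outcomes n T = vectors (vectors (picks n) n) T

length-product : ∀ {A B C : Set} (f : A → B → C) xs ys →
                 length (cartesianProductWith f xs ys) ≡ length xs ℕ.* length ys
length-product f []       ys = refl
length-product f (x ∷ xs) ys = trans (length-++ (Data.List.Base.map (f x) ys))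
  (cong₂ ℕ._+_ (length-map (f x) ys) (length-product f xs ys))

length-vectors : ∀ {A : Set} (xs : List A) m → length (vectors xs m) ≡ length xs ℕ.^ m
length-vectors xs zero    = refl
length-vectors xs (suc m) = trans (length-product _∷_ xs (vectors xs m))
  (cong (length xs ℕ.*_) (length-vectors xs m))

vectors-nonZero : ∀ {A : Set} (xs : List A) m → ℕ.NonZero (length xs) →
                  ℕ.NonZero (length (vectors xs m))
vectors-nonZero xs m nz = subst ℕ.NonZero (sym (length-vectors xs m))
  (ℕₚ.m^n≢0 (length xs) m {{nz}})

outcomes-nonZero : ∀ n T → ℕ.NonZero (length (outcomes n T))
outcomes-nonZero zero    T = vectors-nonZero (vectors (picks 0) 0) T _
outcomes-nonZero (suc n) T =
  vectors-nonZero (vectors (picks (suc n)) (suc n)) T (vectors-nonZero (picks (suc n)) (suc n) _)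

uniformProbability : ∀ {A : Set} {P : Pred A 0ℓ} (xs : List A) .{{_ : ℕ.NonZero (length xs)}} →
                     Decidable P → ℚ
uniformProbability xs P? = + length (filter P? xs) / length xs

-- The probability that 3-majority started from x reaches the all-color-1
-- state within at most T rounds.
consensusProbability : ∀ {n k} → Coloring n (suc k) → ℕ → ℚ
consensusProbability {n} x T =
  uniformProbability (outcomes n T) {{outcomes-nonZero n T}} (reaches? x)

module Submission where

-- Only the smallest admissible value λ = n / c₁ matters, and then the bias
-- hypothesis reads s² c₁ ≥ 1152 n² log n.  With S = Σ_j c_j², a node adopts color j
-- with probability (n² c_j + n c_j² - c_j S) / n³.  As long as c₁ < 2n/3, the expected
-- lead of color 1 over any other color grows by a factor 1 + Ω(c₁/n), while c₁ itself
-- does not decrease; an exponential-moment bound with rate m ≈ 12 n / s shows that a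
-- fixed fraction of this growth is realised against each color with failure
-- probability 2^(-6ℓ), where 3^ℓ ≤ n < 3^(ℓ+1).  After O(λ log n) rounds the lead
-- would exceed n, so c₁ ≥ 2n/3 has been reached.  From there on the expected number
-- of nodes not colored 1 shrinks by 7/9 per round, and Markov's inequality finishes.
-- All of this is integer counting of outcomes; logarithms enter only through
-- ℓ ≤ log n and exp (-log n) = 1/n, both from the functional equation of exp.

open import Data.Fin.Base using (Fin; zero; suc)
import Data.Integer.Base as ℤ
import Data.Integer.Properties as ℤₚ
open import Data.List.Base as List using (List; []; _∷_; _++_; length; filter; allFin; cartesianProduct; cartesianProductWith)
open import Data.Nat.Base as ℕ using (ℕ; zero; suc; z≤n; s≤s)
import Data.Nat.Properties as ℕₚ
open import Data.Nat.Tactic.RingSolver using (solve-∀)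
open import Data.Product.Base using (∃-syntax; _×_; _,_; proj₁; proj₂)
open import Data.Rational.Base as ℚ using (ℚ; 0ℚ; 1ℚ; ½; ∣_∣)
import Data.Rational.Properties as ℚₚ
open import Data.Rational.Solver using (module +-*-Solver)
import Data.Rational.Unnormalised.Base as ℚᵘ
import Data.Rational.Unnormalised.Properties as ℚᵘₚ
open import Data.Sum.Base using (_⊎_; inj₁; inj₂)
open import Data.Vec.Base as Vec using (Vec; []; _∷_; lookup)
open import Function.Base using (_∘_; id)
open import Relation.Binary.PropositionalEquality
open import Relation.Nullary using (Dec; yes; no; does; ¬_; contradiction)
open import Relation.Nullary.Decidable using (¬?; _×-dec_; decidable-stable)
open import Relation.Unary using (Pred; Decidable)

-- The obstacle is to run Chernoff's method inside ℕ. The moment generating function is replaced by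
-- an integer weight that is linear in two indicators `f`, `g` and still equals
-- `m(m+1)((m+1)/m)^(g - f)`, because at most one of them is 1; its sum over all picks then depends
-- on two pick counts only. What remains is measured in powers of `1 - 1/Z` with `Z = m(m+1)n³`, the
-- integer stand-in for `e^(-1/Z)`. The exponent 6 in `2^(6ℓ)` is forced by the union bound: order
-- `λ ℓ` rounds with `n + 1` bad events each, times the `n` of the target error `1/n`, amount to
-- order `n³ ℓ`, and `27^ℓ · 2^ℓ = 54^ℓ ≤ 64^ℓ`. The hypothesis on the bias enters as
-- `24² · 2 = 1152`, to be compared with `13 · 14 · 6 = 1092` from the choice of `m`. The base 3 of
-- `ℓ` is an integer bound for `e`. Since `exp` evaluates its `m`-th partial sum at the `m`-th
-- approximation of the argument, the functional equation is established for rational partial sums,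
-- with an error that is uniform on bounded sets.

module Counting where

  open import Data.Bool.Base using (true; false; if_then_else_)
  open import Data.Fin.Properties using (_≟_; any?)
  open import Data.List.Properties using (map-++; map-∘; map-cong; map-tabulate; length-tabulate)
  open import Data.Nat.Base
  open import Data.Nat.DivMod using (m≡m%n+[m/n]*n; m%n<n; m/n*n≤m; m/n≤m)
  open import Data.Nat.ListAction using () renaming (sum to listSum)
  open import Data.Nat.ListAction.Properties using () renaming (sum-++ to listSum-++)
  open import Data.Nat.Properties hiding (_≟_)
  open import Defs using (vectors; length-vectors; length-product; Coloring; colorCount; majority; Picks; Round; step; picks;
                          AllPlurality; Reaches; reaches?; outcomes)
  open ≤-Reasoning

  -- Indicators, and sums over lists and product spaces of outcomes.

  𝟙 : {P : Set} → Dec P → ℕ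
  𝟙 d = if does d then 1 else 0

  𝟙-yes : {P : Set} (d : Dec P) → P → 𝟙 d ≡ 1
  𝟙-yes (yes _) _ = refl
  𝟙-yes (no ¬p) p = contradiction p ¬p

  𝟙-no : {P : Set} (d : Dec P) → ¬ P → 𝟙 d ≡ 0
  𝟙-no (yes p) ¬p = contradiction p ¬p
  𝟙-no (no _)  _  = refl

  𝟙≤1 : {P : Set} (d : Dec P) → 𝟙 d ≤ 1
  𝟙≤1 (yes _) = ≤-refl
  𝟙≤1 (no _)  = z≤n

  ∑ : {A : Set} → List A → (A → ℕ) → ℕ
  ∑ xs f = listSum (List.map f xs)

  module _ {A : Set} where

    ∑-cong : ∀ {f g : A → ℕ} xs → (∀ x → f x ≡ g x) → ∑ xs f ≡ ∑ xs g
    ∑-cong xs eq = cong listSum (map-cong eq xs)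

    ∑-mono : ∀ {f g : A → ℕ} xs → (∀ x → f x ≤ g x) → ∑ xs f ≤ ∑ xs g
    ∑-mono []       le = z≤n
    ∑-mono (x ∷ xs) le = +-mono-≤ (le x) (∑-mono xs le)

    ∑-+ : ∀ (f g : A → ℕ) xs → ∑ xs (λ x → f x + g x) ≡ ∑ xs f + ∑ xs g
    ∑-+ f g []       = refl
    ∑-+ f g (x ∷ xs) = trans (cong (f x + g x +_) (∑-+ f g xs)) (lemma (f x) (g x) (∑ xs f) (∑ xs g))
      where
      lemma : ∀ a b c d → a + b + (c + d) ≡ a + c + (b + d)
      lemma = solve-∀

    ∑-*ˡ : ∀ k (f : A → ℕ) xs → ∑ xs (λ x → k * f x) ≡ k * ∑ xs f
    ∑-*ˡ k f []       = sym (*-zeroʳ k)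
    ∑-*ˡ k f (x ∷ xs) = trans (cong (k * f x +_) (∑-*ˡ k f xs)) (sym (*-distribˡ-+ k (f x) (∑ xs f)))

    ∑-*ʳ : ∀ k (f : A → ℕ) xs → ∑ xs (λ x → f x * k) ≡ ∑ xs f * k
    ∑-*ʳ k f xs = trans (∑-cong xs (λ x → *-comm (f x) k)) (trans (∑-*ˡ k f xs) (*-comm k (∑ xs f)))

    ∑-const : ∀ k (xs : List A) → ∑ xs (λ _ → k) ≡ length xs * k
    ∑-const k []       = refl
    ∑-const k (x ∷ xs) = cong (k +_) (∑-const k xs)

    length-filter-≡-∑ : ∀ {P : Pred A _} (P? : Decidable P) xs → length (filter P? xs) ≡ ∑ xs (λ x → 𝟙 (P? x))
    length-filter-≡-∑ P? []       = refl
    length-filter-≡-∑ P? (x ∷ xs) with does (P? x)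
    ... | true  = cong suc (length-filter-≡-∑ P? xs)
    ... | false = length-filter-≡-∑ P? xs

  module _ {A B : Set} where

    ∑-swap : ∀ (f : A → B → ℕ) xs ys → ∑ xs (λ x → ∑ ys (f x)) ≡ ∑ ys (λ y → ∑ xs (λ x → f x y))
    ∑-swap f []       ys = sym (trans (∑-const 0 ys) (*-zeroʳ (length ys)))
    ∑-swap f (x ∷ xs) ys = trans (cong (∑ ys (f x) +_) (∑-swap f xs ys)) (sym (∑-+ (f x) _ ys))

    ∑-cartesianProductWith : ∀ {C : Set} (h : A → B → C) (f : C → ℕ) xs ys →
      ∑ (cartesianProductWith h xs ys) f ≡ ∑ xs (λ x → ∑ ys (λ y → f (h x y)))
    ∑-cartesianProductWith h f []       ys = refl
    ∑-cartesianProductWith h f (x ∷ xs) ys = begin-equality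
      listSum (List.map f (List.map (h x) ys ++ rest))                 ≡⟨ cong listSum (map-++ f (List.map (h x) ys) rest) ⟩
      listSum (List.map f (List.map (h x) ys) ++ List.map f rest)      ≡⟨ listSum-++ (List.map f (List.map (h x) ys)) _ ⟩
      ∑ (List.map (h x) ys) f + ∑ rest f                               ≡⟨ cong₂ _+_ (cong listSum (sym (map-∘ ys))) (∑-cartesianProductWith h f xs ys) ⟩
      ∑ ys (λ y → f (h x y)) + ∑ xs (λ x → ∑ ys (λ y → f (h x y)))     ∎
      where rest = cartesianProductWith h xs ys

  ∏ : ∀ {A : Set} {m} → (A → ℕ) → Vec A m → ℕ
  ∏ w []      = 1
  ∏ w (a ∷ ω) = w a * ∏ w ω

  vsum : ∀ {A : Set} {m} → (A → ℕ) → Vec A m → ℕ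
  vsum f ω = Vec.sum (Vec.map f ω)

  module _ {A : Set} where

    ∑-vectors-∏ : ∀ (w : A → ℕ) xs m → ∑ (vectors xs m) (∏ w) ≡ ∑ xs w ^ m
    ∑-vectors-∏ w xs zero    = refl
    ∑-vectors-∏ w xs (suc m) = begin-equality
      ∑ (vectors xs (suc m)) (∏ w)                            ≡⟨ ∑-cartesianProductWith _∷_ (∏ w) xs (vectors xs m) ⟩
      ∑ xs (λ x → ∑ (vectors xs m) (λ ω → w x * ∏ w ω))       ≡⟨ ∑-cong xs (λ x → ∑-*ˡ (w x) (∏ w) (vectors xs m)) ⟩
      ∑ xs (λ x → w x * ∑ (vectors xs m) (∏ w))               ≡⟨ ∑-*ʳ _ w xs ⟩
      ∑ xs w * ∑ (vectors xs m) (∏ w)                         ≡⟨ cong (∑ xs w *_) (∑-vectors-∏ w xs m) ⟩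
      ∑ xs w * ∑ xs w ^ m                                     ∎

    -- Linearity of expectation, cleared of denominators.
    ∑-vectors-vsum : ∀ (f : A → ℕ) xs m → length xs * ∑ (vectors xs m) (vsum f) ≡ m * ∑ xs f * length xs ^ m
    ∑-vectors-vsum f xs zero    = *-zeroʳ (length xs)
    ∑-vectors-vsum f xs (suc m) = begin-equality
      L * ∑ (vectors xs (suc m)) (vsum f)                    ≡⟨ cong (L *_) (∑-cartesianProductWith _∷_ (vsum f) xs (vectors xs m)) ⟩
      L * ∑ xs (λ x → ∑ (vectors xs m) (λ ω → f x + vsum f ω)) ≡⟨ cong (L *_) (∑-cong xs (λ x → ∑-+ (λ _ → f x) (vsum f) (vectors xs m))) ⟩
      L * ∑ xs (λ x → ∑ (vectors xs m) (λ ω → f x) + V)       ≡⟨ cong (L *_) (∑-cong xs (λ x → cong (_+ V) (trans (∑-const (f x) (vectors xs m)) (cong (_* f x) (length-vectors xs m))))) ⟩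
      L * ∑ xs (λ x → L ^ m * f x + V)                        ≡⟨ cong (L *_) (trans (∑-+ (λ x → L ^ m * f x) (λ _ → V) xs) (cong₂ _+_ (∑-*ˡ (L ^ m) f xs) (∑-const V xs))) ⟩
      L * (L ^ m * ∑ xs f + L * V)                            ≡⟨ cong (λ z → L * (L ^ m * ∑ xs f + z)) (∑-vectors-vsum f xs m) ⟩
      L * (L ^ m * ∑ xs f + m * ∑ xs f * L ^ m)               ≡⟨ lemma L (L ^ m) (∑ xs f) m ⟩
      suc m * ∑ xs f * L ^ suc m                              ∎
      where
      L = length xs
      V = ∑ (vectors xs m) (vsum f)
      lemma : ∀ L P F m → L * (P * F + m * F * P) ≡ suc m * F * (L * P)
      lemma = solve-∀

  -- Exponential moments

  *-swap-inner : ∀ a b c d → a * b * (c * d) ≡ a * c * (b * d)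
  *-swap-inner = solve-∀

  ^-distribʳ-* : ∀ k a b → (a * b) ^ k ≡ a ^ k * b ^ k
  ^-distribʳ-* zero    a b = refl
  ^-distribʳ-* (suc k) a b = trans (cong (a * b *_) (^-distribʳ-* k a b)) (*-swap-inner a b (a ^ k) (b ^ k))

  bernoulli : ∀ q k → (q + k) * q ^ k ≤ q * suc q ^ k
  bernoulli q zero    = ≤-reflexive (cong (_* 1) (+-identityʳ q))
  bernoulli q (suc k) = begin
    (q + suc k) * (q * q ^ k)     ≤⟨ m≤m+n _ (k * q ^ k) ⟩
    (q + suc k) * (q * q ^ k) + k * q ^ k ≡⟨ lemma q k (q ^ k) ⟩
    suc q * ((q + k) * q ^ k)     ≤⟨ *-monoʳ-≤ (suc q) (bernoulli q k) ⟩
    suc q * (q * suc q ^ k)       ≡⟨ lemma₂ q (suc q ^ k) ⟩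
    q * (suc q * suc q ^ k)       ∎
    where
    lemma : ∀ q k p → (q + suc k) * (q * p) + k * p ≡ suc q * ((q + k) * p)
    lemma = solve-∀
    lemma₂ : ∀ q p → suc q * (q * p) ≡ q * (suc q * p)
    lemma₂ = solve-∀

  -- Cleared of denominators: `a/b ≤ 1 + k/q ≤ (1 + 1/q)^k`. This converts an arbitrary ratio into a
  -- power of the single base `suc q / q`.
  bernoulli-ratio : ∀ q k a b .{{_ : NonZero q}} → a * q ≤ b * (q + k) → a * q ^ k ≤ b * suc q ^ k
  bernoulli-ratio q k a b le = *-cancelˡ-≤ q (begin
    q * (a * q ^ k)         ≡⟨ lemma q a (q ^ k) ⟩
    a * q * q ^ k           ≤⟨ *-monoˡ-≤ (q ^ k) le ⟩
    b * (q + k) * q ^ k     ≡⟨ *-assoc b (q + k) (q ^ k) ⟩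
    b * ((q + k) * q ^ k)   ≤⟨ *-monoʳ-≤ b (bernoulli q k) ⟩
    b * (q * suc q ^ k)     ≡⟨ lemma₂ b q (suc q ^ k) ⟩
    q * (b * suc q ^ k)     ∎)
    where
    lemma : ∀ q a p → q * (a * p) ≡ a * q * p
    lemma = solve-∀
    lemma₂ : ∀ b q p → b * (q * p) ≡ q * (b * p)
    lemma₂ = solve-∀

  bernoulli-ratio-^ : ∀ q k a b s .{{_ : NonZero q}} → a * q ≤ b * (q + k) →
                      a ^ s * q ^ (k * s) ≤ b ^ s * suc q ^ (k * s)
  bernoulli-ratio-^ q k a b s le = begin
    a ^ s * q ^ (k * s)       ≡⟨ cong (a ^ s *_) (^-*-assoc q k s) ⟨
    a ^ s * (q ^ k) ^ s       ≡⟨ ^-distribʳ-* s a (q ^ k) ⟨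
    (a * q ^ k) ^ s           ≤⟨ ^-monoˡ-≤ s (bernoulli-ratio q k a b le) ⟩
    (b * suc q ^ k) ^ s       ≡⟨ ^-distribʳ-* s b (suc q ^ k) ⟩
    b ^ s * (suc q ^ k) ^ s   ≡⟨ cong (b ^ s *_) (^-*-assoc (suc q) k s) ⟩
    b ^ s * suc q ^ (k * s)   ∎

  -- (1 - Y/Z) ≤ (1 - 1/Z)^Y with Z = suc q.
  bernoulli-complement : ∀ q X Y → X + Y ≡ suc q → X * suc q ^ Y ≤ suc q * q ^ Y
  bernoulli-complement q X zero    eq = ≤-reflexive (cong (_* 1) (trans (sym (+-identityʳ X)) eq))
  bernoulli-complement q X (suc Y) eq = begin
    X * (suc q * suc q ^ Y)     ≡⟨ lemma₁ X q (suc q ^ Y) ⟩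
    (X * q + X) * suc q ^ Y     ≤⟨ *-monoˡ-≤ (suc q ^ Y) (+-monoʳ-≤ (X * q) X≤q) ⟩
    (X * q + q) * suc q ^ Y     ≡⟨ lemma₂ X q (suc q ^ Y) ⟩
    q * (suc X * suc q ^ Y)     ≤⟨ *-monoʳ-≤ q (bernoulli-complement q (suc X) Y (trans (sym (+-suc X Y)) eq)) ⟩
    q * (suc q * q ^ Y)         ≡⟨ lemma₃ q (q ^ Y) ⟩
    suc q * (q * q ^ Y)         ∎
    where
    X≤q : X ≤ q
    X≤q = ≤-pred (≤-trans (s≤s (m≤m+n X Y)) (≤-reflexive (trans (sym (+-suc X Y)) eq)))
    lemma₁ : ∀ X q p → X * (suc q * p) ≡ (X * q + X) * p
    lemma₁ = solve-∀
    lemma₂ : ∀ X q p → (X * q + q) * p ≡ q * (suc X * p)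
    lemma₂ = solve-∀
    lemma₃ : ∀ q p → q * (suc q * p) ≡ suc q * (q * p)
    lemma₃ = solve-∀

  -- With `Z = suc q`, the hypothesis says `B/M^n ≤ ((m+1)/m)^s (X/Z)^n`, and `X/Z ≤ (q/Z)^Y`. The
  -- factors to be beaten are powers of the same base: `(m+1)/m ≤ (Z/q)^((m+1)M)` and `2 ≤ (Z/q)^Z`.
  -- The budget `n Y` of exponents therefore pays for `s` factors of the first kind and `e` of the
  -- second, and the surplus `t` is discarded.
  chernoff-arithmetic : ∀ q m M s e n X Y B .{{_ : NonZero q}} .{{_ : NonZero m}} →
    suc q ≡ m * suc m * M → X + Y ≡ suc q →
    suc m * M * s + suc q * e ≤ n * Y →
    B * (m * suc m) ^ n * m ^ s ≤ suc m ^ s * X ^ n →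
    2 ^ e * B ≤ M ^ n
  chernoff-arithmetic q m M s e n X Y B Z≡ XY≡ room le with m≤n⇒∃[o]m+o≡n room
  ... | t , room≡ = *-cancelʳ-≤ _ _ (D ^ n) {{m^n≢0 D n {{m*n≢0 m (suc m)}}}}
        (*-cancelʳ-≤ _ _ (m ^ s * Z ^ (n * Y)) {{m*n≢0 (m ^ s) _ {{m^n≢0 m s}} {{m^n≢0 Z (n * Y)}}}} (begin
    2 ^ e * B * D ^ n * (m ^ s * Z ^ (n * Y))
      ≡⟨ lemma₁ (2 ^ e) B (D ^ n) (m ^ s) (Z ^ (n * Y)) ⟩
    2 ^ e * (B * D ^ n * m ^ s) * Z ^ (n * Y)
      ≤⟨ *-monoˡ-≤ (Z ^ (n * Y)) (*-monoʳ-≤ (2 ^ e) le) ⟩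
    2 ^ e * (suc m ^ s * X ^ n) * Z ^ (n * Y)
      ≡⟨ lemma₂ (2 ^ e) (suc m ^ s) (X ^ n) (Z ^ (n * Y)) ⟩
    suc m ^ s * 2 ^ e * (X ^ n * Z ^ (n * Y))
      ≤⟨ *-monoʳ-≤ (suc m ^ s * 2 ^ e) complement ⟩
    suc m ^ s * 2 ^ e * (Z ^ n * q ^ (n * Y))
      ≡⟨ cong (λ z → suc m ^ s * 2 ^ e * (Z ^ n * z)) (split q) ⟩
    suc m ^ s * 2 ^ e * (Z ^ n * (q ^ (suc m * M * s) * q ^ (Z * e) * q ^ t))
      ≡⟨ lemma₃ (suc m ^ s) (2 ^ e) (Z ^ n) (q ^ (suc m * M * s)) (q ^ (Z * e)) (q ^ t) ⟩
    Z ^ n * (suc m ^ s * q ^ (suc m * M * s)) * (2 ^ e * q ^ (Z * e)) * q ^ t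
      ≤⟨ *-mono-≤ (*-mono-≤ (*-monoʳ-≤ (Z ^ n) (bernoulli-ratio-^ q (suc m * M) (suc m) m s ratio₁))
                            (bernoulli-ratio-^ q Z 2 1 e ratio₂))
                  (^-monoˡ-≤ t (n≤1+n q)) ⟩
    Z ^ n * (m ^ s * Z ^ (suc m * M * s)) * (1 ^ e * Z ^ (Z * e)) * Z ^ t
      ≡⟨ cong (λ z → Z ^ n * (m ^ s * Z ^ (suc m * M * s)) * (z * Z ^ (Z * e)) * Z ^ t) (^-zeroˡ e) ⟩
    Z ^ n * (m ^ s * Z ^ (suc m * M * s)) * (1 * Z ^ (Z * e)) * Z ^ t
      ≡⟨ lemma₄ (Z ^ n) (m ^ s) (Z ^ (suc m * M * s)) (Z ^ (Z * e)) (Z ^ t) ⟩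
    Z ^ n * (m ^ s * (Z ^ (suc m * M * s) * Z ^ (Z * e) * Z ^ t))
      ≡⟨ cong₂ (λ u v → u * (m ^ s * v)) (trans (cong (_^ n) Z≡) (trans (^-distribʳ-* n D M) (*-comm (D ^ n) (M ^ n)))) (sym (split Z)) ⟩
    M ^ n * D ^ n * (m ^ s * Z ^ (n * Y)) ∎))
    where
    D = m * suc m
    Z = suc q
    split : ∀ a → a ^ (n * Y) ≡ a ^ (suc m * M * s) * a ^ (Z * e) * a ^ t
    split a = trans (cong (a ^_) (sym room≡)) (trans (^-distribˡ-+-* a (suc m * M * s + Z * e) t) (cong (_* a ^ t) (^-distribˡ-+-* a (suc m * M * s) (Z * e))))
    complement : X ^ n * Z ^ (n * Y) ≤ Z ^ n * q ^ (n * Y)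
    complement = subst₂ _≤_ (shape X Z) (shape Z q) (^-monoˡ-≤ n (bernoulli-complement q X Y XY≡))
      where
      shape : ∀ a b → (a * b ^ Y) ^ n ≡ a ^ n * b ^ (n * Y)
      shape a b = trans (^-distribʳ-* n a (b ^ Y)) (cong (a ^ n *_) (trans (^-*-assoc b Y n) (cong (b ^_) (*-comm Y n))))
    ratio₁ : suc m * q ≤ m * (q + suc m * M)
    ratio₁ = begin
      suc m * q             ≡⟨ +-comm q (m * q) ⟩
      m * q + q             ≤⟨ +-monoʳ-≤ (m * q) (≤-trans (n≤1+n q) (≤-reflexive Z≡)) ⟩
      m * q + m * suc m * M ≡⟨ lemma m q M ⟩
      m * (q + suc m * M)   ∎
      where
      lemma : ∀ m q M → m * q + m * suc m * M ≡ m * (q + suc m * M)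
      lemma = solve-∀
    ratio₂ : 2 * q ≤ 1 * (q + Z)
    ratio₂ = ≤-trans (m≤n+m (2 * q) 1) (≤-reflexive (lemma q))
      where
      lemma : ∀ q → 1 + 2 * q ≡ 1 * (q + suc q)
      lemma = solve-∀
    lemma₁ : ∀ a b c d e → a * b * c * (d * e) ≡ a * (b * c * d) * e
    lemma₁ = solve-∀
    lemma₂ : ∀ a b c d → a * (b * c) * d ≡ b * a * (c * d)
    lemma₂ = solve-∀
    lemma₃ : ∀ a b c d e f → a * b * (c * (d * e * f)) ≡ c * (a * d) * (b * e) * f
    lemma₃ = solve-∀
    lemma₄ : ∀ a b c d e → a * (b * c) * (1 * d) * e ≡ a * (b * (c * d * e))
    lemma₄ = solve-∀

  module _ {A : Set} (m : ℕ) (f g : A → ℕ) (f+g≤1 : ∀ a → f a + g a ≤ 1) where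

    -- m(m+1) times ((m+1)/m)^(g a - f a).
    weight : A → ℕ
    weight a = m * suc m + suc m * g a ∸ m * f a

    weight-linear : ∀ a → weight a + m * f a ≡ m * suc m + suc m * g a
    weight-linear a = m∸n+n≡m (≤-trans (*-monoʳ-≤ m (≤-trans (≤-trans (m≤m+n (f a) (g a)) (f+g≤1 a)) (s≤s z≤n))) (m≤m+n (m * suc m) _))

    -- A function linear in `f` and `g` can agree with an exponential on the three pairs `(0,0)`,
    -- `(0,1)`, `(1,0)`, and no other pair occurs. Linearity makes the sum computable, the
    -- exponential form makes the product over nodes telescope.
    weight-power : ∀ a → weight a * (suc m ^ f a * m ^ g a) ≡ m * suc m * (m ^ f a * suc m ^ g a)
    weight-power a = cases (f a) (g a) (f+g≤1 a) (weight-linear a)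
      where
      cases : ∀ i j → i + j ≤ 1 → weight a + m * i ≡ m * suc m + suc m * j →
              weight a * (suc m ^ i * m ^ j) ≡ m * suc m * (m ^ i * suc m ^ j)
      cases 0 0 _ eq = cong (_* 1) (+-cancelʳ-≡ (m * 0) _ _ (trans eq (lemma m)))
        where
        lemma : ∀ m → m * suc m + suc m * 0 ≡ m * suc m + m * 0
        lemma = solve-∀
      cases 0 1 _ eq = trans (cong (_* (1 * (m * 1))) (+-cancelʳ-≡ (m * 0) _ _ (trans eq (lemma₁ m)))) (lemma₂ m)
        where
        lemma₁ : ∀ m → m * suc m + suc m * 1 ≡ suc m * suc m + m * 0
        lemma₁ = solve-∀
        lemma₂ : ∀ m → suc m * suc m * (1 * (m * 1)) ≡ m * suc m * (1 * (suc m * 1))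
        lemma₂ = solve-∀
      cases 1 0 _ eq = trans (cong (_* (suc m * 1 * 1)) (+-cancelʳ-≡ (m * 1) _ _ (trans eq (lemma₁ m)))) (lemma₂ m)
        where
        lemma₁ : ∀ m → m * suc m + suc m * 0 ≡ m * m + m * 1
        lemma₁ = solve-∀
        lemma₂ : ∀ m → m * m * (suc m * 1 * 1) ≡ m * suc m * (m * 1 * 1)
        lemma₂ = solve-∀
      cases 0 (suc (suc j)) (s≤s ())
      cases 1 (suc j)       (s≤s ())
      cases (suc (suc i)) j (s≤s ())

    ∏-weight : ∀ {n} (ω : Vec A n) → ∏ weight ω * (suc m ^ vsum f ω * m ^ vsum g ω) ≡
               (m * suc m) ^ n * (m ^ vsum f ω * suc m ^ vsum g ω)
    ∏-weight []      = refl
    ∏-weight {suc n} (a ∷ ω) = begin-equality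
      weight a * ∏ weight ω * (suc m ^ (f a + vsum f ω) * m ^ (g a + vsum g ω))
        ≡⟨ cong₂ (λ u v → weight a * ∏ weight ω * (u * v)) (^-distribˡ-+-* (suc m) (f a) _) (^-distribˡ-+-* m (g a) _) ⟩
      weight a * ∏ weight ω * (suc m ^ f a * suc m ^ vsum f ω * (m ^ g a * m ^ vsum g ω))
        ≡⟨ lemma (weight a) _ (suc m ^ f a) _ (m ^ g a) _ ⟩
      weight a * (suc m ^ f a * m ^ g a) * (∏ weight ω * (suc m ^ vsum f ω * m ^ vsum g ω))
        ≡⟨ cong₂ _*_ (weight-power a) (∏-weight ω) ⟩
      m * suc m * (m ^ f a * suc m ^ g a) * ((m * suc m) ^ n * (m ^ vsum f ω * suc m ^ vsum g ω))
        ≡⟨ lemma (m * suc m) ((m * suc m) ^ n) (m ^ f a) (m ^ vsum f ω) (suc m ^ g a) _ ⟨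
      m * suc m * (m * suc m) ^ n * (m ^ f a * m ^ vsum f ω * (suc m ^ g a * suc m ^ vsum g ω))
        ≡⟨ cong₂ (λ u v → (m * suc m) ^ suc n * (u * v)) (^-distribˡ-+-* m (f a) _) (^-distribˡ-+-* (suc m) (g a) _) ⟨
      (m * suc m) ^ suc n * (m ^ (f a + vsum f ω) * suc m ^ (g a + vsum g ω)) ∎
      where
      lemma : ∀ a b c d e f → a * b * (c * d * (e * f)) ≡ a * (c * e) * (b * (d * f))
      lemma = solve-∀

    -- On the bad event the excess `t = G + s - F` is non-negative, so `((m+1)/m)^t ≥ 1`; off the
    -- event the left-hand side vanishes.
    markov : ∀ {n} .{{_ : NonZero m}} s (ω : Vec A n) →
             𝟙 (vsum f ω <? vsum g ω + s) * ((m * suc m) ^ n * m ^ s) ≤ suc m ^ s * ∏ weight ω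
    markov {n} s ω = cases (F <? G + s)
      where
      F = vsum f ω
      G = vsum g ω
      Dn = (m * suc m) ^ n
      cases : (d : Dec (F < G + s)) → 𝟙 d * (Dn * m ^ s) ≤ suc m ^ s * ∏ weight ω
      cases (no _)   = z≤n
      cases (yes F<) with m≤n⇒∃[o]m+o≡n (<⇒≤ F<)
      ... | t , F+t≡ = ≤-trans (≤-reflexive (*-identityˡ _)) (*-cancelʳ-≤ _ _ (suc m ^ F * m ^ G) {{m*n≢0 _ _ {{m^n≢0 (suc m) F}} {{m^n≢0 m G}}}} (begin
        Dn * m ^ s * (suc m ^ F * m ^ G)               ≡⟨ lemma₁ Dn (m ^ s) (suc m ^ F) (m ^ G) ⟩
        Dn * (m ^ G * m ^ s) * suc m ^ F               ≡⟨ cong (λ z → Dn * z * suc m ^ F) (trans (sym (^-distribˡ-+-* m G s)) (trans (cong (m ^_) (sym F+t≡)) (^-distribˡ-+-* m F t))) ⟩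
        Dn * (m ^ F * m ^ t) * suc m ^ F               ≤⟨ *-monoˡ-≤ (suc m ^ F) (*-monoʳ-≤ Dn (*-monoʳ-≤ (m ^ F) (^-monoˡ-≤ t (n≤1+n m)))) ⟩
        Dn * (m ^ F * suc m ^ t) * suc m ^ F           ≡⟨ lemma₂ Dn (m ^ F) (suc m ^ t) (suc m ^ F) ⟩
        Dn * m ^ F * (suc m ^ F * suc m ^ t)           ≡⟨ cong (Dn * m ^ F *_) (trans (sym (^-distribˡ-+-* (suc m) F t)) (trans (cong (suc m ^_) F+t≡) (^-distribˡ-+-* (suc m) G s))) ⟩
        Dn * m ^ F * (suc m ^ G * suc m ^ s)           ≡⟨ lemma₃ Dn (m ^ F) (suc m ^ G) (suc m ^ s) ⟩
        suc m ^ s * (Dn * (m ^ F * suc m ^ G))         ≡⟨ cong (suc m ^ s *_) (∏-weight ω) ⟨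
        suc m ^ s * (∏ weight ω * (suc m ^ F * m ^ G)) ≡⟨ *-assoc (suc m ^ s) (∏ weight ω) _ ⟨
        suc m ^ s * ∏ weight ω * (suc m ^ F * m ^ G)   ∎))
        where
        lemma₁ : ∀ a b c d → a * b * (c * d) ≡ a * (d * b) * c
        lemma₁ = solve-∀
        lemma₂ : ∀ a b c d → a * (b * c) * d ≡ a * b * (d * c)
        lemma₂ = solve-∀
        lemma₃ : ∀ a b c d → a * b * (c * d) ≡ d * (a * (b * c))
        lemma₃ = solve-∀

    -- `Y` is the drift: the mean weight of one sample is `1 - Y/Z` after division by `m(m+1)`,
    -- where `Z = m(m+1)M`. Divided by `Z`, the second hypothesis reads `s/m + e ≤ n Y/Z`: the total
    -- drift covers the required lead and `e` halvings of the failure probability.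
    chernoff : ∀ (xs : List A) n s e Y .{{_ : NonZero m}} .{{_ : NonZero (length xs)}} →
      m * ∑ xs f ≡ suc m * ∑ xs g + Y →
      suc m * length xs * s + m * suc m * length xs * e ≤ n * Y →
      2 ^ e * ∑ (vectors xs n) (λ ω → 𝟙 (vsum f ω <? vsum g ω + s)) ≤ length xs ^ n
    chernoff xs n s e Y drift room =
      chernoff-arithmetic q m M s e n X Y B Z≡ (trans XY≡ (sym Z≡))
        (subst (λ z → suc m * M * s + z * e ≤ n * Y) (sym Z≡) room) (begin
      B * Dn * m ^ s                    ≡⟨ *-assoc B Dn (m ^ s) ⟩
      B * (Dn * m ^ s)                  ≡⟨ ∑-*ʳ (Dn * m ^ s) _ (vectors xs n) ⟨
      ∑ (vectors xs n) (λ ω → 𝟙 (vsum f ω <? vsum g ω + s) * (Dn * m ^ s)) ≤⟨ ∑-mono (vectors xs n) (markov s) ⟩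
      ∑ (vectors xs n) (λ ω → suc m ^ s * ∏ weight ω) ≡⟨ ∑-*ˡ (suc m ^ s) (∏ weight) (vectors xs n) ⟩
      suc m ^ s * ∑ (vectors xs n) (∏ weight) ≡⟨ cong (suc m ^ s *_) (∑-vectors-∏ weight xs n) ⟩
      suc m ^ s * X ^ n                 ∎)
      where
      M = length xs
      Z = m * suc m * M
      q = pred Z
      X = ∑ xs weight
      B = ∑ (vectors xs n) (λ ω → 𝟙 (vsum f ω <? vsum g ω + s))
      Dn = (m * suc m) ^ n
      instance
        mm≢0 : NonZero (m * suc m)
        mm≢0 = m*n≢0 m (suc m)
        Z≢0 : NonZero Z
        Z≢0 = m*n≢0 (m * suc m) M
      Z≡ : suc q ≡ Z
      Z≡ = suc-pred Z
      2≤Z : 2 ≤ Z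
      2≤Z = *-mono-≤ {2} {m * suc m} {1} {M} (*-mono-≤ {1} {m} {2} {suc m} (>-nonZero⁻¹ m) (s≤s (>-nonZero⁻¹ m))) (>-nonZero⁻¹ M)
      instance
        q≢0 : NonZero q
        q≢0 = >-nonZero (≤-pred (≤-trans 2≤Z (≤-reflexive (sym Z≡))))
      XY≡ : X + Y ≡ Z
      XY≡ = +-cancelʳ-≡ (suc m * ∑ xs g) _ _ (begin-equality
        X + Y + suc m * ∑ xs g     ≡⟨ trans (+-assoc X Y _) (cong (X +_) (trans (+-comm Y _) (sym drift))) ⟩
        X + m * ∑ xs f             ≡⟨ cong (X +_) (∑-*ˡ m f xs) ⟨
        X + ∑ xs (λ a → m * f a)   ≡⟨ ∑-+ weight (λ a → m * f a) xs ⟨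
        ∑ xs (λ a → weight a + m * f a) ≡⟨ ∑-cong xs weight-linear ⟩
        ∑ xs (λ a → m * suc m + suc m * g a) ≡⟨ ∑-+ (λ _ → m * suc m) (λ a → suc m * g a) xs ⟩
        ∑ xs (λ _ → m * suc m) + ∑ xs (λ a → suc m * g a) ≡⟨ cong₂ _+_ (trans (∑-const (m * suc m) xs) (*-comm M (m * suc m))) (∑-*ˡ (suc m) g xs) ⟩
        Z + suc m * ∑ xs g         ∎)

  -- The law of one round

  ∑-allFin-suc : ∀ {n} (f : Fin (suc n) → ℕ) → ∑ (allFin (suc n)) f ≡ f zero + ∑ (allFin n) (f ∘ suc)
  ∑-allFin-suc {n} f = cong (f zero +_) (cong listSum
    (trans (cong (List.map f) (sym (map-tabulate id suc))) (sym (map-∘ (allFin n)))))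

  ∑-allFin-lookup : ∀ {A : Set} {n} (f : A → ℕ) (ω : Vec A n) → ∑ (allFin n) (λ v → f (lookup ω v)) ≡ vsum f ω
  ∑-allFin-lookup f []      = refl
  ∑-allFin-lookup f (a ∷ ω) = trans (∑-allFin-suc (λ v → f (lookup (a ∷ ω) v))) (cong (f a +_) (∑-allFin-lookup f ω))

  term≤∑ : ∀ {n} (f : Fin n → ℕ) v → f v ≤ ∑ (allFin n) f
  term≤∑ f zero    = ≤-trans (m≤m+n (f zero) _) (≤-reflexive (sym (∑-allFin-suc f)))
  term≤∑ f (suc v) = ≤-trans (term≤∑ (f ∘ suc) v) (≤-trans (m≤n+m _ (f zero)) (≤-reflexive (sym (∑-allFin-suc f))))

  length-allFin : ∀ n → length (allFin n) ≡ n
  length-allFin n = length-tabulate id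

  ∑-allFin-const : ∀ n k → ∑ (allFin n) (λ _ → k) ≡ n * k
  ∑-allFin-const n k = trans (∑-const k (allFin n)) (cong (_* k) (length-allFin n))

  length-picks : ∀ n → length (picks n) ≡ n * (n * n)
  length-picks n = trans (length-product _,_ (allFin n) (cartesianProduct (allFin n) (allFin n)))
    (cong₂ _*_ (length-allFin n) (trans (length-product _,_ (allFin n) (allFin n)) (cong₂ _*_ (length-allFin n) (length-allFin n))))

  colorCount-∑ : ∀ {n k} (x : Coloring n k) j → colorCount x j ≡ ∑ (allFin n) (λ v → 𝟙 (x v ≟ j))
  colorCount-∑ {n} x j = length-filter-≡-∑ (λ v → x v ≟ j) (allFin n)

  seen : ∀ {n k} → Coloring n k → Picks n → Fin k
  seen x (a , b , c) = majority (x a) (x b) (x c)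

  colorCount-step : ∀ {n k} (x : Coloring n k) ω j → colorCount (step ω x) j ≡ vsum (λ p → 𝟙 (seen x p ≟ j)) ω
  colorCount-step x ω j = trans (colorCount-∑ (step ω x) j) (∑-allFin-lookup (λ p → 𝟙 (seen x p ≟ j)) ω)

  -- The rule amounts to this: keep the first color unless the last two agree, then take theirs.
  -- Hence `[maj = j] = [α = j](1 - [δ = β]) + [β = j][δ = j]`, with the negative term moved across.
  -- Each product separates when summed over independent picks.
  majority-𝟙 : ∀ {k} (α β δ j : Fin k) →
    𝟙 (majority α β δ ≟ j) + 𝟙 (α ≟ j) * 𝟙 (δ ≟ β) ≡ 𝟙 (α ≟ j) + 𝟙 (β ≟ j) * 𝟙 (δ ≟ j)
  majority-𝟙 α β δ j with α ≟ β | α ≟ δ | β ≟ δ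
  ... | yes refl | yes refl | no β≢δ = contradiction refl β≢δ
  ... | yes refl | no α≢δ   | yes β≡δ = contradiction β≡δ α≢δ
  ... | no α≢β   | yes refl | yes β≡δ = contradiction (sym β≡δ) α≢β
  ... | yes refl | yes refl | yes _ rewrite 𝟙-yes (α ≟ α) refl = lemma (α ≟ j)
    where
    lemma : (d : Dec (α ≡ j)) → 𝟙 d + 𝟙 d * 1 ≡ 𝟙 d + 𝟙 d * 𝟙 d
    lemma (yes _) = refl
    lemma (no _)  = refl
  ... | yes refl | no α≢δ | no _ rewrite 𝟙-no (δ ≟ α) (α≢δ ∘ sym) = lemma (α ≟ j) (δ ≟ j)
    where
    lemma : (d : Dec (α ≡ j)) (d′ : Dec (δ ≡ j)) → 𝟙 d + 𝟙 d * 0 ≡ 𝟙 d + 𝟙 d * 𝟙 d′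
    lemma (yes refl) (yes refl) = contradiction refl α≢δ
    lemma (yes _)    (no _)     = refl
    lemma (no _)     _          = refl
  ... | no α≢β | yes refl | no _ rewrite 𝟙-no (α ≟ β) α≢β = lemma (α ≟ j) (β ≟ j)
    where
    lemma : (d : Dec (α ≡ j)) (d′ : Dec (β ≡ j)) → 𝟙 d + 𝟙 d * 0 ≡ 𝟙 d + 𝟙 d′ * 𝟙 d
    lemma (yes refl) (yes refl) = contradiction refl α≢β
    lemma (yes _)    (no _)     = refl
    lemma (no _)     (yes _)    = refl
    lemma (no _)     (no _)     = refl
  ... | no α≢β | no _ | yes refl rewrite 𝟙-yes (β ≟ β) refl = lemma (α ≟ j) (β ≟ j)
    where
    lemma : (d : Dec (α ≡ j)) (d′ : Dec (β ≡ j)) → 𝟙 d′ + 𝟙 d * 1 ≡ 𝟙 d + 𝟙 d′ * 𝟙 d′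
    lemma (yes refl) (yes refl) = contradiction refl α≢β
    lemma (yes _)    (no _)     = refl
    lemma (no _)     (yes _)    = refl
    lemma (no _)     (no _)     = refl
  ... | no _ | no _ | no β≢δ rewrite 𝟙-no (δ ≟ β) (β≢δ ∘ sym) = lemma (α ≟ j) (β ≟ j) (δ ≟ j)
    where
    lemma : (d : Dec (α ≡ j)) (d′ : Dec (β ≡ j)) (d″ : Dec (δ ≡ j)) → 𝟙 d + 𝟙 d * 0 ≡ 𝟙 d + 𝟙 d′ * 𝟙 d″
    lemma d (yes refl) (yes refl) = contradiction refl β≢δ
    lemma d (yes _)    (no _)     = cong (𝟙 d +_) (*-zeroʳ (𝟙 d))
    lemma d (no _)     _          = cong (𝟙 d +_) (*-zeroʳ (𝟙 d))

  module _ {n k : ℕ} (x : Coloring n k) where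

    private
      V = allFin n
      ι : Fin k → Fin n → ℕ
      ι j v = 𝟙 (x v ≟ j)

    -- The number of pairs of nodes with equal colors, Σ_j c_j².
    collisions : ℕ
    collisions = ∑ V (λ v → colorCount x (x v))

    picksOf : Fin k → ℕ
    picksOf j = ∑ (picks n) (λ p → 𝟙 (seen x p ≟ j))

    ∑-picks : ∀ f → ∑ (picks n) f ≡ ∑ V (λ a → ∑ V (λ b → ∑ V (λ c → f (a , b , c))))
    ∑-picks f = trans (∑-cartesianProductWith _,_ f V (cartesianProduct V V))
      (∑-cong V (λ a → ∑-cartesianProductWith _,_ (λ q → f (a , q)) V V))

    picksOf-formula : ∀ j → let c = colorCount x j in picksOf j + c * collisions ≡ n * n * c + n * c * c
    picksOf-formula j = begin-equality
      picksOf j + c * collisions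
        ≡⟨ cong₂ _+_ (∑-picks (λ p → 𝟙 (seen x p ≟ j))) prod ⟩
      ∑ V (λ a → ∑ V (λ b → ∑ V (λ d → m a b d))) + ∑ V (λ a → ∑ V (λ b → ∑ V (λ d → ι j a * 𝟙 (x d ≟ x b))))
        ≡⟨ merge (λ a b d → m a b d) (λ a b d → ι j a * 𝟙 (x d ≟ x b)) ⟨
      ∑ V (λ a → ∑ V (λ b → ∑ V (λ d → m a b d + ι j a * 𝟙 (x d ≟ x b))))
        ≡⟨ ∑-cong V (λ a → ∑-cong V (λ b → ∑-cong V (λ d → majority-𝟙 (x a) (x b) (x d) j))) ⟩
      ∑ V (λ a → ∑ V (λ b → ∑ V (λ d → ι j a + ι j b * ι j d)))
        ≡⟨ merge (λ a b d → ι j a) (λ a b d → ι j b * ι j d) ⟩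
      ∑ V (λ a → ∑ V (λ b → ∑ V (λ d → ι j a))) + ∑ V (λ a → ∑ V (λ b → ∑ V (λ d → ι j b * ι j d)))
        ≡⟨ cong₂ _+_ first second ⟩
      n * n * c + n * c * c ∎
      where
      c = colorCount x j
      m : Fin n → Fin n → Fin n → ℕ
      m a b d = 𝟙 (majority (x a) (x b) (x d) ≟ j)
      merge : ∀ (f g : Fin n → Fin n → Fin n → ℕ) →
        ∑ V (λ a → ∑ V (λ b → ∑ V (λ d → f a b d + g a b d))) ≡
        ∑ V (λ a → ∑ V (λ b → ∑ V (λ d → f a b d))) + ∑ V (λ a → ∑ V (λ b → ∑ V (λ d → g a b d)))
      merge f g = trans (∑-cong V (λ a → trans (∑-cong V (λ b → ∑-+ (f a b) (g a b) V))
          (∑-+ (λ b → ∑ V (f a b)) (λ b → ∑ V (g a b)) V)))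
        (∑-+ (λ a → ∑ V (λ b → ∑ V (f a b))) (λ a → ∑ V (λ b → ∑ V (g a b))) V)
      c≡ : c ≡ ∑ V (ι j)
      c≡ = colorCount-∑ x j
      prod : c * collisions ≡ ∑ V (λ a → ∑ V (λ b → ∑ V (λ d → ι j a * 𝟙 (x d ≟ x b))))
      prod = sym (begin-equality
        ∑ V (λ a → ∑ V (λ b → ∑ V (λ d → ι j a * 𝟙 (x d ≟ x b))))
          ≡⟨ ∑-cong V (λ a → ∑-cong V (λ b → trans (∑-*ˡ (ι j a) _ V) (cong (ι j a *_) (sym (colorCount-∑ x (x b)))))) ⟩
        ∑ V (λ a → ∑ V (λ b → ι j a * colorCount x (x b)))
          ≡⟨ ∑-cong V (λ a → ∑-*ˡ (ι j a) _ V) ⟩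
        ∑ V (λ a → ι j a * collisions)
          ≡⟨ ∑-*ʳ collisions (ι j) V ⟩
        ∑ V (ι j) * collisions
          ≡⟨ cong (_* collisions) c≡ ⟨
        c * collisions ∎)
      first : ∑ V (λ a → ∑ V (λ b → ∑ V (λ d → ι j a))) ≡ n * n * c
      first = begin-equality
        ∑ V (λ a → ∑ V (λ b → ∑ V (λ d → ι j a)))
          ≡⟨ ∑-cong V (λ a → trans (∑-cong V (λ b → ∑-allFin-const n (ι j a))) (∑-allFin-const n (n * ι j a))) ⟩
        ∑ V (λ a → n * (n * ι j a)) ≡⟨ ∑-cong V (λ a → sym (*-assoc n n (ι j a))) ⟩
        ∑ V (λ a → n * n * ι j a)   ≡⟨ ∑-*ˡ (n * n) (ι j) V ⟩
        n * n * ∑ V (ι j)           ≡⟨ cong (n * n *_) c≡ ⟨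
        n * n * c                   ∎
      second : ∑ V (λ a → ∑ V (λ b → ∑ V (λ d → ι j b * ι j d))) ≡ n * c * c
      second = begin-equality
        ∑ V (λ a → ∑ V (λ b → ∑ V (λ d → ι j b * ι j d)))
          ≡⟨ ∑-cong V (λ a → ∑-cong V (λ b → trans (∑-*ˡ (ι j b) (ι j) V) (cong (ι j b *_) (sym c≡)))) ⟩
        ∑ V (λ a → ∑ V (λ b → ι j b * c)) ≡⟨ ∑-cong V (λ a → trans (∑-*ʳ c (ι j) V) (cong (_* c) (sym c≡))) ⟩
        ∑ V (λ a → c * c)                 ≡⟨ ∑-allFin-const n (c * c) ⟩
        n * (c * c)                       ≡⟨ *-assoc n c c ⟨
        n * c * c                         ∎

    colorCount≤n : ∀ j → colorCount x j ≤ n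
    colorCount≤n j = subst₂ _≤_ (sym (colorCount-∑ x j)) (trans (∑-allFin-const n 1) (*-identityʳ n)) (∑-mono V (λ v → 𝟙≤1 (x v ≟ j)))

    colorCount-disjoint : ∀ i j → i ≢ j → colorCount x i + colorCount x j ≤ n
    colorCount-disjoint i j i≢j = subst₂ _≤_
        (trans (∑-+ (ι i) (ι j) V) (cong₂ _+_ (sym (colorCount-∑ x i)) (sym (colorCount-∑ x j))))
        (trans (∑-allFin-const n 1) (*-identityʳ n))
        (∑-mono V (λ v → bound (x v ≟ i) (x v ≟ j)))
      where
      bound : ∀ {l : Fin k} (d : Dec (l ≡ i)) (d′ : Dec (l ≡ j)) → 𝟙 d + 𝟙 d′ ≤ 1
      bound (yes refl) (yes refl) = contradiction refl i≢j
      bound (yes _)    (no _)     = ≤-refl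
      bound (no _)     (yes _)    = ≤-refl
      bound (no _)     (no _)     = z≤n

    -- collisions ≤ c² + (n - c) b, moved so that no subtraction occurs.
    collisions-bound : ∀ i b → (∀ v → x v ≢ i → colorCount x (x v) ≤ b) →
      let c = colorCount x i in collisions + c * b ≤ c * c + n * b
    collisions-bound i b bound = subst₂ _≤_
        (trans (∑-+ (λ v → colorCount x (x v)) (λ v → ι i v * b) V)
               (cong (collisions +_) (trans (∑-*ʳ b (ι i) V) (cong (_* b) (sym (colorCount-∑ x i))))))
        (trans (∑-+ (λ v → ι i v * c) (λ _ → b) V)
               (cong₂ _+_ (trans (∑-*ʳ c (ι i) V) (cong (_* c) (sym (colorCount-∑ x i)))) (∑-allFin-const n b)))
        (∑-mono V (λ v → pointwise v (x v ≟ i)))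
      where
      c = colorCount x i
      pointwise : ∀ v (d : Dec (x v ≡ i)) → colorCount x (x v) + 𝟙 d * b ≤ 𝟙 d * c + b
      pointwise v (yes refl) = ≤-reflexive (cong₂ _+_ (sym (*-identityˡ (colorCount x (x v)))) (*-identityˡ b))
      pointwise v (no ≢)     = ≤-trans (≤-reflexive (+-identityʳ _)) (bound v ≢)

  -- Drift estimates

  -- n c - S ≥ (n - c) s for the number S of collisions; u stands for the left-hand side.
  collision-deficit : ∀ n c q s b S → c + q ≡ n → b + s ≡ c → S + c * b ≤ c * c + n * b →
                      ∃[ u ] n * c ≡ S + u × q * s ≤ u
  collision-deficit n c q s b S refl refl le with m≤n⇒∃[o]m+o≡n le
  ... | t , eq = t + q * s , +-cancelʳ-≡ (c * b) _ _ (begin-equality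
      (c + q) * c + c * b           ≡⟨ lemma₁ b s q ⟩
      c * c + (c + q) * b + q * s   ≡⟨ cong (_+ q * s) eq ⟨
      S + c * b + t + q * s         ≡⟨ lemma₂ S (c * b) t (q * s) ⟩
      S + (t + q * s) + c * b       ∎) , m≤n+m (q * s) t
    where
    lemma₁ : ∀ b s q → (b + s + q) * (b + s) + (b + s) * b ≡ (b + s) * (b + s) + (b + s + q) * b + q * s
    lemma₁ = solve-∀
    lemma₂ : ∀ a b c d → a + b + c + d ≡ a + (c + d) + b
    lemma₂ = solve-∀

  plurality-picks : ∀ n c S u A → n * c ≡ S + u → A + c * S ≡ n * n * c + n * c * c → A ≡ n * n * c + c * u
  plurality-picks n c S u A nc≡ A≡ = +-cancelʳ-≡ (c * S) _ _ (begin-equality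
    A + c * S                     ≡⟨ A≡ ⟩
    n * n * c + n * c * c         ≡⟨ cong (λ z → n * n * c + z * c) nc≡ ⟩
    n * n * c + (S + u) * c       ≡⟨ lemma (n * n * c) S u c ⟩
    n * n * c + c * u + c * S     ∎)
    where
    lemma : ∀ a S u c → a + (S + u) * c ≡ a + c * u + c * S
    lemma = solve-∀

  -- Eliminating `S = n c - u` leaves the initial lead `σ` multiplied by `n² + u + n y`. The last
  -- two terms are the amplification per round; either `u` or `n y` is large, according to whether
  -- color `j` is small or close to the plurality.
  picks-difference : ∀ n c y σ S u A A′ → n * c ≡ S + u → y + σ ≡ c →
    A + c * S ≡ n * n * c + n * c * c → A′ + y * S ≡ n * n * y + n * y * y →
    A ≡ A′ + σ * (n * n + u + n * y)
  picks-difference n c y σ S u A A′ nc≡ refl A≡ A′≡ = +-cancelʳ-≡ (y * S) _ _ (begin-equality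
    A + y * S                                          ≡⟨ cong (_+ y * S) (plurality-picks n c S u A nc≡ A≡) ⟩
    n * n * (y + σ) + (y + σ) * u + y * S              ≡⟨ lemma₁ n y σ u S ⟩
    n * n * (y + σ) + σ * u + y * (S + u)              ≡⟨ cong (λ z → n * n * (y + σ) + σ * u + y * z) nc≡ ⟨
    n * n * (y + σ) + σ * u + y * (n * (y + σ))        ≡⟨ lemma₂ n y σ u ⟩
    n * n * y + n * y * y + σ * (n * n + u + n * y)    ≡⟨ cong (_+ σ * (n * n + u + n * y)) A′≡ ⟨
    A′ + y * S + σ * (n * n + u + n * y)               ≡⟨ lemma₃ A′ (y * S) _ ⟩
    A′ + σ * (n * n + u + n * y) + y * S               ∎)
    where
    lemma₁ : ∀ n y σ u S → n * n * (y + σ) + (y + σ) * u + y * S ≡ n * n * (y + σ) + σ * u + y * (S + u)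
    lemma₁ = solve-∀
    lemma₂ : ∀ n y σ u → n * n * (y + σ) + σ * u + y * (n * (y + σ)) ≡ n * n * y + n * y * y + σ * (n * n + u + n * y)
    lemma₂ = solve-∀
    lemma₃ : ∀ a b c → a + b + c ≡ a + c + b
    lemma₃ = solve-∀

  picks≤ : ∀ n y S A → y ≤ n → A + y * S ≡ n * n * y + n * y * y → A ≤ 2 * (n * n * y)
  picks≤ n y S A y≤n A≡ = begin
    A                         ≤⟨ m≤m+n A (y * S) ⟩
    A + y * S                 ≡⟨ A≡ ⟩
    n * n * y + n * y * y     ≤⟨ +-monoʳ-≤ (n * n * y) (*-monoˡ-≤ y (*-monoʳ-≤ n y≤n)) ⟩
    n * n * y + n * n * y     ≡⟨ lemma (n * n * y) ⟩
    2 * (n * n * y)           ∎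
    where
    lemma : ∀ a → a + a ≡ 2 * a
    lemma = solve-∀

  -- After multiplication by 12, the amplification `σ(u + n y)` is worth at least `4 m s n c`. One
  -- quarter pays for the increase `d`. Each other quarter is at least `12 n² c` because
  -- `12 n ≤ m s`: two of them absorb the extra `A′ + n²(s + d) ≤ 2 n² c` that comes from `suc m` in
  -- place of `m`, and the last absorbs the term with `e`.
  bias-drift : ∀ n c q y s d b S A A′ m e →
    c + q ≡ n → n ≤ 3 * q → b + s ≡ c → S + c * b ≤ c * c + n * b →
    A + c * S ≡ n * n * c + n * c * c → A′ + y * S ≡ n * n * y + n * y * y →
    y + s ≤ c → 12 * (n * d) ≤ s * c → d ≤ s → 12 * n ≤ m * s → m * suc m * e ≤ c →
    suc m * A′ + suc m * (n * n) * (s + d) + m * suc m * (n * n) * e ≤ m * A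
  bias-drift n c q y s d b S A A′ m e n≡ n≤3q b≡ S≤ A≡ A′≡ y+s≤c d≤ d≤s m≥ small
    with m≤n⇒∃[o]m+o≡n y+s≤c | collision-deficit n c q s b S n≡ b≡ S≤
  ... | r , y+s+r≡ | u , nc≡ , qs≤u = *-cancelˡ-≤ 12 (begin
    12 * (suc m * A′ + suc m * nn * (s + d) + m * suc m * nn * e)
      ≡⟨ lemma₁ m A′ nn s d e ⟩
    12 * (m * A′) + 12 * (m * (nn * s)) + (12 * (A′ + nn * (s + d)) + 12 * (m * (nn * d)) + 12 * (nn * (m * suc m * e)))
      ≤⟨ +-monoʳ-≤ (12 * (m * A′) + 12 * (m * (nn * s))) (+-mono-≤ (+-mono-≤ (*-monoʳ-≤ 12 A′-bound) (≤-trans (≤-reflexive (lemma₆ m n d)) (*-monoʳ-≤ (m * n) d≤)))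
          (*-monoʳ-≤ 12 (*-monoʳ-≤ nn small))) ⟩
    12 * (m * A′) + 12 * (m * (nn * s)) + (12 * (2 * (nn * c)) + m * n * (s * c) + 12 * (nn * c))
      ≡⟨ lemma₂ m A′ nn s c n ⟩
    12 * (m * A′) + 12 * (m * (nn * s)) + (3 * (n * c) * (12 * n) + m * (s * n * c))
      ≤⟨ +-monoʳ-≤ (12 * (m * A′) + 12 * (m * (nn * s))) (+-monoˡ-≤ (m * (s * n * c)) (*-monoʳ-≤ (3 * (n * c)) m≥)) ⟩
    12 * (m * A′) + 12 * (m * (nn * s)) + (3 * (n * c) * (m * s) + m * (s * n * c))
      ≡⟨ lemma₃ m A′ nn s c n ⟩
    12 * (m * A′) + 12 * (m * (nn * s)) + 4 * (m * (s * n * c))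
      ≤⟨ +-mono-≤ (+-monoʳ-≤ (12 * (m * A′)) (*-monoʳ-≤ 12 (*-monoʳ-≤ m (*-monoʳ-≤ nn (m≤m+n s r)))))
                  (*-monoʳ-≤ 4 (*-monoʳ-≤ m gain)) ⟩
    12 * (m * A′) + 12 * (m * (nn * σ)) + 4 * (m * (3 * (σ * (u + n * y))))
      ≡⟨ lemma₄ m A′ nn σ u (n * y) ⟩
    12 * (m * (A′ + σ * (nn + u + n * y)))
      ≡⟨ cong (λ z → 12 * (m * z)) (picks-difference n c y σ S u A A′ nc≡ y+σ≡c A≡ A′≡) ⟨
    12 * (m * A) ∎)
    where
    nn = n * n
    σ = s + r
    y+σ≡c : y + σ ≡ c
    y+σ≡c = trans (sym (+-assoc y s r)) y+s+r≡
    A′-bound : A′ + nn * (s + d) ≤ 2 * (nn * c)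
    A′-bound = begin
      A′ + nn * (s + d)           ≤⟨ +-mono-≤ (picks≤ n y S A′ y≤n A′≡) (*-monoʳ-≤ nn (+-monoʳ-≤ s d≤s)) ⟩
      2 * (nn * y) + nn * (s + s) ≡⟨ lemma nn y s ⟩
      2 * (nn * (y + s))          ≤⟨ *-monoʳ-≤ 2 (*-monoʳ-≤ nn y+s≤c) ⟩
      2 * (nn * c)                ∎
      where
      y≤n : y ≤ n
      y≤n = ≤-trans (m≤m+n y s) (≤-trans y+s≤c (≤-trans (m≤m+n c q) (≤-reflexive n≡)))
      lemma : ∀ a y s → 2 * (a * y) + a * (s + s) ≡ 2 * (a * (y + s))
      lemma = solve-∀
    gain : s * n * c ≤ 3 * (σ * (u + n * y))
    gain = begin
      s * n * c                             ≡⟨ cong (s * n *_) y+σ≡c ⟨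
      s * n * (y + σ)                       ≡⟨ lemma s n y σ ⟩
      σ * s * n + s * (n * y)               ≤⟨ +-mono-≤ (*-monoʳ-≤ (σ * s) n≤3q) (*-monoˡ-≤ (n * y) (m≤m+n s r)) ⟩
      σ * s * (3 * q) + σ * (n * y)         ≤⟨ m≤m+n _ (2 * (σ * (n * y))) ⟩
      σ * s * (3 * q) + σ * (n * y) + 2 * (σ * (n * y)) ≡⟨ lemma′ σ s q (n * y) ⟩
      3 * (σ * (q * s + n * y))             ≤⟨ *-monoʳ-≤ 3 (*-monoʳ-≤ σ (+-monoˡ-≤ (n * y) qs≤u)) ⟩
      3 * (σ * (u + n * y))                 ∎
      where
      lemma : ∀ s n y σ → s * n * (y + σ) ≡ σ * s * n + s * (n * y)
      lemma = solve-∀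
      lemma′ : ∀ σ s q a → σ * s * (3 * q) + σ * a + 2 * (σ * a) ≡ 3 * (σ * (q * s + a))
      lemma′ = solve-∀
    lemma₁ : ∀ m A′ nn s d e → 12 * (suc m * A′ + suc m * nn * (s + d) + m * suc m * nn * e) ≡
      12 * (m * A′) + 12 * (m * (nn * s)) + (12 * (A′ + nn * (s + d)) + 12 * (m * (nn * d)) + 12 * (nn * (m * suc m * e)))
    lemma₁ = solve-∀
    lemma₂ : ∀ m A′ nn s c n → 12 * (m * A′) + 12 * (m * (n * n * s)) + (12 * (2 * (n * n * c)) + m * n * (s * c) + 12 * (n * n * c)) ≡
      12 * (m * A′) + 12 * (m * (n * n * s)) + (3 * (n * c) * (12 * n) + m * (s * n * c))
    lemma₂ = solve-∀
    lemma₃ : ∀ m A′ nn s c n → 12 * (m * A′) + 12 * (m * (nn * s)) + (3 * (n * c) * (m * s) + m * (s * n * c)) ≡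
      12 * (m * A′) + 12 * (m * (nn * s)) + 4 * (m * (s * n * c))
    lemma₃ = solve-∀
    lemma₄ : ∀ m A′ nn σ u v → 12 * (m * A′) + 12 * (m * (nn * σ)) + 4 * (m * (3 * (σ * (u + v)))) ≡
      12 * (m * (A′ + σ * (nn + u + v)))
    lemma₄ = solve-∀
    lemma₆ : ∀ m n d → 12 * (m * (n * n * d)) ≡ m * n * (12 * (n * d))
    lemma₆ = solve-∀

  -- No growth is asked for here. The surplus in `A = n² c + c u` satisfies `m c u ≥ 4 n² c`, while
  -- passing from `m` to `suc m` and paying for `e` cost at most `n² c` each.
  plurality-drift : ∀ n c c₀ q s b S A m e →
    c + q ≡ n → n ≤ 3 * q → b + s ≡ c → S + c * b ≤ c * c + n * b →
    A + c * S ≡ n * n * c + n * c * c → c₀ ≤ c → 12 * n ≤ m * s → m * suc m * e ≤ c →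
    suc m * (n * n) * c₀ + m * suc m * (n * n) * e ≤ m * A
  plurality-drift n c c₀ q s b S A m e n≡ n≤3q b≡ S≤ A≡ c₀≤ m≥ small
    with collision-deficit n c q s b S n≡ b≡ S≤
  ... | u , nc≡ , qs≤u = *-cancelˡ-≤ 3 (begin
    3 * (suc m * nn * c₀ + m * suc m * nn * e)      ≡⟨ lemma₁ m nn c₀ e ⟩
    3 * (suc m * nn * c₀) + 3 * (nn * (m * suc m * e)) ≤⟨ +-mono-≤ (*-monoʳ-≤ 3 (*-monoʳ-≤ (suc m * nn) c₀≤)) (*-monoʳ-≤ 3 (*-monoʳ-≤ nn small)) ⟩
    3 * (suc m * nn * c) + 3 * (nn * c)             ≤⟨ m≤m+n _ (6 * (nn * c)) ⟩
    3 * (suc m * nn * c) + 3 * (nn * c) + 6 * (nn * c) ≡⟨ lemma₂ m n c ⟩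
    3 * (m * (nn * c)) + c * n * (12 * n)           ≤⟨ +-monoʳ-≤ (3 * (m * (nn * c))) (*-monoʳ-≤ (c * n) m≥) ⟩
    3 * (m * (nn * c)) + c * n * (m * s)            ≡⟨ lemma₃ m (nn * c) c n s ⟩
    3 * (m * (nn * c)) + m * (c * (n * s))          ≤⟨ +-monoʳ-≤ (3 * (m * (nn * c))) (*-monoʳ-≤ m (*-monoʳ-≤ c ns≤3u)) ⟩
    3 * (m * (nn * c)) + m * (c * (3 * u))          ≡⟨ lemma₄ m (nn * c) c u ⟩
    3 * (m * (nn * c + c * u))                      ≡⟨ cong (λ z → 3 * (m * z)) (plurality-picks n c S u A nc≡ A≡) ⟨
    3 * (m * A)                                     ∎)
    where
    nn = n * n
    ns≤3u : n * s ≤ 3 * u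
    ns≤3u = begin
      n * s       ≤⟨ *-monoˡ-≤ s n≤3q ⟩
      3 * q * s   ≡⟨ *-assoc 3 q s ⟩
      3 * (q * s) ≤⟨ *-monoʳ-≤ 3 qs≤u ⟩
      3 * u       ∎
    lemma₁ : ∀ m nn c e → 3 * (suc m * nn * c + m * suc m * nn * e) ≡ 3 * (suc m * nn * c) + 3 * (nn * (m * suc m * e))
    lemma₁ = solve-∀
    lemma₂ : ∀ m n c → 3 * (suc m * (n * n) * c) + 3 * (n * n * c) + 6 * (n * n * c) ≡ 3 * (m * (n * n * c)) + c * n * (12 * n)
    lemma₂ = solve-∀
    lemma₃ : ∀ m a c n s → 3 * (m * a) + c * n * (m * s) ≡ 3 * (m * a) + m * (c * (n * s))
    lemma₃ = solve-∀
    lemma₄ : ∀ m a c u → 3 * (m * a) + m * (c * (3 * u)) ≡ 3 * (m * (a + c * u))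
    lemma₄ = solve-∀

  -- The rate m of the exponential weights is about 12 n / s.
  rate : ∀ n s c ℓ .{{_ : NonZero s}} → s ≤ n → 1152 * (n * n * ℓ) ≤ s * s * c →
         ∃[ m ] NonZero m × 12 * n ≤ m * s × m * suc m * (6 * ℓ) ≤ c
  rate n s c ℓ s≤n big = m , _ , <⇒≤ m-lower , *-cancelˡ-≤ (s * s) {{m*n≢0 s s}} (begin
    s * s * (m * suc m * (6 * ℓ))         ≡⟨ lemma₁ s m ℓ ⟩
    (m * s) * (suc m * s) * (6 * ℓ)       ≤⟨ *-monoˡ-≤ (6 * ℓ) (*-mono-≤ m-upper (+-mono-≤ s≤n m-upper)) ⟩
    -- Here `m s ≤ 13 n` and `suc m * s ≤ 14 n`, so `13 · 14 · 6 = 1092` has to fit below `1152`;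
    -- the difference is the 60.
    (n + 12 * n) * (n + (n + 12 * n)) * (6 * ℓ) ≤⟨ m≤m+n _ (60 * (n * n * ℓ)) ⟩
    (n + 12 * n) * (n + (n + 12 * n)) * (6 * ℓ) + 60 * (n * n * ℓ) ≡⟨ lemma₂ n ℓ ⟩
    1152 * (n * n * ℓ)                    ≤⟨ big ⟩
    s * s * c                             ∎)
    where
    m = suc (12 * n / s)
    m-lower : 12 * n < m * s
    m-lower = begin-strict
      12 * n                       ≡⟨ m≡m%n+[m/n]*n (12 * n) s ⟩
      (12 * n) % s + 12 * n / s * s <⟨ +-monoˡ-< (12 * n / s * s) (m%n<n (12 * n) s) ⟩
      m * s                        ∎
    m-upper : m * s ≤ n + 12 * n
    m-upper = +-mono-≤ s≤n (m/n*n≤m (12 * n) s)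
    lemma₁ : ∀ s m ℓ → s * s * (m * suc m * (6 * ℓ)) ≡ (m * s) * (suc m * s) * (6 * ℓ)
    lemma₁ = solve-∀
    lemma₂ : ∀ n ℓ → (n + 12 * n) * (n + (n + 12 * n)) * (6 * ℓ) + 60 * (n * n * ℓ) ≡ 1152 * (n * n * ℓ)
    lemma₂ = solve-∀

  -- The increase `d` is `s/h` rounded up. As `h ≤ s`, rounding at most doubles it, so `h d ≤ 2 s`;
  -- this factor 2 is why 24, twice the 12 of the drift estimate, appears in the condition on `h`.
  increment : ∀ n s c h .{{_ : NonZero h}} → 2 ≤ h → h ≤ s → 24 * n ≤ h * c →
              ∃[ d ] s ≤ h * d × 12 * (n * d) ≤ s * c × d ≤ s
  increment n s c h 2≤h h≤s hc = d , <⇒≤ lower , *-cancelˡ-≤ 2 room , *-cancelˡ-≤ 2 (≤-trans (*-monoˡ-≤ d 2≤h) upper)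
    where
    d = suc (s / h)
    lower : s < h * d
    lower = begin-strict
      s                   ≡⟨ m≡m%n+[m/n]*n s h ⟩
      s % h + s / h * h   <⟨ +-monoˡ-< (s / h * h) (m%n<n s h) ⟩
      d * h               ≡⟨ *-comm d h ⟩
      h * d               ∎
    upper : h * d ≤ 2 * s
    upper = begin
      h * d           ≡⟨ *-comm h d ⟩
      h + s / h * h   ≤⟨ +-mono-≤ h≤s (m/n*n≤m s h) ⟩
      s + s           ≡⟨ lemma s ⟩
      2 * s           ∎
      where
      lemma : ∀ s → s + s ≡ 2 * s
      lemma = solve-∀
    room : 2 * (12 * (n * d)) ≤ 2 * (s * c)
    room = begin
      2 * (12 * (n * d))  ≡⟨ lemma n d ⟩
      24 * n * d          ≤⟨ *-monoˡ-≤ d hc ⟩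
      h * c * d           ≡⟨ lemma′ h c d ⟩
      h * d * c           ≤⟨ *-monoˡ-≤ c upper ⟩
      2 * s * c           ≡⟨ *-assoc 2 s c ⟩
      2 * (s * c)         ∎
      where
      lemma : ∀ n d → 2 * (12 * (n * d)) ≡ 24 * n * d
      lemma = solve-∀
      lemma′ : ∀ h c d → h * c * d ≡ h * d * c
      lemma′ = solve-∀

  -- The lower bound is n³ (3 p² - 2 p³) with p = c / n, the two-color value.
  majority-picks : ∀ n c q S A → c + q ≡ n → S + c * q ≤ c * c + n * q →
    A + c * S ≡ n * n * c + n * c * c → c * c * (c + 3 * q) ≤ A
  majority-picks n c q S A refl S≤ A≡ = +-cancelʳ-≤ (c * S + c * (c * q)) _ _ (begin
    c * c * (c + 3 * q) + (c * S + c * (c * q))      ≡⟨ lemma₁ c q S ⟩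
    c * c * (c + 3 * q) + c * (S + c * q)            ≤⟨ +-monoʳ-≤ (c * c * (c + 3 * q)) (*-monoʳ-≤ c S≤) ⟩
    c * c * (c + 3 * q) + c * (c * c + (c + q) * q)  ≡⟨ lemma₂ c q ⟩
    n * n * c + n * c * c + c * (c * q)              ≡⟨ cong (_+ c * (c * q)) A≡ ⟨
    A + c * S + c * (c * q)                          ≡⟨ +-assoc A _ _ ⟩
    A + (c * S + c * (c * q))                        ∎)
    where
    lemma₁ : ∀ c q S → c * c * (c + 3 * q) + (c * S + c * (c * q)) ≡ c * c * (c + 3 * q) + c * (S + c * q)
    lemma₁ = solve-∀
    lemma₂ : ∀ c q → c * c * (c + 3 * q) + c * (c * c + (c + q) * q) ≡ (c + q) * (c + q) * c + (c + q) * c * c + c * (c * q)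
    lemma₂ = solve-∀

  double-minority : ∀ n c q → c + q ≡ n → 2 * n ≤ 3 * c → 2 * q ≤ c
  double-minority n c q refl le = +-cancelˡ-≤ (2 * c) _ _ (begin
    2 * c + 2 * q ≡⟨ *-distribˡ-+ 2 c q ⟨
    2 * (c + q)   ≤⟨ le ⟩
    3 * c         ≡⟨ lemma c ⟩
    2 * c + c     ∎)
    where
    lemma : ∀ c → 3 * c ≡ 2 * c + c
    lemma = solve-∀

  -- With `p = c/n`, the bound on `A` gives `H/n³ ≤ 1 - 3p² + 2p³ = (1-p)²(1+2p)`, and `(1-p)(1+2p)`
  -- is at most its value `7/9` at `p = 2/3`. Writing `c = 2q + r` turns this into a polynomial
  -- identity with a non-negative remainder.
  minority-shrinks : ∀ n c q A H → c + q ≡ n → 2 * n ≤ 3 * c → c * c * (c + 3 * q) ≤ A →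
    H + A ≡ n * (n * n) → 9 * H ≤ 7 * (n * n * q)
  minority-shrinks n c q A H refl le A≥ H≡ with m≤n⇒∃[o]m+o≡n (double-minority n c q refl le)
  ... | r , refl = +-cancelʳ-≤ (9 * A) _ _ (begin
    9 * H + 9 * A                                   ≡⟨ *-distribˡ-+ 9 H A ⟨
    9 * (H + A)                                     ≡⟨ cong (9 *_) H≡ ⟩
    9 * (n * (n * n))                               ≤⟨ m≤m+n _ _ ⟩
    9 * (n * (n * n)) + q * r * (15 * q + 7 * r)    ≡⟨ lemma q r ⟩
    7 * (n * n * q) + 9 * (c * c * (c + 3 * q))     ≤⟨ +-monoʳ-≤ (7 * (n * n * q)) (*-monoʳ-≤ 9 A≥) ⟩
    7 * (n * n * q) + 9 * A                         ∎)
    where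
    lemma : ∀ q r → 9 * ((2 * q + r + q) * ((2 * q + r + q) * (2 * q + r + q))) + q * r * (15 * q + 7 * r) ≡
            7 * ((2 * q + r + q) * (2 * q + r + q) * q) + 9 * ((2 * q + r) * (2 * q + r) * (2 * q + r + 3 * q))
    lemma = solve-∀

  -- At `p = 2/3` the two-color value is `20/27`. With rate `m = 18`, the scale of 27 leaves
  -- `18 · 20 = 360` against `19 · 18 = 342` for the threshold, and the remaining `18 n` covers the
  -- rounding of `s` and the exponent `6ℓ` once `n ≥ 3200 ℓ`.
  majority-drift : ∀ n c q A s ℓ → c + q ≡ n → 2 * n ≤ 3 * c → c * c * (c + 3 * q) ≤ A →
    3 * s ≤ 2 * n + 3 → 1 ≤ ℓ → 3200 * ℓ ≤ n →
    19 * (n * n) * s + 18 * 19 * (n * n) * (6 * ℓ) ≤ 18 * A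
  majority-drift n c q A s ℓ refl le A≥ s≤ 1≤ℓ ℓ≤ with m≤n⇒∃[o]m+o≡n (double-minority n c q refl le)
  ... | r , refl = *-cancelˡ-≤ 27 (begin
    27 * (19 * nn * s + 18 * 19 * nn * (6 * ℓ))           ≡⟨ lemma₁ nn s ℓ ⟩
    nn * (171 * (3 * s) + 55404 * ℓ)                      ≤⟨ *-monoʳ-≤ nn (+-monoˡ-≤ (55404 * ℓ) (*-monoʳ-≤ 171 s≤)) ⟩
    nn * (171 * (2 * n + 3) + 55404 * ℓ)                  ≡⟨ cong (λ z → nn * (z + 55404 * ℓ)) (lemma₂ n) ⟩
    nn * (342 * n + 513 * 1 + 55404 * ℓ)                  ≤⟨ *-monoʳ-≤ nn (+-monoˡ-≤ (55404 * ℓ) (+-monoʳ-≤ (342 * n) (*-monoʳ-≤ 513 1≤ℓ))) ⟩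
    nn * (342 * n + 513 * ℓ + 55404 * ℓ)                  ≤⟨ *-monoʳ-≤ nn (m≤m+n _ (1683 * ℓ)) ⟩
    nn * (342 * n + 513 * ℓ + 55404 * ℓ + 1683 * ℓ)       ≡⟨ lemma₃ nn n ℓ ⟩
    nn * (342 * n + 18 * (3200 * ℓ))                      ≤⟨ *-monoʳ-≤ nn (+-monoʳ-≤ (342 * n) (*-monoʳ-≤ 18 ℓ≤)) ⟩
    nn * (342 * n + 18 * n)                               ≡⟨ lemma₄ n ⟩
    18 * (20 * (n * nn))                                  ≤⟨ *-monoʳ-≤ 18 (m≤m+n (20 * (n * nn)) _) ⟩
    18 * (20 * (n * nn) + (108 * (q * q * r) + 63 * (q * r * r) + 7 * (r * r * r))) ≡⟨ cong (18 *_) (lemma₅ q r) ⟩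
    18 * (27 * (c * c * (c + 3 * q)))                     ≤⟨ *-monoʳ-≤ 18 (*-monoʳ-≤ 27 A≥) ⟩
    18 * (27 * A)                                         ≡⟨ lemma₆ A ⟩
    27 * (18 * A)                                         ∎)
    where
    nn = n * n
    lemma₁ : ∀ nn s ℓ → 27 * (19 * nn * s + 18 * 19 * nn * (6 * ℓ)) ≡ nn * (171 * (3 * s) + 55404 * ℓ)
    lemma₁ = solve-∀
    lemma₂ : ∀ n → 171 * (2 * n + 3) ≡ 342 * n + 513 * 1
    lemma₂ = solve-∀
    lemma₃ : ∀ nn n ℓ → nn * (342 * n + 513 * ℓ + 55404 * ℓ + 1683 * ℓ) ≡ nn * (342 * n + 18 * (3200 * ℓ))
    lemma₃ = solve-∀
    lemma₄ : ∀ n → n * n * (342 * n + 18 * n) ≡ 18 * (20 * (n * (n * n)))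
    lemma₄ = solve-∀
    lemma₅ : ∀ q r → 20 * ((2 * q + r + q) * ((2 * q + r + q) * (2 * q + r + q))) + (108 * (q * q * r) + 63 * (q * r * r) + 7 * (r * r * r)) ≡
             27 * ((2 * q + r) * (2 * q + r) * (2 * q + r + 3 * q))
    lemma₅ = solve-∀
    lemma₆ : ∀ A → 18 * (27 * A) ≡ 27 * (18 * A)
    lemma₆ = solve-∀

  -- Concentration and the majority phase

  rounds : ∀ n → List (Round n)
  rounds n = vectors (picks n) n

  length-picks-nonZero : ∀ n .{{_ : NonZero n}} → NonZero (length (picks n))
  length-picks-nonZero n = subst NonZero (sym (length-picks n)) (m*n≢0 n (n * n) {{it}} {{m*n≢0 n n}})
    where
    it : NonZero n
    it = >-nonZero (>-nonZero⁻¹ n)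

  length-rounds : ∀ n → length (rounds n) ≡ length (picks n) ^ n
  length-rounds n = length-vectors (picks n) n

  minority : ∀ {n k} → Coloring n (suc k) → ℕ
  minority {n} x = ∑ (allFin n) (λ v → 𝟙 (¬? (x v ≟ zero)))

  𝟙-¬ : {P : Set} (d : Dec P) → 𝟙 (¬? d) + 𝟙 d ≡ 1
  𝟙-¬ (yes _) = refl
  𝟙-¬ (no _)  = refl

  module _ {n k : ℕ} (x : Coloring n (suc k)) where

    minority-complement : colorCount x zero + minority x ≡ n
    minority-complement = begin-equality
      colorCount x zero + minority x   ≡⟨ +-comm (colorCount x zero) (minority x) ⟩
      minority x + colorCount x zero   ≡⟨ cong (minority x +_) (colorCount-∑ x zero) ⟩
      minority x + ∑ (allFin n) (λ v → 𝟙 (x v ≟ zero)) ≡⟨ ∑-+ (λ v → 𝟙 (¬? (x v ≟ zero))) _ (allFin n) ⟨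
      ∑ (allFin n) (λ v → 𝟙 (¬? (x v ≟ zero)) + 𝟙 (x v ≟ zero)) ≡⟨ ∑-cong (allFin n) (λ v → 𝟙-¬ (x v ≟ zero)) ⟩
      ∑ (allFin n) (λ _ → 1)           ≡⟨ ∑-allFin-const n 1 ⟩
      n * 1                            ≡⟨ *-identityʳ n ⟩
      n                                ∎

    allPlurality-or-minority : AllPlurality x ⊎ ∃[ v ] x v ≢ zero
    allPlurality-or-minority with any? (λ v → ¬? (x v ≟ zero))
    ... | yes found = inj₂ found
    ... | no  none  = inj₁ (λ v → decidable-stable (x v ≟ zero) (λ x≢ → none (v , x≢)))

    minority-positive : ∀ v → x v ≢ zero → 1 ≤ minority x
    minority-positive v x≢ = ≤-trans (≤-reflexive (sym (𝟙-yes (¬? (x v ≟ zero)) x≢))) (term≤∑ (λ v → 𝟙 (¬? (x v ≟ zero))) v)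

    allPlurality-minority : AllPlurality x → minority x ≡ 0
    allPlurality-minority all = trans (∑-cong (allFin n) (λ v → 𝟙-no (¬? (x v ≟ zero)) (λ x≢ → x≢ (all v))))
      (trans (∑-allFin-const n 0) (*-zeroʳ n))

    module _ (m : ℕ) (e : ℕ) .{{_ : NonZero n}} .{{_ : NonZero m}} where

      private
        A₀ = picksOf x zero
        f : Picks n → ℕ
        f p = 𝟙 (seen x p ≟ zero)

      -- The competitor `g` is left general: the indicator of a rival color controls the lead over
      -- it, and `g = 0` controls the plurality count itself.
      step-deviation : ∀ (g : Picks n → ℕ) s → (∀ p → f p + g p ≤ 1) →
        suc m * ∑ (picks n) g + suc m * (n * n) * s + m * suc m * (n * n) * e ≤ m * A₀ →
        2 ^ e * ∑ (rounds n) (λ ω → 𝟙 (vsum f ω <? vsum g ω + s)) ≤ length (rounds n)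
      step-deviation g s f+g≤1 drift with m≤n⇒∃[o]m+o≡n drift
      ... | t , drift≡ = subst (2 ^ e * ∑ (rounds n) (λ ω → 𝟙 (vsum f ω <? vsum g ω + s)) ≤_) (sym (length-rounds n))
        (chernoff m f g f+g≤1 (picks n) n s e Y {{it}} {{length-picks-nonZero n}} (trans (sym drift≡) (lemma₀ (suc m * ∑ (picks n) g) _ _ t)) room)
        where
        it : NonZero m
        it = >-nonZero (>-nonZero⁻¹ m)
        Y = suc m * (n * n) * s + m * suc m * (n * n) * e + t
        lemma₀ : ∀ a b c d → a + b + c + d ≡ a + (b + c + d)
        lemma₀ = solve-∀
        room : suc m * length (picks n) * s + m * suc m * length (picks n) * e ≤ n * Y
        room = begin
          suc m * length (picks n) * s + m * suc m * length (picks n) * e ≡⟨ cong (λ z → suc m * z * s + m * suc m * z * e) (length-picks n) ⟩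
          suc m * (n * (n * n)) * s + m * suc m * (n * (n * n)) * e ≡⟨ lemma n m s e ⟩
          n * (suc m * (n * n) * s + m * suc m * (n * n) * e)       ≤⟨ *-monoʳ-≤ n (m≤m+n _ t) ⟩
          n * Y                                                     ∎
          where
          lemma : ∀ n m s e → suc m * (n * (n * n)) * s + m * suc m * (n * (n * n)) * e ≡
                  n * (suc m * (n * n) * s + m * suc m * (n * n) * e)
          lemma = solve-∀

      lead-deviation : ∀ j s → j ≢ zero →
        suc m * picksOf x j + suc m * (n * n) * s + m * suc m * (n * n) * e ≤ m * A₀ →
        2 ^ e * ∑ (rounds n) (λ ω → 𝟙 (colorCount (step ω x) zero <? colorCount (step ω x) j + s)) ≤ length (rounds n)
      lead-deviation j s j≢0 drift = subst (λ z → 2 ^ e * z ≤ length (rounds n))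
        (∑-cong (rounds n) (λ ω → cong₂ (λ a b → 𝟙 (a <? b + s)) (sym (colorCount-step x ω zero)) (sym (colorCount-step x ω j))))
        (step-deviation (λ p → 𝟙 (seen x p ≟ j)) s (λ p → exclusive (seen x p ≟ zero) (seen x p ≟ j)) drift)
        where
        exclusive : ∀ {l : Fin (suc k)} (d : Dec (l ≡ zero)) (d′ : Dec (l ≡ j)) → 𝟙 d + 𝟙 d′ ≤ 1
        exclusive (yes l≡0) (yes l≡j) = contradiction (trans (sym l≡j) l≡0) j≢0
        exclusive (yes _)   (no _)    = ≤-refl
        exclusive (no _)    d′        = 𝟙≤1 d′

      plurality-deviation : ∀ s →
        suc m * (n * n) * s + m * suc m * (n * n) * e ≤ m * A₀ →
        2 ^ e * ∑ (rounds n) (λ ω → 𝟙 (colorCount (step ω x) zero <? s)) ≤ length (rounds n)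
      plurality-deviation s drift = subst (λ z → 2 ^ e * z ≤ length (rounds n))
        (∑-cong (rounds n) (λ ω → cong₂ (λ a b → 𝟙 (a <? b + s)) (sym (colorCount-step x ω zero)) (vsum-0 ω)))
        (step-deviation (λ _ → 0) s (λ p → ≤-trans (≤-reflexive (+-identityʳ (f p))) (𝟙≤1 (seen x p ≟ zero)))
          (≤-trans (≤-reflexive (cong (λ z → z + suc m * (n * n) * s + m * suc m * (n * n) * e)
            (trans (cong (suc m *_) (trans (∑-const 0 (picks n)) (*-zeroʳ (length (picks n))))) (*-zeroʳ (suc m))))) drift))
        where
        vsum-0 : ∀ {A : Set} {l} (ω : Vec A l) → vsum (λ _ → 0) ω ≡ 0
        vsum-0 []      = refl
        vsum-0 (_ ∷ ω) = vsum-0 ω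

    plurality-picks≥ : colorCount x zero * colorCount x zero * (colorCount x zero + 3 * minority x) ≤ picksOf x zero
    plurality-picks≥ = majority-picks n (colorCount x zero) (minority x) (collisions x) (picksOf x zero) minority-complement
      (collisions-bound x zero (minority x) (λ v x≢ → +-cancelˡ-≤ (colorCount x zero) _ _
        (≤-trans (colorCount-disjoint x zero (x v) (x≢ ∘ sym)) (≤-reflexive (sym minority-complement)))))
      (picksOf-formula x zero)

    expected-minority : .{{_ : NonZero n}} → 2 * n ≤ 3 * colorCount x zero →
      9 * ∑ (rounds n) (λ ω → minority (step ω x)) ≤ 7 * minority x * length (rounds n)
    expected-minority le = *-cancelˡ-≤ M {{length-picks-nonZero n}} (begin
      M * (9 * ∑ (rounds n) (λ ω → minority (step ω x))) ≡⟨ cong (λ z → M * (9 * z)) (∑-cong (rounds n) (λ ω → ∑-allFin-lookup h ω)) ⟩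
      M * (9 * ∑ (rounds n) (vsum h))       ≡⟨ lemma₁ M _ ⟩
      9 * (M * ∑ (rounds n) (vsum h))       ≡⟨ cong (9 *_) (∑-vectors-vsum h (picks n) n) ⟩
      9 * (n * H * M ^ n)                   ≡⟨ lemma₂ n H (M ^ n) ⟩
      9 * H * n * M ^ n                     ≤⟨ *-monoˡ-≤ (M ^ n) (*-monoˡ-≤ n shrink) ⟩
      7 * (n * n * q) * n * M ^ n           ≡⟨ lemma₃ n q (M ^ n) ⟩
      n * (n * n) * (7 * q * M ^ n)         ≡⟨ cong₂ (λ u v → u * (7 * q * v)) (length-picks n) (length-rounds n) ⟨
      M * (7 * q * length (rounds n))       ∎)
      where
      M = length (picks n)
      q = minority x
      h : Picks n → ℕ
      h p = 𝟙 (¬? (seen x p ≟ zero))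
      H = ∑ (picks n) h
      H+A≡ : H + picksOf x zero ≡ n * (n * n)
      H+A≡ = begin-equality
        H + picksOf x zero ≡⟨ ∑-+ h _ (picks n) ⟨
        ∑ (picks n) (λ p → h p + 𝟙 (seen x p ≟ zero)) ≡⟨ ∑-cong (picks n) (λ p → 𝟙-¬ (seen x p ≟ zero)) ⟩
        ∑ (picks n) (λ _ → 1) ≡⟨ ∑-const 1 (picks n) ⟩
        M * 1              ≡⟨ trans (*-identityʳ M) (length-picks n) ⟩
        n * (n * n)        ∎
      shrink : 9 * H ≤ 7 * (n * n * q)
      shrink = minority-shrinks n (colorCount x zero) q (picksOf x zero) H minority-complement le plurality-picks≥ H+A≡
      lemma₁ : ∀ a b → a * (9 * b) ≡ 9 * (a * b)
      lemma₁ = solve-∀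
      lemma₂ : ∀ n H p → 9 * (n * H * p) ≡ 9 * H * n * p
      lemma₂ = solve-∀
      lemma₃ : ∀ n q p → 7 * (n * n * q) * n * p ≡ n * (n * n) * (7 * q * p)
      lemma₃ = solve-∀

  failures : ∀ {n k} → Coloring n (suc k) → ℕ → ℕ
  failures {n} x T = ∑ (outcomes n T) (λ ωs → 𝟙 (¬? (reaches? x ωs)))

  allPlurality-reaches : ∀ {n k T} (x : Coloring n (suc k)) (ωs : Vec (Round n) T) → AllPlurality x → Reaches x ωs
  allPlurality-reaches x []       all = all
  allPlurality-reaches x (ω ∷ ωs) all = inj₁ all

  𝟙-mono : {P Q : Set} (d : Dec P) (d′ : Dec Q) → (P → Q) → 𝟙 d ≤ 𝟙 d′
  𝟙-mono (yes p) d′ f = ≤-reflexive (sym (𝟙-yes d′ (f p)))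
  𝟙-mono (no _)  d′ f = z≤n

  module _ {n k : ℕ} (x : Coloring n (suc k)) where

    failures-suc : ∀ T → failures x (suc T) ≤ ∑ (rounds n) (λ ω → failures (step ω x) T)
    failures-suc T = ≤-trans (≤-reflexive (∑-cartesianProductWith _∷_ _ (rounds n) (outcomes n T)))
      (∑-mono (rounds n) (λ ω → ∑-mono (outcomes n T) (λ ωs →
        𝟙-mono (¬? (reaches? x (ω ∷ ωs))) (¬? (reaches? (step ω x) ωs)) (λ ¬r r → ¬r (inj₂ r)))))

    failures≤ : ∀ T → failures x T ≤ length (rounds n) ^ T
    failures≤ T = ≤-trans (∑-mono (outcomes n T) (λ ωs → 𝟙≤1 (¬? (reaches? x ωs))))
      (≤-reflexive (trans (∑-const 1 (outcomes n T)) (trans (*-identityʳ _) (length-vectors (rounds n) T))))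

    -- Markov's inequality in counting form: a state that is not yet unanimous has at least one
    -- minority node.
    failures-0≤minority : failures x 0 ≤ minority x
    failures-0≤minority with allPlurality-or-minority x
    ... | inj₁ all = ≤-trans (≤-reflexive (cong (_+ 0) (𝟙-no (¬? (reaches? x [])) (λ ¬all → ¬all all)))) z≤n
    ... | inj₂ (v , x≢) = ≤-trans (failures≤ 0) (minority-positive x v x≢)

  module _ {n k : ℕ} (ℓ : ℕ) .{{n≢0 : NonZero n}} (1≤ℓ : 1 ≤ ℓ) (ℓ≪n : 3200 * ℓ ≤ n) where

    private
      N = length (rounds n)
      E = 2 ^ (6 * ℓ)

    -- An integer threshold that guarantees `2 n ≤ 3 c`. It exceeds `2n/3` by at most 1, which is
    -- the `+ 3` allowed for in `majority-drift`.
    twoThirds : ℕ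
    twoThirds = suc (2 * n / 3)

    majority-loss : Coloring n (suc k) → Round n → ℕ
    majority-loss x ω = 𝟙 (colorCount (step ω x) zero <? twoThirds)

    majority-loss-rare : ∀ (x : Coloring n (suc k)) → 2 * n ≤ 3 * colorCount x zero →
                         E * ∑ (rounds n) (majority-loss x) ≤ N
    majority-loss-rare x le = plurality-deviation x 18 (6 * ℓ) twoThirds
      (majority-drift n (colorCount x zero) (minority x) (picksOf x zero) twoThirds ℓ (minority-complement x) le
        (plurality-picks≥ x) bound 1≤ℓ ℓ≪n)
      where
      bound : 3 * twoThirds ≤ 2 * n + 3
      bound = begin
        3 * twoThirds           ≡⟨ lemma (2 * n / 3) ⟩
        2 * n / 3 * 3 + 3       ≤⟨ +-monoˡ-≤ 3 (m/n*n≤m (2 * n) 3) ⟩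
        2 * n + 3               ∎
        where
        lemma : ∀ a → 3 * suc a ≡ a * 3 + 3
        lemma = solve-∀

    twoThirds-enough : ∀ {c} → twoThirds ≤ c → 2 * n ≤ 3 * c
    twoThirds-enough {c} le = begin
      2 * n                               ≡⟨ m≡m%n+[m/n]*n (2 * n) 3 ⟩
      (2 * n) % 3 + 2 * n / 3 * 3         ≤⟨ +-monoˡ-≤ (2 * n / 3 * 3) (<⇒≤ (m%n<n (2 * n) 3)) ⟩
      twoThirds * 3                       ≡⟨ *-comm twoThirds 3 ⟩
      3 * twoThirds                       ≤⟨ *-monoʳ-≤ 3 le ⟩
      3 * c                               ∎

    -- As probabilities: failure is at most `(7/9)^T` times the minority, plus `T/E`. The
    -- contraction is available only while color 1 holds two thirds, so each round is split by
    -- `majority-loss`; a loss is charged as certain failure, at cost `1/E`.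
    majority-phase : ∀ T (x : Coloring n (suc k)) → 2 * n ≤ 3 * colorCount x zero →
      9 ^ T * E * failures x T ≤ N ^ T * (7 ^ T * E * minority x + T * 9 ^ T)
    majority-phase zero x le = begin
      1 * E * failures x 0               ≤⟨ *-monoʳ-≤ (1 * E) (failures-0≤minority x) ⟩
      1 * E * minority x                 ≡⟨ lemma (1 * E * minority x) ⟩
      1 * (1 * E * minority x + 0)       ∎
      where
      lemma : ∀ a → a ≡ 1 * (a + 0)
      lemma = solve-∀
    majority-phase (suc T) x le = begin
      9 ^ suc T * E * failures x (suc T)
        ≤⟨ *-monoʳ-≤ (9 ^ suc T * E) (failures-suc x T) ⟩
      9 ^ suc T * E * ∑ R (λ ω → failures (step ω x) T)
        ≡⟨ trans (lemma₁ (9 ^ T) E _) (cong (9 *_) (sym (∑-*ˡ (9 ^ T * E) _ R))) ⟩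
      9 * ∑ R (λ ω → 9 ^ T * E * failures (step ω x) T)
        ≤⟨ *-monoʳ-≤ 9 (∑-mono R (λ ω → pointwise ω (colorCount (step ω x) zero <? twoThirds))) ⟩
      9 * ∑ R (λ ω → N ^ T * (7 ^ T * E * minority (step ω x) + T * 9 ^ T) + N ^ T * 9 ^ T * E * majority-loss x ω)
        ≡⟨ cong (9 *_) sum ⟩
      9 * (N ^ T * (7 ^ T * E * Q + N * (T * 9 ^ T)) + N ^ T * 9 ^ T * E * B)
        ≡⟨ lemma₂ (N ^ T) (7 ^ T) (9 ^ T) E Q N T B ⟩
      N ^ T * (7 ^ T * E * (9 * Q) + N * (T * 9 ^ suc T)) + N ^ T * 9 ^ suc T * (E * B)
        ≤⟨ +-mono-≤ (*-monoʳ-≤ (N ^ T) (+-monoˡ-≤ (N * (T * 9 ^ suc T)) (*-monoʳ-≤ (7 ^ T * E) (expected-minority x le))))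
                    (*-monoʳ-≤ (N ^ T * 9 ^ suc T) (majority-loss-rare x le)) ⟩
      N ^ T * (7 ^ T * E * (7 * minority x * N) + N * (T * 9 ^ suc T)) + N ^ T * 9 ^ suc T * N
        ≡⟨ lemma₃ (N ^ T) (7 ^ T) (9 ^ T) E (minority x) N T ⟩
      N ^ suc T * (7 ^ suc T * E * minority x + suc T * 9 ^ suc T) ∎
      where
      R = rounds n
      Q = ∑ R (λ ω → minority (step ω x))
      B = ∑ R (majority-loss x)
      pointwise : ∀ ω (d : Dec (colorCount (step ω x) zero < twoThirds)) → 9 ^ T * E * failures (step ω x) T ≤
        N ^ T * (7 ^ T * E * minority (step ω x) + T * 9 ^ T) + N ^ T * 9 ^ T * E * 𝟙 d
      pointwise ω (yes _) = ≤-trans (≤-trans (*-monoʳ-≤ (9 ^ T * E) (failures≤ (step ω x) T)) (≤-reflexive (lemma (9 ^ T) E (N ^ T)))) (m≤n+m _ _)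
        where
        lemma : ∀ a b c → a * b * c ≡ c * a * b * 1
        lemma = solve-∀
      pointwise ω (no ≮) = ≤-trans (majority-phase T (step ω x) (twoThirds-enough (≮⇒≥ ≮))) (m≤m+n _ _)
      sum : ∑ R (λ ω → N ^ T * (7 ^ T * E * minority (step ω x) + T * 9 ^ T) + N ^ T * 9 ^ T * E * majority-loss x ω) ≡
            N ^ T * (7 ^ T * E * Q + N * (T * 9 ^ T)) + N ^ T * 9 ^ T * E * B
      sum = trans (∑-+ _ _ R) (cong₂ _+_
        (trans (∑-*ˡ (N ^ T) _ R) (cong (N ^ T *_) (trans (∑-+ _ _ R) (cong₂ _+_ (∑-*ˡ (7 ^ T * E) _ R) (∑-const (T * 9 ^ T) R)))))
        (∑-*ˡ (N ^ T * 9 ^ T * E) _ R))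
      lemma₁ : ∀ a E F → 9 * a * E * F ≡ 9 * (a * E * F)
      lemma₁ = solve-∀
      lemma₂ : ∀ P S Z E Q N T B → 9 * (P * (S * E * Q + N * (T * Z)) + P * Z * E * B) ≡
               P * (S * E * (9 * Q) + N * (T * (9 * Z))) + P * (9 * Z) * (E * B)
      lemma₂ = solve-∀
      lemma₃ : ∀ P S Z E q N T → P * (S * E * (7 * q * N) + N * (T * (9 * Z))) + P * (9 * Z) * N ≡
               N * P * (7 * S * E * q + suc T * (9 * Z))
      lemma₃ = solve-∀

  -- The growth phase

  majority-∈ : ∀ {k} (α β δ : Fin k) → majority α β δ ≡ α ⊎ majority α β δ ≡ β
  majority-∈ α β δ with α ≟ β | α ≟ δ | β ≟ δ
  ... | yes _ | _     | _     = inj₁ refl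
  ... | no _  | yes _ | _     = inj₁ refl
  ... | no _  | no _  | yes _ = inj₂ refl
  ... | no _  | no _  | no _  = inj₁ refl

  -- A round creates no new colors. Every color present afterwards was held by some node before, so
  -- control over the colors of the old nodes yields `Leads` for the new state.
  step-color : ∀ {n k} (x : Coloring n k) ω v → ∃[ u ] step ω x v ≡ x u
  step-color x ω v = pick (lookup ω v)
    where
    pick : ∀ p → ∃[ u ] seen x p ≡ x u
    pick (a , b , c) with majority-∈ (x a) (x b) (x c)
    ... | inj₁ eq = a , eq
    ... | inj₂ eq = b , eq

  -- Quantified over nodes, not colors: this keeps the union bound at n terms however large k is.
  Leads : ∀ {n k} → Coloring n (suc k) → ℕ → Set
  Leads x s = ∀ v → x v ≢ zero → colorCount x (x v) + s ≤ colorCount x zero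

  module _ {n k : ℕ} (ℓ c s₀ h : ℕ) .{{n≢0 : NonZero n}} .{{s₀≢0 : NonZero s₀}} .{{h≢0 : NonZero h}}
           (1≤ℓ : 1 ≤ ℓ) (ℓ≪n : 3200 * ℓ ≤ n)
           (2≤h : 2 ≤ h) (h≤s₀ : h ≤ s₀) (24n≤hc : 24 * n ≤ h * c)
           (big : 1152 * (n * n * ℓ) ≤ s₀ * s₀ * c) where

    private
      N = length (rounds n)
      E = 2 ^ (6 * ℓ)

    -- t more rounds of growth by the factor 1 + 1/h would bring the bias above n.
    record Biased (t : ℕ) (x : Coloring n (suc k)) : Set where
      field
        s      : ℕ
        s₀≤s   : s₀ ≤ s
        s≤lead : s ≤ colorCount x zero
        c≤     : c ≤ colorCount x zero
        leads  : Leads x s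
        enough : h ^ t * n < suc h ^ t * s

    Good : ℕ → Coloring n (suc k) → Set
    Good t x = 2 * n ≤ 3 * colorCount x zero ⊎ Biased t x

    module _ (t : ℕ) (x : Coloring n (suc k)) (¬majority : ¬ 2 * n ≤ 3 * colorCount x zero) (biased : Biased (suc t) x) where

      open Biased biased

      private
        V = allFin n
        a = colorCount x zero
        q = minority x
        b = a ∸ s
        inc = increment n s c h 2≤h (≤-trans h≤s₀ s₀≤s) 24n≤hc
        d = proj₁ inc
        s≢0 : NonZero s
        s≢0 = >-nonZero (≤-trans (>-nonZero⁻¹ s₀) s₀≤s)
        rt = rate n s a ℓ {{s≢0}} (≤-trans s≤lead (colorCount≤n x zero)) (≤-trans big (*-mono-≤ (*-mono-≤ s₀≤s s₀≤s) c≤))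
        m = proj₁ rt
        n≤3q : n ≤ 3 * q
        n≤3q = +-cancelˡ-≤ (2 * n) _ _ (begin
          2 * n + n       ≡⟨ lemma n ⟩
          3 * n           ≡⟨ cong (3 *_) (minority-complement x) ⟨
          3 * (a + q)     ≡⟨ *-distribˡ-+ 3 a q ⟩
          3 * a + 3 * q   ≤⟨ +-monoˡ-≤ (3 * q) (<⇒≤ (≰⇒> ¬majority)) ⟩
          2 * n + 3 * q   ∎)
          where
          lemma : ∀ n → 2 * n + n ≡ 3 * n
          lemma = solve-∀
        b+s≡ : b + s ≡ a
        b+s≡ = m∸n+n≡m s≤lead
        few-collisions : collisions x + a * b ≤ a * a + n * b
        few-collisions = collisions-bound x zero b (λ v x≢ → ≤-trans (≤-reflexive (sym (m+n∸n≡m (colorCount x (x v)) s))) (∸-monoˡ-≤ s (leads v x≢)))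

      behind : Fin n → Round n → ℕ
      behind v ω = 𝟙 (colorCount (step ω x) zero <? colorCount (step ω x) (x v) + (s + d))

      -- A sum rather than the indicator of a union: linearity then gives the union bound, and any
      -- single bad event makes it at least 1.
      bias-loss : Round n → ℕ
      bias-loss ω = 𝟙 (colorCount (step ω x) zero <? c) + ∑ V (λ v → 𝟙 (¬? (x v ≟ zero)) * behind v ω)

      bias-loss-rare : E * ∑ (rounds n) bias-loss ≤ suc n * N
      bias-loss-rare = begin
        E * ∑ (rounds n) bias-loss
          ≡⟨ cong (E *_) (trans (∑-+ _ _ (rounds n)) (cong (B₀ +_) (∑-swap (λ ω v → 𝟙 (¬? (x v ≟ zero)) * behind v ω) (rounds n) V))) ⟩
        E * (B₀ + ∑ V (λ v → ∑ (rounds n) (λ ω → 𝟙 (¬? (x v ≟ zero)) * behind v ω)))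
          ≡⟨ trans (*-distribˡ-+ E B₀ _) (cong (E * B₀ +_) (sym (∑-*ˡ E _ V))) ⟩
        E * B₀ + ∑ V (λ v → E * ∑ (rounds n) (λ ω → 𝟙 (¬? (x v ≟ zero)) * behind v ω))
          ≤⟨ +-mono-≤ plurality-rare (∑-mono V (λ v → behind-rare v (x v ≟ zero))) ⟩
        N + ∑ V (λ _ → N)
          ≡⟨ cong (N +_) (∑-allFin-const n N) ⟩
        suc n * N ∎
        where
        B₀ = ∑ (rounds n) (λ ω → 𝟙 (colorCount (step ω x) zero <? c))
        plurality-rare : E * B₀ ≤ N
        plurality-rare = plurality-deviation x m (6 * ℓ) {{n≢0}} {{proj₁ (proj₂ rt)}} c
          (plurality-drift n a c q s b (collisions x) (picksOf x zero) m (6 * ℓ) (minority-complement x) n≤3q b+s≡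
            few-collisions (picksOf-formula x zero) c≤ (proj₁ (proj₂ (proj₂ rt))) (proj₂ (proj₂ (proj₂ rt))))
        behind-rare : ∀ v (e : Dec (x v ≡ zero)) → E * ∑ (rounds n) (λ ω → 𝟙 (¬? e) * behind v ω) ≤ N
        behind-rare v (yes _) = ≤-trans (≤-reflexive (trans (cong (E *_) (trans (∑-const 0 (rounds n)) (*-zeroʳ N))) (*-zeroʳ E))) z≤n
        behind-rare v (no x≢) = ≤-trans (*-monoʳ-≤ E (≤-reflexive (∑-cong (rounds n) (λ ω → *-identityˡ (behind v ω)))))
          (lead-deviation x m (6 * ℓ) {{n≢0}} {{proj₁ (proj₂ rt)}} (x v) (s + d) x≢
            (bias-drift n a q (colorCount x (x v)) s d b (collisions x) (picksOf x zero) (picksOf x (x v)) m (6 * ℓ)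
              (minority-complement x) n≤3q b+s≡ few-collisions (picksOf-formula x zero) (picksOf-formula x (x v)) (leads v x≢)
              (≤-trans (proj₁ (proj₂ (proj₂ inc))) (*-monoʳ-≤ s c≤)) (proj₂ (proj₂ (proj₂ inc)))
              (proj₁ (proj₂ (proj₂ rt))) (proj₂ (proj₂ (proj₂ rt)))))

      bias-step : ∀ ω → Good t (step ω x) ⊎ 1 ≤ bias-loss ω
      bias-step ω with colorCount (step ω x) zero <? c
      ... | yes lt = inj₂ (≤-trans (≤-reflexive (sym (𝟙-yes (_ <? c) lt))) (m≤m+n _ _))
      ... | no c≰ with any? (λ v → ¬? (x v ≟ zero) ×-dec (colorCount (step ω x) zero <? colorCount (step ω x) (x v) + (s + d)))
      ... | yes (v , x≢ , lt) = inj₂ (≤-trans (≤-reflexive (sym (cong₂ _*_ (𝟙-yes (¬? (x v ≟ zero)) x≢) (𝟙-yes (_ <? _) lt))))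
                                       (≤-trans (term≤∑ (λ v → 𝟙 (¬? (x v ≟ zero)) * behind v ω) v) (m≤n+m _ _)))
      ... | no none = inj₁ (inj₂ (record
        { s      = s + d
        ; s₀≤s   = ≤-trans s₀≤s (m≤m+n s d)
        ; s≤lead = s+d≤
        ; c≤     = ≮⇒≥ c≰
        ; leads  = leads′
        ; enough = enough′
        }))
        where
        ahead : ∀ v → x v ≢ zero → colorCount (step ω x) (x v) + (s + d) ≤ colorCount (step ω x) zero
        ahead v x≢ = ≮⇒≥ (λ lt → none (v , x≢ , lt))
        -- The bound on the lead is read off from some competitor. If there were none, `a` would
        -- equal `n`, against `¬majority`.
        s+d≤ : s + d ≤ colorCount (step ω x) zero
        s+d≤ with allPlurality-or-minority x
        ... | inj₂ (v , x≢) = ≤-trans (m≤n+m (s + d) (colorCount (step ω x) (x v))) (ahead v x≢)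
        ... | inj₁ all = contradiction (≤-trans (*-monoˡ-≤ n {2} {3} (s≤s (s≤s z≤n))) (≤-reflexive (cong (3 *_)
                (trans (sym (minority-complement x)) (trans (cong (a +_) (allPlurality-minority x all)) (+-identityʳ a)))))) ¬majority
        leads′ : Leads (step ω x) (s + d)
        leads′ v x≢ with step-color x ω v
        ... | u , eq = subst (λ j → colorCount (step ω x) j + (s + d) ≤ colorCount (step ω x) zero) (sym eq)
                             (ahead u (λ xu≡0 → x≢ (trans eq xu≡0)))
        enough′ : h ^ t * n < suc h ^ t * (s + d)
        enough′ = *-cancelˡ-< h _ _ (begin-strict
          h * (h ^ t * n)             ≡⟨ *-assoc h (h ^ t) n ⟨
          h ^ suc t * n               <⟨ enough ⟩
          suc h ^ suc t * s           ≡⟨ lemma₁ (suc h ^ t) h s ⟩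
          suc h ^ t * (h * s + s)     ≤⟨ *-monoʳ-≤ (suc h ^ t) (+-monoʳ-≤ (h * s) (proj₁ (proj₂ inc))) ⟩
          suc h ^ t * (h * s + h * d) ≡⟨ lemma₂ (suc h ^ t) h s d ⟩
          h * (suc h ^ t * (s + d))   ∎)
          where
          lemma₁ : ∀ p h s → suc h * p * s ≡ p * (h * s + s)
          lemma₁ = solve-∀
          lemma₂ : ∀ p h s d → p * (h * s + h * d) ≡ h * (p * (s + d))
          lemma₂ = solve-∀

    -- The phase is decided by the current count, not by the disjunct supplied. A biased state that
    -- already holds two thirds is thus treated by the majority estimate, and the growth estimate is
    -- used only where the minority is at least `n/3`.
    good-step : ∀ t x → Good (suc t) x →
      ∃[ loss ] (∀ ω → Good t (step ω x) ⊎ 1 ≤ loss ω) × E * ∑ (rounds n) loss ≤ suc n * N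
    good-step t x good with 2 * n ≤? 3 * colorCount x zero | good
    ... | no ¬majority | inj₁ le     = contradiction le ¬majority
    ... | no ¬majority | inj₂ biased = bias-loss t x ¬majority biased , bias-step t x ¬majority biased , bias-loss-rare t x ¬majority biased
    ... | yes le       | _           = majority-loss ℓ 1≤ℓ ℓ≪n x , stays ,
      ≤-trans (majority-loss-rare ℓ 1≤ℓ ℓ≪n x le) (m≤m+n N (n * N))
      where
      stays : ∀ ω → Good t (step ω x) ⊎ 1 ≤ majority-loss ℓ 1≤ℓ ℓ≪n x ω
      stays ω with colorCount (step ω x) zero <? twoThirds {n} {k} ℓ 1≤ℓ ℓ≪n
      ... | yes lt = inj₂ (≤-reflexive (sym (𝟙-yes (_ <? twoThirds {n} {k} ℓ 1≤ℓ ℓ≪n) lt)))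
      ... | no ≮  = inj₁ (inj₁ (twoThirds-enough {n} {k} ℓ 1≤ℓ ℓ≪n (≮⇒≥ ≮)))

    private
      T₂ = 3 * (6 * ℓ)

    majority-end : ∀ (x : Coloring n (suc k)) → 2 * n ≤ 3 * colorCount x zero → E * failures x T₂ ≤ N ^ T₂ * (n + T₂)
    majority-end x le = *-cancelˡ-≤ (9 ^ T₂) {{m^n≢0 9 T₂}} (begin
      9 ^ T₂ * (E * failures x T₂)                          ≡⟨ *-assoc (9 ^ T₂) E _ ⟨
      9 ^ T₂ * E * failures x T₂                            ≤⟨ majority-phase ℓ 1≤ℓ ℓ≪n T₂ x le ⟩
      N ^ T₂ * (7 ^ T₂ * E * minority x + T₂ * 9 ^ T₂)      ≤⟨ *-monoʳ-≤ (N ^ T₂) (+-monoˡ-≤ (T₂ * 9 ^ T₂) (*-mono-≤ ratio minority≤n)) ⟩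
      N ^ T₂ * (9 ^ T₂ * n + T₂ * 9 ^ T₂)                   ≡⟨ lemma (N ^ T₂) (9 ^ T₂) n T₂ ⟩
      9 ^ T₂ * (N ^ T₂ * (n + T₂))                          ∎)
      where
      minority≤n : minority x ≤ n
      minority≤n = ≤-trans (m≤n+m (minority x) _) (≤-reflexive (minority-complement x))
      ratio : 7 ^ T₂ * E ≤ 9 ^ T₂
      ratio = begin
        7 ^ T₂ * 2 ^ (6 * ℓ)          ≡⟨ cong (_* 2 ^ (6 * ℓ)) (^-*-assoc 7 3 (6 * ℓ)) ⟨
        -- Three rounds at least halve the expected minority, as `7³ · 2 = 686 ≤ 729 = 9³`; hence
        -- `T₂ = 3 · 6ℓ` rounds gain the factor `E`.
        (7 ^ 3) ^ (6 * ℓ) * 2 ^ (6 * ℓ) ≡⟨ ^-distribʳ-* (6 * ℓ) (7 ^ 3) 2 ⟨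
        (7 ^ 3 * 2) ^ (6 * ℓ)         ≤⟨ ^-monoˡ-≤ (6 * ℓ) (≤ᵇ⇒≤ (7 ^ 3 * 2) (9 ^ 3) _) ⟩
        (9 ^ 3) ^ (6 * ℓ)             ≡⟨ ^-*-assoc 9 3 (6 * ℓ) ⟩
        9 ^ T₂                        ∎
      lemma : ∀ P Z n T → P * (Z * n + T * Z) ≡ Z * (P * (n + T))
      lemma = solve-∀

    -- Failure has probability at most `(n + T₂ + t(n+1))/E`: each growth round contributes the
    -- `n + 1` events of `bias-loss`, and `majority-end` contributes `n + T₂`.
    growth-phase : ∀ t x → Good t x → E * failures x (t + T₂) ≤ N ^ (t + T₂) * (n + T₂ + t * suc n)
    growth-phase zero x (inj₁ le) = subst (E * failures x T₂ ≤_) (cong (N ^ T₂ *_) (sym (+-identityʳ (n + T₂)))) (majority-end x le)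
    -- With no growth round left, `enough` asserts a lead above `n`, which is impossible; only the
    -- majority alternative survives.
    growth-phase zero x (inj₂ biased) = contradiction (Biased.enough biased)
      (≤⇒≯ (*-monoʳ-≤ 1 (≤-trans (Biased.s≤lead biased) (colorCount≤n x zero))))
    growth-phase (suc t) x good with good-step t x good
    ... | loss , good-or-loss , rare = begin
      E * failures x (suc t + T₂)
        ≤⟨ *-monoʳ-≤ E (failures-suc x (t + T₂)) ⟩
      E * ∑ R (λ ω → failures (step ω x) (t + T₂))
        ≡⟨ ∑-*ˡ E _ R ⟨
      ∑ R (λ ω → E * failures (step ω x) (t + T₂))
        ≤⟨ ∑-mono R (λ ω → pointwise ω (good-or-loss ω)) ⟩
      ∑ R (λ ω → P * K + P * E * loss ω)
        ≡⟨ trans (∑-+ _ _ R) (cong₂ _+_ (∑-const (P * K) R) (∑-*ˡ (P * E) loss R)) ⟩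
      N * (P * K) + P * E * ∑ R loss
        ≡⟨ cong (N * (P * K) +_) (*-assoc P E (∑ R loss)) ⟩
      N * (P * K) + P * (E * ∑ R loss)
        ≤⟨ +-monoʳ-≤ (N * (P * K)) (*-monoʳ-≤ P rare) ⟩
      N * (P * K) + P * (suc n * N)
        ≡⟨ lemma N P (n + T₂) t (suc n) ⟩
      N * P * (n + T₂ + suc t * suc n) ∎
      where
      R = rounds n
      P = N ^ (t + T₂)
      K = n + T₂ + t * suc n
      pointwise : ∀ ω → Good t (step ω x) ⊎ 1 ≤ loss ω → E * failures (step ω x) (t + T₂) ≤ P * K + P * E * loss ω
      pointwise ω (inj₁ good′) = ≤-trans (growth-phase t (step ω x) good′) (m≤m+n _ _)
      pointwise ω (inj₂ 1≤)    = begin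
        E * failures (step ω x) (t + T₂)  ≤⟨ *-monoʳ-≤ E (failures≤ (step ω x) (t + T₂)) ⟩
        E * P                             ≡⟨ trans (*-comm E P) (sym (*-identityʳ (P * E))) ⟩
        P * E * 1                         ≤⟨ *-monoʳ-≤ (P * E) 1≤ ⟩
        P * E * loss ω                    ≤⟨ m≤n+m _ (P * K) ⟩
        P * K + P * E * loss ω            ∎
      lemma : ∀ N P A t B → N * (P * (A + t * B)) + P * (B * N) ≡ N * P * (A + suc t * B)
      lemma = solve-∀

  -- Numerical estimates and the choice of the parameters.

  linear≤exponential : ∀ A b ℓ₀ → 2 ≤ b → 1 ≤ ℓ₀ → A * ℓ₀ ≤ b ^ ℓ₀ → ∀ {ℓ} → ℓ₀ ≤ ℓ → A * ℓ ≤ b ^ ℓ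
  linear≤exponential A b ℓ₀ 2≤b 1≤ℓ₀ base ℓ₀≤ℓ with m≤n⇒∃[o]m+o≡n ℓ₀≤ℓ
  ... | i , refl = subst (λ z → A * z ≤ b ^ z) (+-comm i ℓ₀) (go i)
    where
    go : ∀ i → A * (i + ℓ₀) ≤ b ^ (i + ℓ₀)
    go zero    = base
    go (suc i) = begin
      A * (suc i + ℓ₀)                ≡⟨ lemma₁ A (i + ℓ₀) ⟩
      A * 1 + A * (i + ℓ₀)            ≤⟨ +-monoˡ-≤ (A * (i + ℓ₀)) (*-monoʳ-≤ A (≤-trans 1≤ℓ₀ (m≤n+m ℓ₀ i))) ⟩
      A * (i + ℓ₀) + A * (i + ℓ₀)     ≡⟨ lemma₂ (A * (i + ℓ₀)) ⟩
      2 * (A * (i + ℓ₀))              ≤⟨ *-mono-≤ 2≤b (go i) ⟩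
      b * b ^ (i + ℓ₀)                ∎
      where
      lemma₁ : ∀ A j → A * suc j ≡ A * 1 + A * j
      lemma₁ = solve-∀
      lemma₂ : ∀ a → a + a ≡ 2 * a
      lemma₂ = solve-∀

  -- At `ℓ = 15` this reads `28944 ≤ 32768`, and at `ℓ = 14` it is false. It is the source of the
  -- threshold `3 ^ 15` for `n`.
  linear≤2^ : ∀ {ℓ} → 15 ≤ ℓ → 1809 * suc ℓ ≤ 2 ^ ℓ
  linear≤2^ {ℓ} 15≤ℓ = *-cancelˡ-≤ 2 (≤-trans (≤-reflexive (sym (*-assoc 2 1809 (suc ℓ))))
    (linear≤exponential 3618 2 16 ≤-refl (s≤s z≤n) (≤ᵇ⇒≤ (3618 * 16) (2 ^ 16) _) (s≤s 15≤ℓ)))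

  linear≤3^ : ∀ {ℓ} → 15 ≤ ℓ → 3200 * ℓ ≤ 3 ^ ℓ
  linear≤3^ = linear≤exponential 3200 3 15 (s≤s (s≤s z≤n)) (s≤s z≤n) (≤ᵇ⇒≤ (3200 * 15) (3 ^ 15) _)

  -- Bounding `n`, `suc n` and `λ′` by `3^(ℓ+1)` leaves `27^ℓ` times a linear function of `ℓ`. The
  -- coefficient 1809 collects the constants, and the linear factor is at most `2^ℓ`.
  failure-budget : ∀ n ℓ λ′ → 15 ≤ ℓ → n < 3 ^ suc ℓ → λ′ ≤ suc n →
    n * (n + 3 * (6 * ℓ) + 24 * λ′ * (2 * suc ℓ) * suc n) ≤ 2 ^ (6 * ℓ)
  failure-budget n ℓ λ′ 15≤ n<P λ′≤ = begin
    n * (n + 3 * (6 * ℓ) + 24 * λ′ * (2 * suc ℓ) * suc n)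
      ≤⟨ *-mono-≤ (<⇒≤ n<P) (+-mono-≤ (+-mono-≤ (≤-trans (<⇒≤ n<P) (m≤m*n P (P * 1) {{m*n≢0 P 1}}))
           (m≤m*n (3 * (6 * ℓ)) (P * P) {{m*n≢0 P P}}))
         (*-mono-≤ (*-monoˡ-≤ (2 * suc ℓ) (*-monoʳ-≤ 24 (≤-trans λ′≤ n<P))) n<P)) ⟩
    P * (P * (P * 1) + 3 * (6 * ℓ) * (P * P) + 24 * P * (2 * suc ℓ) * P)
      ≤⟨ m≤m+n _ _ ⟩
    P * (P * (P * 1) + 3 * (6 * ℓ) * (P * P) + 24 * P * (2 * suc ℓ) * P) + P * P * P * (18 + ℓ)
      ≡⟨ lemma₁ (3 ^ ℓ) ℓ ⟩
    3 ^ ℓ * 3 ^ ℓ * 3 ^ ℓ * (1809 * suc ℓ)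
      ≤⟨ *-monoʳ-≤ (3 ^ ℓ * 3 ^ ℓ * 3 ^ ℓ) (linear≤2^ 15≤) ⟩
    3 ^ ℓ * 3 ^ ℓ * 3 ^ ℓ * 2 ^ ℓ
      ≡⟨ cong (λ z → z * 3 ^ ℓ * 2 ^ ℓ) (^-distribʳ-* ℓ 3 3) ⟨
    9 ^ ℓ * 3 ^ ℓ * 2 ^ ℓ
      ≡⟨ cong (_* 2 ^ ℓ) (^-distribʳ-* ℓ 9 3) ⟨
    27 ^ ℓ * 2 ^ ℓ
      ≡⟨ ^-distribʳ-* ℓ 27 2 ⟨
    54 ^ ℓ
      ≤⟨ ^-monoˡ-≤ ℓ (≤ᵇ⇒≤ 54 64 _) ⟩
    (2 ^ 6) ^ ℓ
      ≡⟨ ^-*-assoc 2 6 ℓ ⟩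
    2 ^ (6 * ℓ) ∎
    where
    P = 3 ^ suc ℓ
    instance
      P≢0 : NonZero P
      P≢0 = m^n≢0 3 (suc ℓ)
    lemma₁ : ∀ p ℓ → 3 * p * (3 * p * (3 * p * 1) + 3 * (6 * ℓ) * (3 * p * (3 * p)) + 24 * (3 * p) * (2 * suc ℓ) * (3 * p)) + 3 * p * (3 * p) * (3 * p) * (18 + ℓ) ≡
             p * p * p * (1809 * suc ℓ)
    lemma₁ = solve-∀

  failures-rare : ∀ {n k} ℓ → 3 ^ ℓ ≤ n → n < 3 ^ suc ℓ → 15 ≤ ℓ → (x : Coloring n (suc k)) →
    ∀ s → s ≤ colorCount x zero → Leads x s → 1152 * (n * n * ℓ) ≤ s * s * colorCount x zero →
    ∃[ T ] T * colorCount x zero ≤ 210 * (n * ℓ) × n * failures x T ≤ length (outcomes n T)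
  failures-rare {n} {k} ℓ 3^ℓ≤n n<3^ 15≤ℓ x s s≤c leads big =
    T₁ + 3 * (6 * ℓ) , duration , *-cancelˡ-≤ E {{m^n≢0 2 (6 * ℓ)}} (begin
      E * (n * failures x T)         ≡⟨ lemma₁ E n _ ⟩
      n * (E * failures x T)         ≤⟨ *-monoʳ-≤ n (growth-phase {n} {k} ℓ c s h 1≤ℓ (≤-trans (linear≤3^ 15≤ℓ) 3^ℓ≤n) 2≤h h≤s 24n≤hc big T₁ x (inj₂ initial)) ⟩
      n * (N ^ T * (n + 3 * (6 * ℓ) + T₁ * suc n)) ≡⟨ lemma₁ n (N ^ T) _ ⟩
      N ^ T * (n * (n + 3 * (6 * ℓ) + T₁ * suc n)) ≤⟨ *-monoʳ-≤ (N ^ T) (failure-budget n ℓ λ′ 15≤ℓ n<3^ (s≤s (m/n≤m n c))) ⟩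
      N ^ T * E                      ≡⟨ *-comm (N ^ T) E ⟩
      E * N ^ T                      ≡⟨ cong (E *_) (length-vectors (rounds n) T) ⟨
      E * length (outcomes n T)      ∎)
    where
    c = colorCount x zero
    E = 2 ^ (6 * ℓ)
    N = length (rounds n)
    1≤ℓ : 1 ≤ ℓ
    1≤ℓ = ≤-trans (s≤s z≤n) 15≤ℓ
    1≤n : 1 ≤ n
    1≤n = ≤-trans (m^n>0 3 ℓ) 3^ℓ≤n
    instance
      n≢0 : NonZero n
      n≢0 = >-nonZero 1≤n
    1≤ssc : 1 ≤ s * s * c
    1≤ssc = ≤-trans (≤-trans (*-mono-≤ (*-mono-≤ 1≤n 1≤n) 1≤ℓ) (m≤n*m (n * n * ℓ) 1152)) big
    instance
      ssc≢0 : NonZero (s * s * c)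
      ssc≢0 = >-nonZero 1≤ssc
      c≢0 : NonZero c
      c≢0 = m*n≢0⇒n≢0 (s * s)
      ss≢0 : NonZero (s * s)
      ss≢0 = m*n≢0⇒m≢0 (s * s) {c}
      s≢0 : NonZero s
      s≢0 = m*n≢0⇒n≢0 s
    -- `n/c` is the least possible value of the real parameter; rounding to an integer keeps `λ′ c`
    -- between `n` and `2 n`.
    λ′ = suc (n / c)
    h = 24 * λ′
    -- Since `(1 + 1/h)^h ≥ 2`, this many rounds multiply the lead by at least `4^(ℓ+1)`, which
    -- exceeds `n`.
    T₁ = h * (2 * suc ℓ)
    T = T₁ + 3 * (6 * ℓ)
    instance
      h≢0 : NonZero h
      h≢0 = m*n≢0 24 λ′
    2≤h : 2 ≤ h
    2≤h = *-mono-≤ {2} {24} {1} {λ′} (s≤s (s≤s z≤n)) (s≤s z≤n)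
    24n≤hc : 24 * n ≤ h * c
    24n≤hc = begin
      24 * n          ≤⟨ *-monoʳ-≤ 24 (≤-trans (≤-reflexive (m≡m%n+[m/n]*n n c)) (+-monoˡ-≤ (n / c * c) (<⇒≤ (m%n<n n c)))) ⟩
      24 * (λ′ * c)   ≡⟨ *-assoc 24 λ′ c ⟨
      h * c           ∎
    hc≤48n : h * c ≤ 48 * n
    hc≤48n = begin
      h * c           ≡⟨ *-assoc 24 λ′ c ⟩
      24 * (λ′ * c)   ≤⟨ *-monoʳ-≤ 24 (+-mono-≤ (colorCount≤n x zero) (m/n*n≤m n c)) ⟩
      24 * (n + n)    ≡⟨ lemma n ⟩
      48 * n          ∎
      where
      lemma : ∀ n → 24 * (n + n) ≡ 48 * n
      lemma = solve-∀
    -- Compared after squaring: `48² = 1152 · 2`, so `ℓ ≥ 2` and `c ≥ 1` suffice. Together with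
    -- `h c ≤ 48 n` it gives `h ≤ s`, as `increment` requires.
    48n≤sc : 48 * n ≤ s * c
    48n≤sc = ≮⇒≥ (λ lt → <⇒≱ (*-mono-< lt lt) (begin
      48 * n * (48 * n)             ≡⟨ lemma n ⟩
      1152 * (n * n * 2) * 1        ≤⟨ *-mono-≤ (*-monoʳ-≤ 1152 (*-monoʳ-≤ (n * n) (≤-trans (s≤s (s≤s z≤n)) 15≤ℓ))) (>-nonZero⁻¹ c) ⟩
      1152 * (n * n * ℓ) * c        ≤⟨ *-monoˡ-≤ c big ⟩
      s * s * c * c                 ≡⟨ lemma′ s c ⟩
      s * c * (s * c)               ∎))
      where
      lemma : ∀ n → 48 * n * (48 * n) ≡ 1152 * (n * n * 2) * 1
      lemma = solve-∀
      lemma′ : ∀ s c → s * s * c * c ≡ s * c * (s * c)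
      lemma′ = solve-∀
    h≤s : h ≤ s
    h≤s = *-cancelʳ-≤ h s c (≤-trans hc≤48n 48n≤sc)
    initial : Biased {n} {k} ℓ c s h 1≤ℓ (≤-trans (linear≤3^ 15≤ℓ) 3^ℓ≤n) 2≤h h≤s 24n≤hc big T₁ x
    initial = record
      { s = s ; s₀≤s = ≤-refl ; s≤lead = s≤c ; c≤ = ≤-refl ; leads = leads
      ; enough = begin-strict
          h ^ T₁ * n                  <⟨ *-monoʳ-< (h ^ T₁) {{m^n≢0 h T₁}} n<2^ ⟩
          h ^ T₁ * 2 ^ r              ≡⟨ *-comm (h ^ T₁) (2 ^ r) ⟩
          2 ^ r * h ^ T₁              ≤⟨ bernoulli-ratio-^ h h 2 1 r (≤-reflexive (double h)) ⟩
          1 ^ r * suc h ^ T₁          ≡⟨ cong (_* suc h ^ T₁) (^-zeroˡ r) ⟩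
          1 * suc h ^ T₁              ≡⟨ *-identityˡ (suc h ^ T₁) ⟩
          suc h ^ T₁                  ≤⟨ m≤m*n (suc h ^ T₁) s ⟩
          suc h ^ T₁ * s              ∎
      }
      where
      r = 2 * suc ℓ
      n<2^ : n < 2 ^ r
      n<2^ = begin-strict
        n                 <⟨ n<3^ ⟩
        3 ^ suc ℓ         ≤⟨ ^-monoˡ-≤ (suc ℓ) (s≤s (s≤s (s≤s z≤n))) ⟩
        (2 ^ 2) ^ suc ℓ   ≡⟨ ^-*-assoc 2 2 (suc ℓ) ⟩
        2 ^ r             ∎
      double : ∀ h → 2 * h ≡ 1 * (h + h)
      double = solve-∀
    -- The constant is `210 = 48 · 4 + 18`: growth takes `2(ℓ + 1) ≤ 4ℓ` blocks of `h` rounds with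
    -- `h c ≤ 48 n`, and the majority phase takes `18 ℓ` rounds.
    duration : T * c ≤ 210 * (n * ℓ)
    duration = begin
      T * c                                    ≡⟨ lemma h ℓ c ⟩
      h * c * (2 * (1 + ℓ)) + 18 * ℓ * c       ≤⟨ +-mono-≤ (*-mono-≤ hc≤48n (*-monoʳ-≤ 2 (+-monoˡ-≤ ℓ 1≤ℓ))) (*-monoʳ-≤ (18 * ℓ) (colorCount≤n x zero)) ⟩
      48 * n * (2 * (ℓ + ℓ)) + 18 * ℓ * n      ≡⟨ lemma′ n ℓ ⟩
      210 * (n * ℓ)                            ∎
      where
      lemma : ∀ h ℓ c → (h * (2 * suc ℓ) + 3 * (6 * ℓ)) * c ≡ h * c * (2 * (1 + ℓ)) + 18 * ℓ * c
      lemma = solve-∀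
      lemma′ : ∀ n ℓ → 48 * n * (2 * (ℓ + ℓ)) + 18 * ℓ * n ≡ 210 * (n * ℓ)
      lemma′ = solve-∀
    lemma₁ : ∀ a b c → a * (b * c) ≡ b * (a * c)
    lemma₁ = solve-∀

-- The functional equation of the exponential, for rational partial sums.

module RationalExponential where

  open import Data.Rational.Base
  open import Defs using (module RationalLemmas; module ExpLemmas; expTerm; expSum)
  open RationalLemmas
  open ExpLemmas using (recip≥0; term-suc; uniform-tail)
  open +-*-Solver
  open ℚₚ.≤-Reasoning

  expTerm-suc : ∀ x j → ι (suc j) * expTerm x (suc j) ≡ x * expTerm x j
  expTerm-suc x j = trans (solve 4 (λ a t x r → a :* (t :* (x :* r)) := (a :* r) :* (x :* t)) refl (ι (suc j)) (expTerm x j) x (ℤ.+ 1 / suc j))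
    (trans (cong (_* (x * expTerm x j)) (ι-inv j)) (ℚₚ.*-identityˡ _))

  ι-+ : ∀ a b → ι (a ℕ.+ b) ≡ ι a + ι b
  ι-+ zero    b = sym (ℚₚ.+-identityˡ (ι b))
  ι-+ (suc a) b = begin-equality
    ι (suc (a ℕ.+ b))   ≡⟨ ι-suc (a ℕ.+ b) ⟩
    1ℚ + ι (a ℕ.+ b)    ≡⟨ cong (1ℚ +_) (ι-+ a b) ⟩
    1ℚ + (ι a + ι b)    ≡⟨ ℚₚ.+-assoc 1ℚ (ι a) (ι b) ⟨
    1ℚ + ι a + ι b      ≡⟨ cong (_+ ι b) (ι-suc a) ⟨
    ι (suc a) + ι b     ∎

  ι-* : ∀ a b → ι (a ℕ.* b) ≡ ι a * ι b
  ι-* zero    b = sym (ℚₚ.*-zeroˡ (ι b))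
  ι-* (suc a) b = begin-equality
    ι (b ℕ.+ a ℕ.* b)   ≡⟨ ι-+ b (a ℕ.* b) ⟩
    ι b + ι (a ℕ.* b)   ≡⟨ cong₂ _+_ (sym (ℚₚ.*-identityˡ (ι b))) (ι-* a b) ⟩
    1ℚ * ι b + ι a * ι b ≡⟨ ℚₚ.*-distribʳ-+ (ι b) 1ℚ (ι a) ⟨
    (1ℚ + ι a) * ι b    ≡⟨ cong (_* ι b) (ι-suc a) ⟨
    ι (suc a) * ι b     ∎

  ι-pos : ∀ n → Positive (ι (suc n))
  ι-pos n = ℚₚ.normalize-pos (suc n) 1

  ι-cancelˡ : ∀ n {p q} → ι (suc n) * p ≡ ι (suc n) * q → p ≡ q
  ι-cancelˡ n eq = ℚₚ.≤-antisym (ℚₚ.*-cancelˡ-≤-pos (ι (suc n)) {{ι-pos n}} (ℚₚ.≤-reflexive eq))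
                                (ℚₚ.*-cancelˡ-≤-pos (ι (suc n)) {{ι-pos n}} (ℚₚ.≤-reflexive (sym eq)))

  *-nonNeg : ∀ {a b} → 0ℚ ≤ a → 0ℚ ≤ b → 0ℚ ≤ a * b
  *-nonNeg {a} {b} 0≤a 0≤b = subst (_≤ a * b) (ℚₚ.*-zeroʳ a) (*-monoˡ 0≤a 0≤b)

  +-nonNeg : ∀ {a b} → 0ℚ ≤ a → 0ℚ ≤ b → 0ℚ ≤ a + b
  +-nonNeg {a} {b} 0≤a 0≤b = subst (_≤ a + b) (ℚₚ.+-identityˡ 0ℚ) (ℚₚ.+-mono-≤ 0≤a 0≤b)

  p≤p+q : ∀ {p q} → 0ℚ ≤ q → p ≤ p + q
  p≤p+q {p} {q} 0≤q = subst (_≤ p + q) (ℚₚ.+-identityʳ p) (ℚₚ.+-monoʳ-≤ p 0≤q)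

  p≤q+p : ∀ {p q} → 0ℚ ≤ q → p ≤ q + p
  p≤q+p {p} {q} 0≤q = subst (_≤ q + p) (ℚₚ.+-identityˡ p) (ℚₚ.+-monoˡ-≤ p 0≤q)

  p-q≤r⇒p≤r+q : ∀ {p q r} → p - q ≤ r → p ≤ r + q
  p-q≤r⇒p≤r+q {p} {q} {r} le = subst (_≤ r + q) (solve 2 (λ p q → p :- q :+ q := p) refl p q) (ℚₚ.+-monoˡ-≤ q le)

  p≤r+q⇒p-q≤r : ∀ {p q r} → p ≤ r + q → p - q ≤ r
  p≤r+q⇒p-q≤r {p} {q} {r} le = subst (p - q ≤_) (solve 2 (λ r q → r :+ q :- q := r) refl r q) (ℚₚ.+-monoˡ-≤ (- q) le)

  p≤∣p∣ : ∀ p → p ≤ ∣ p ∣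
  p≤∣p∣ p with ℚₚ.≤-total 0ℚ p
  ... | inj₁ 0≤p = ℚₚ.≤-reflexive (sym (ℚₚ.0≤p⇒∣p∣≡p 0≤p))
  ... | inj₂ p≤0 = ℚₚ.≤-trans p≤0 (ℚₚ.0≤∣p∣ p)

  ∣∣≤⇒≤+ : ∀ {p q r} → ∣ p - q ∣ ≤ r → p ≤ r + q
  ∣∣≤⇒≤+ {p} {q} le = p-q≤r⇒p≤r+q (ℚₚ.≤-trans (p≤∣p∣ (p - q)) le)

  ∣∣≤⇒≥ : ∀ {p q r} → ∣ p - q ∣ ≤ r → q ≤ r + p
  ∣∣≤⇒≥ {p} {q} {r} le = ∣∣≤⇒≤+ {q} {p} (subst (_≤ r) (∣∣-sym p q) le)

  ∣expTerm∣ : ∀ x j → ∣ expTerm x j ∣ ≡ expTerm (∣ x ∣) j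
  ∣expTerm∣ x zero    = refl
  ∣expTerm∣ x (suc j) = trans (term-suc x j) (cong (_* ((∣ x ∣) * (ℤ.+ 1 / suc j))) (∣expTerm∣ x j))

  module _ {x : ℚ} (0≤x : 0ℚ ≤ x) where

    expTerm-nonNeg : ∀ j → 0ℚ ≤ expTerm x j
    expTerm-nonNeg zero    = ℚₚ.nonNegative⁻¹ 1ℚ
    expTerm-nonNeg (suc j) = *-nonNeg (expTerm-nonNeg j) (*-nonNeg 0≤x (recip≥0 j))

    expSum-mono : ∀ m d → expSum x m ≤ expSum x (d ℕ.+ m)
    expSum-mono m zero    = ℚₚ.≤-refl
    expSum-mono m (suc d) = ℚₚ.≤-trans (expSum-mono m d) (p≤p+q (expTerm-nonNeg (d ℕ.+ m)))

    expSum-nonNeg : ∀ m → 0ℚ ≤ expSum x m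
    expSum-nonNeg m = subst (λ z → 0ℚ ≤ expSum x z) (ℕₚ.+-identityʳ m) (expSum-mono 0 m)

  -- The triangle inequality over the added terms; it reduces signed arguments to non-negative ones,
  -- where partial sums are monotone.
  expSum-gap : ∀ y k d → ∣ expSum y (d ℕ.+ k) - expSum y k ∣ ≤ expSum (∣ y ∣) (d ℕ.+ k) - expSum (∣ y ∣) k
  expSum-gap y k zero    = ℚₚ.≤-reflexive (trans (cong ∣_∣ (ℚₚ.+-inverseʳ (expSum y k))) (sym (ℚₚ.+-inverseʳ (expSum (∣ y ∣) k))))
  expSum-gap y k (suc d) = begin
    ∣ S + t - S₀ ∣          ≡⟨ cong ∣_∣ (solve 3 (λ a b c → a :+ b :- c := (a :- c) :+ b) refl S t S₀) ⟩
    ∣ (S - S₀) + t ∣        ≤⟨ ℚₚ.∣p+q∣≤∣p∣+∣q∣ (S - S₀) t ⟩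
    ∣ S - S₀ ∣ + ∣ t ∣      ≤⟨ ℚₚ.+-mono-≤ (expSum-gap y k d) (ℚₚ.≤-reflexive (∣expTerm∣ y (d ℕ.+ k))) ⟩
    (S′ - S₀′) + t′         ≡⟨ solve 3 (λ a b c → (a :- c) :+ b := a :+ b :- c) refl S′ t′ S₀′ ⟩
    S′ + t′ - S₀′           ∎
    where
    S = expSum y (d ℕ.+ k)
    S′ = expSum (∣ y ∣) (d ℕ.+ k)
    S₀ = expSum y k
    S₀′ = expSum (∣ y ∣) k
    t = expTerm y (d ℕ.+ k)
    t′ = expTerm (∣ y ∣) (d ℕ.+ k)

  -- Σ_{d<j} of the terms of index i + d.
  window : ℚ → ℕ → ℕ → ℚ
  window x i zero    = 0ℚ
  window x i (suc j) = expTerm x i + window x (suc i) j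

  window-suc : ∀ x i j → window x i (suc j) ≡ window x i j + expTerm x (i ℕ.+ j)
  window-suc x i zero    = trans (ℚₚ.+-comm (expTerm x i) 0ℚ) (cong (λ z → 0ℚ + expTerm x z) (sym (ℕₚ.+-identityʳ i)))
  window-suc x i (suc j) = begin-equality
    expTerm x i + window x (suc i) (suc j)                       ≡⟨ cong (expTerm x i +_) (window-suc x (suc i) j) ⟩
    expTerm x i + (window x (suc i) j + expTerm x (suc i ℕ.+ j)) ≡⟨ ℚₚ.+-assoc (expTerm x i) _ _ ⟨
    window x i (suc j) + expTerm x (suc i ℕ.+ j)                 ≡⟨ cong (λ z → window x i (suc j) + expTerm x z) (sym (ℕₚ.+-suc i j)) ⟩
    window x i (suc j) + expTerm x (i ℕ.+ suc j)                 ∎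

  expSum-window : ∀ x m → expSum x m ≡ window x 0 m
  expSum-window x zero    = refl
  expSum-window x (suc m) = trans (cong (_+ expTerm x m) (expSum-window x m)) (sym (window-suc x 0 m))

  module _ (x y : ℚ) where

    -- Σ_{d≤j} xⁱ⁺ᵈ/(i+d)! · yʲ⁻ᵈ/(j-d)!, and the same sum weighted by i+d and by j-d.
    conv conv-l conv-r : ℕ → ℕ → ℚ
    conv i zero      = expTerm x i * expTerm y 0
    conv i (suc j)   = expTerm x i * expTerm y (suc j) + conv (suc i) j
    conv-l i zero    = ι i * expTerm x i * expTerm y 0
    conv-l i (suc j) = ι i * expTerm x i * expTerm y (suc j) + conv-l (suc i) j
    conv-r i zero    = 0ℚ
    conv-r i (suc j) = expTerm x i * (ι (suc j) * expTerm y (suc j)) + conv-r (suc i) j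

    conv-l+r : ∀ i j → conv-l i j + conv-r i j ≡ ι (i ℕ.+ j) * conv i j
    conv-l+r i zero    = trans (ℚₚ.+-identityʳ _) (trans (ℚₚ.*-assoc (ι i) (expTerm x i) (expTerm y 0))
      (cong (λ z → ι z * conv i 0) (sym (ℕₚ.+-identityʳ i))))
    conv-l+r i (suc j) = begin-equality
      a * t * u + conv-l (suc i) j + (t * (b * u) + conv-r (suc i) j)
        ≡⟨ solve 6 (λ a t u l b r → a :* t :* u :+ l :+ (t :* (b :* u) :+ r) := (a :+ b) :* (t :* u) :+ (l :+ r)) refl a t u (conv-l (suc i) j) b (conv-r (suc i) j) ⟩
      (a + b) * (t * u) + (conv-l (suc i) j + conv-r (suc i) j)
        ≡⟨ cong₂ _+_ (cong (_* (t * u)) (sym (ι-+ i (suc j)))) (trans (conv-l+r (suc i) j) (cong (λ z → ι z * conv (suc i) j) (sym (ℕₚ.+-suc i j)))) ⟩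
      ι (i ℕ.+ suc j) * (t * u) + ι (i ℕ.+ suc j) * conv (suc i) j
        ≡⟨ ℚₚ.*-distribˡ-+ (ι (i ℕ.+ suc j)) (t * u) (conv (suc i) j) ⟨
      ι (i ℕ.+ suc j) * conv i (suc j) ∎
      where
      a = ι i
      b = ι (suc j)
      t = expTerm x i
      u = expTerm y (suc j)

    conv-l-suc : ∀ i j → conv-l (suc i) j ≡ x * conv i j
    conv-l-suc i zero    = trans (cong (_* expTerm y 0) (expTerm-suc x i)) (ℚₚ.*-assoc x (expTerm x i) (expTerm y 0))
    conv-l-suc i (suc j) = trans (cong₂ _+_ (trans (cong (_* expTerm y (suc j)) (expTerm-suc x i)) (ℚₚ.*-assoc x (expTerm x i) _)) (conv-l-suc (suc i) j))
      (sym (ℚₚ.*-distribˡ-+ x _ _))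

    conv-r-suc : ∀ i j → conv-r i (suc j) ≡ y * conv i j
    conv-r-suc i zero    = trans (ℚₚ.+-identityʳ _) (term i 0)
      where
      term : ∀ i j → expTerm x i * (ι (suc j) * expTerm y (suc j)) ≡ y * (expTerm x i * expTerm y j)
      term i j = trans (cong (expTerm x i *_) (expTerm-suc y j))
        (solve 3 (λ t y u → t :* (y :* u) := y :* (t :* u)) refl (expTerm x i) y (expTerm y j))
    conv-r-suc i (suc j) = trans (cong₂ _+_ (trans (cong (expTerm x i *_) (expTerm-suc y (suc j)))
        (solve 3 (λ t y u → t :* (y :* u) := y :* (t :* u)) refl (expTerm x i) y (expTerm y (suc j)))) (conv-r-suc (suc i) j))
      (sym (ℚₚ.*-distribˡ-+ y _ _))

    -- Both sides satisfy `(l+1) t(l+1) = (x+y) t(l)`. For the convolution this is a Leibniz rule: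
    -- the weight `l + 1` splits into the two indices of each term, one cancels a factor of `x` and
    -- the other a factor of `y`. No binomial coefficients occur.
    binomial : ∀ l → conv 0 l ≡ expTerm (x + y) l
    binomial zero    = refl
    binomial (suc l) = ι-cancelˡ l (begin-equality
      ι (suc l) * conv 0 (suc l)                ≡⟨ conv-l+r 0 (suc l) ⟨
      conv-l 0 (suc l) + conv-r 0 (suc l)       ≡⟨ cong₂ _+_ left (conv-r-suc 0 l) ⟩
      x * conv 0 l + y * conv 0 l               ≡⟨ ℚₚ.*-distribʳ-+ (conv 0 l) x y ⟨
      (x + y) * conv 0 l                        ≡⟨ cong ((x + y) *_) (binomial l) ⟩
      (x + y) * expTerm (x + y) l               ≡⟨ expTerm-suc (x + y) l ⟨
      ι (suc l) * expTerm (x + y) (suc l)       ∎)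
      where
      left : conv-l 0 (suc l) ≡ x * conv 0 l
      left = trans (cong₂ _+_ (trans (cong (_* expTerm y (suc l)) (ℚₚ.*-zeroˡ (expTerm x 0))) (ℚₚ.*-zeroˡ (expTerm y (suc l)))) (conv-l-suc 0 l)) (ℚₚ.+-identityˡ _)

    -- Σ_{d<j} xⁱ⁺ᵈ/(i+d)! · expSum y (j-d).
    triangle-sum : ℕ → ℕ → ℚ
    triangle-sum i zero    = 0ℚ
    triangle-sum i (suc j) = expTerm x i * expSum y (suc j) + triangle-sum (suc i) j

    triangle-sum-suc : ∀ i j → triangle-sum i (suc j) ≡ triangle-sum i j + conv i j
    triangle-sum-suc i zero    = trans (ℚₚ.+-comm (expTerm x i * expSum y 1) 0ℚ) (cong (λ z → 0ℚ + expTerm x i * z) (ℚₚ.+-identityˡ 1ℚ))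
    triangle-sum-suc i (suc j) = trans (cong (t * (S + u) +_) (triangle-sum-suc (suc i) j))
      (solve 5 (λ t S u a b → t :* (S :+ u) :+ (a :+ b) := t :* S :+ a :+ (t :* u :+ b)) refl t S u (triangle-sum (suc i) j) (conv (suc i) j))
      where
      t = expTerm x i
      S = expSum y (suc j)
      u = expTerm y (suc j)

    triangle-sum-exp : ∀ m → triangle-sum 0 m ≡ expSum (x + y) m
    triangle-sum-exp zero    = refl
    triangle-sum-exp (suc m) = trans (triangle-sum-suc 0 m) (cong₂ _+_ (triangle-sum-exp m) (binomial m))

  -- The difference between the rectangle and the triangle of terms is a corner region. Row by row
  -- its terms are bounded by those for the absolute values, so the whole gap is dominated by the
  -- gap for `∣ x ∣` and `∣ y ∣`.
  triangle-gap : ∀ x y n i j → j ℕ.≤ n →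
    ∣ window x i j * expSum y n - triangle-sum x y i j ∣ ≤
    window (∣ x ∣) i j * expSum (∣ y ∣) n - triangle-sum (∣ x ∣) (∣ y ∣) i j
  triangle-gap x y n i zero    _   = ℚₚ.≤-reflexive (trans (cong ∣_∣ (zeros (expSum y n))) (sym (zeros (expSum (∣ y ∣) n))))
    where
    zeros : ∀ S → 0ℚ * S - 0ℚ ≡ 0ℚ
    zeros S = trans (cong (_- 0ℚ) (ℚₚ.*-zeroˡ S)) refl
  triangle-gap x y n i (suc j) j<n with ℕₚ.m≤n⇒∃[o]m+o≡n j<n
  ... | d , eq = begin
    ∣ (t + w) * S - (t * R + T) ∣           ≡⟨ cong ∣_∣ (rearrange t w S R T) ⟩
    ∣ t * (S - R) + (w * S - T) ∣           ≤⟨ ℚₚ.∣p+q∣≤∣p∣+∣q∣ (t * (S - R)) (w * S - T) ⟩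
    ∣ t * (S - R) ∣ + ∣ w * S - T ∣         ≡⟨ cong (_+ ∣ w * S - T ∣) (trans (ℚₚ.∣p*q∣≡∣p∣*∣q∣ t (S - R)) (cong (_* ∣ S - R ∣) (∣expTerm∣ x i))) ⟩
    t′ * ∣ S - R ∣ + ∣ w * S - T ∣          ≤⟨ ℚₚ.+-mono-≤ (*-monoˡ (expTerm-nonNeg (ℚₚ.0≤∣p∣ x) i) gap) (triangle-gap x y n (suc i) j (ℕₚ.<⇒≤ j<n)) ⟩
    t′ * (S′ - R′) + (w′ * S′ - T′)         ≡⟨ rearrange t′ w′ S′ R′ T′ ⟨
    (t′ + w′) * S′ - (t′ * R′ + T′)         ∎
    where
    t = expTerm x i ; t′ = expTerm (∣ x ∣) i
    w = window x (suc i) j ; w′ = window (∣ x ∣) (suc i) j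
    S = expSum y n ; S′ = expSum (∣ y ∣) n
    R = expSum y (suc j) ; R′ = expSum (∣ y ∣) (suc j)
    T = triangle-sum x y (suc i) j ; T′ = triangle-sum (∣ x ∣) (∣ y ∣) (suc i) j
    rearrange : ∀ t w S R T → (t + w) * S - (t * R + T) ≡ t * (S - R) + (w * S - T)
    rearrange = solve 5 (λ t w S R T → (t :+ w) :* S :- (t :* R :+ T) := t :* (S :- R) :+ (w :* S :- T)) refl
    gap : ∣ S - R ∣ ≤ S′ - R′
    gap = subst (λ z → ∣ expSum y z - R ∣ ≤ expSum (∣ y ∣) z - R′) (trans (ℕₚ.+-comm d (suc j)) eq) (expSum-gap y (suc j) d)

  module _ {x y : ℚ} (0≤x : 0ℚ ≤ x) (0≤y : 0ℚ ≤ y) where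

    triangle-sum-nonNeg : ∀ i j → 0ℚ ≤ triangle-sum x y i j
    triangle-sum-nonNeg i zero    = ℚₚ.≤-refl
    triangle-sum-nonNeg i (suc j) = +-nonNeg (*-nonNeg (expTerm-nonNeg 0≤x i) (expSum-nonNeg 0≤y (suc j))) (triangle-sum-nonNeg (suc i) j)

    -- For non-negative terms the `j` by `m` rectangle lies inside the triangle of side `j + m`.
    window≤triangle-sum : ∀ m i j → window x i j * expSum y m ≤ triangle-sum x y i (j ℕ.+ m)
    window≤triangle-sum m i zero    = subst (_≤ triangle-sum x y i m) (sym (ℚₚ.*-zeroˡ (expSum y m))) (triangle-sum-nonNeg i m)
    window≤triangle-sum m i (suc j) = begin
      (t + window x (suc i) j) * expSum y m               ≡⟨ ℚₚ.*-distribʳ-+ (expSum y m) t _ ⟩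
      t * expSum y m + window x (suc i) j * expSum y m    ≤⟨ ℚₚ.+-mono-≤ (*-monoˡ (expTerm-nonNeg 0≤x i) (expSum-mono 0≤y m (suc j))) (window≤triangle-sum m (suc i) j) ⟩
      t * expSum y (suc j ℕ.+ m) + triangle-sum x y (suc i) (j ℕ.+ m) ∎
      where t = expTerm x i

    expSum-+-upper : ∀ m → expSum x m * expSum y m ≤ expSum (x + y) (m ℕ.+ m)
    expSum-+-upper m = subst₂ _≤_ (cong (_* expSum y m) (sym (expSum-window x m))) (triangle-sum-exp x y (m ℕ.+ m)) (window≤triangle-sum m 0 m)

    -- The triangle lies inside the square. The sign comes from `triangle-gap`: its right-hand side
    -- dominates an absolute value, and for non-negative arguments it is the gap itself.
    expSum-+-lower : ∀ m → expSum (x + y) m ≤ expSum x m * expSum y m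
    expSum-+-lower m = subst₂ _≤_ (triangle-sum-exp x y m) (cong (_* expSum y m) (sym (expSum-window x m)))
      (subst (_≤ W * Y) (ℚₚ.+-identityˡ T) (p≤q-r⇒p+r≤q (ℚₚ.≤-trans (ℚₚ.0≤∣p∣ (W * Y - T))
        (subst₂ (λ u v → ∣ W * Y - T ∣ ≤ window u 0 m * expSum v m - triangle-sum u v 0 m) (ℚₚ.0≤p⇒∣p∣≡p 0≤x) (ℚₚ.0≤p⇒∣p∣≡p 0≤y)
          (triangle-gap x y m 0 m ℕₚ.≤-refl)))))
      where
      W = window x 0 m
      Y = expSum y m
      T = triangle-sum x y 0 m
      p≤q-r⇒p+r≤q : ∀ {p q r} → p ≤ q - r → p + r ≤ q
      p≤q-r⇒p+r≤q {p} {q} {r} le = subst (p + r ≤_) (solve 2 (λ q r → q :- r :+ r := q) refl q r) (ℚₚ.+-monoˡ-≤ r le)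

  expSum-+-gap : ∀ x y m → ∣ expSum x m * expSum y m - expSum (x + y) m ∣ ≤
                 expSum ((∣ x ∣) + (∣ y ∣)) (m ℕ.+ m) - expSum ((∣ x ∣) + (∣ y ∣)) m
  expSum-+-gap x y m = begin
    ∣ expSum x m * expSum y m - expSum (x + y) m ∣
      ≡⟨ cong₂ (λ u v → ∣ u * expSum y m - v ∣) (expSum-window x m) (sym (triangle-sum-exp x y m)) ⟩
    ∣ window x 0 m * expSum y m - triangle-sum x y 0 m ∣
      ≤⟨ triangle-gap x y m 0 m ℕₚ.≤-refl ⟩
    window (∣ x ∣) 0 m * expSum (∣ y ∣) m - triangle-sum (∣ x ∣) (∣ y ∣) 0 m
      ≡⟨ cong₂ (λ u v → u * expSum (∣ y ∣) m - v) (sym (expSum-window (∣ x ∣) m)) (triangle-sum-exp (∣ x ∣) (∣ y ∣) m) ⟩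
    expSum (∣ x ∣) m * expSum (∣ y ∣) m - expSum ((∣ x ∣) + (∣ y ∣)) m
      ≤⟨ ℚₚ.+-monoˡ-≤ (- expSum ((∣ x ∣) + (∣ y ∣)) m) (expSum-+-upper (ℚₚ.0≤∣p∣ x) (ℚₚ.0≤∣p∣ y) m) ⟩
    expSum ((∣ x ∣) + (∣ y ∣)) (m ℕ.+ m) - expSum ((∣ x ∣) + (∣ y ∣)) m ∎

  -- The error is part of the tail of the series at `∣ x ∣ + ∣ y ∣`. One `N` serves all arguments in
  -- the range, as the diagonal definition of `exp` demands, where argument and truncation move
  -- together.
  exp-+ : ∀ b ε → 0ℚ < ε → ∃[ N ] ∀ m → N ℕ.≤ m → ∀ x y → (∣ x ∣) ≤ ι b → (∣ y ∣) ≤ ι b →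
          ∣ expSum x m * expSum y m - expSum (x + y) m ∣ ≤ ε
  exp-+ b ε 0<ε = go (uniform-tail (b ℕ.+ b) (½ * ε) (half>0 0<ε))
    where
    go : (∃[ N ] ∀ q → ∣ q ∣ ≤ ι (b ℕ.+ b) → ∀ m → N ℕ.≤ m → ∣ expSum q m - expSum q N ∣ ≤ ½ * ε) →
         ∃[ N ] ∀ m → N ℕ.≤ m → ∀ x y → (∣ x ∣) ≤ ι b → (∣ y ∣) ≤ ι b →
         ∣ expSum x m * expSum y m - expSum (x + y) m ∣ ≤ ε
    go (N , tail) = N , bound
      where
      bound : ∀ m → N ℕ.≤ m → ∀ x y → (∣ x ∣) ≤ ι b → (∣ y ∣) ≤ ι b →
              ∣ expSum x m * expSum y m - expSum (x + y) m ∣ ≤ ε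
      bound m N≤m x y x≤ y≤ = begin
        ∣ expSum x m * expSum y m - expSum (x + y) m ∣  ≤⟨ expSum-+-gap x y m ⟩
        expSum a (m ℕ.+ m) - expSum a m                 ≤⟨ p≤∣p∣ (expSum a (m ℕ.+ m) - expSum a m) ⟩
        ∣ expSum a (m ℕ.+ m) - expSum a m ∣             ≤⟨ triangle (expSum a (m ℕ.+ m)) (expSum a N) (expSum a m) ⟩
        ∣ expSum a (m ℕ.+ m) - expSum a N ∣ + ∣ expSum a N - expSum a m ∣
          ≤⟨ ℚₚ.+-mono-≤ (tail a a≤ (m ℕ.+ m) (ℕₚ.≤-trans N≤m (ℕₚ.m≤m+n m m)))
                         (subst (_≤ ½ * ε) (∣∣-sym (expSum a m) (expSum a N)) (tail a a≤ m N≤m)) ⟩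
        ½ * ε + ½ * ε                                   ≡⟨ halves ε ⟩
        ε                                               ∎
        where
        a = (∣ x ∣) + (∣ y ∣)
        a≤ : ∣ a ∣ ≤ ι (b ℕ.+ b)
        a≤ = subst₂ _≤_ (sym (ℚₚ.0≤p⇒∣p∣≡p (+-nonNeg (ℚₚ.0≤∣p∣ x) (ℚₚ.0≤∣p∣ y)))) (sym (ι-+ b b)) (ℚₚ.+-mono-≤ x≤ y≤)

  expSum-0 : ∀ m → expSum 0ℚ (suc m) ≡ 1ℚ
  expSum-0 zero    = refl
  expSum-0 (suc m) = trans (cong₂ _+_ (expSum-0 m) (trans (cong (expTerm 0ℚ m *_) (ℚₚ.*-zeroˡ (ℤ.+ 1 / suc m))) (ℚₚ.*-zeroʳ (expTerm 0ℚ m)))) (ℚₚ.+-identityʳ 1ℚ)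

  1+q≤expSum : ∀ {q} → 0ℚ ≤ q → ∀ m → 1ℚ + q ≤ expSum q (m ℕ.+ 2)
  1+q≤expSum {q} 0≤q m = ℚₚ.≤-trans (ℚₚ.≤-reflexive (sym two)) (expSum-mono 0≤q 2 m)
    where
    two : expSum q 2 ≡ 1ℚ + q
    two = cong₂ _+_ (ℚₚ.+-identityˡ 1ℚ) (trans (ℚₚ.*-identityˡ _) (ℚₚ.*-identityʳ q))

  -- e ≤ 3: the terms 1/j! at least halve from j = 1 on.
  expSum-1≤3 : ∀ m → expSum 1ℚ m ≤ ι 3
  expSum-1≤3 zero    = ι-nonNeg 3
  expSum-1≤3 (suc m) = ℚₚ.≤-trans (p≤p+q (+-nonNeg (t≥0 (suc m)) (t≥0 (suc m)))) (potential m)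
    where
    t : ℕ → ℚ
    t = expTerm 1ℚ
    t≥0 : ∀ m → 0ℚ ≤ t m
    t≥0 = expTerm-nonNeg (ℚₚ.nonNegative⁻¹ 1ℚ)
    halving : ∀ m → t (suc (suc m)) + t (suc (suc m)) ≤ t (suc m)
    halving m = begin
      u + u               ≡⟨ solve 1 (λ u → u :+ u := (con 1ℚ :+ con 1ℚ) :* u) refl u ⟩
      (1ℚ + 1ℚ) * u       ≤⟨ *-monoʳ (t≥0 (suc (suc m))) (subst (λ z → ι 2 ≤ ι z) (ℕₚ.+-comm m 2) (ι-mono 2 m)) ⟩
      ι (suc (suc m)) * u ≡⟨ expTerm-suc 1ℚ (suc m) ⟩
      1ℚ * t (suc m)      ≡⟨ ℚₚ.*-identityˡ (t (suc m)) ⟩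
      t (suc m)           ∎
      where u = t (suc (suc m))
    potential : ∀ m → expSum 1ℚ (suc m) + (t (suc m) + t (suc m)) ≤ ι 3
    potential zero    = ℚₚ.≤-refl
    potential (suc m) = begin
      expSum 1ℚ (suc m) + t (suc m) + (t (suc (suc m)) + t (suc (suc m))) ≤⟨ ℚₚ.+-monoʳ-≤ (expSum 1ℚ (suc m) + t (suc m)) (halving m) ⟩
      expSum 1ℚ (suc m) + t (suc m) + t (suc m)   ≡⟨ ℚₚ.+-assoc (expSum 1ℚ (suc m)) _ _ ⟩
      expSum 1ℚ (suc m) + (t (suc m) + t (suc m)) ≤⟨ potential m ⟩
      ι 3                                         ∎

  -- Submultiplicativity of the truncated sums on non-negative arguments reduces this to `e ≤ 3`,
  -- with no limit taken.
  expSum-ι≤3^ : ∀ ℓ m → expSum (ι ℓ) m ≤ ι (3 ℕ.^ ℓ)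
  expSum-ι≤3^ zero    zero    = ι-nonNeg 1
  expSum-ι≤3^ zero    (suc m) = ℚₚ.≤-reflexive (expSum-0 m)
  expSum-ι≤3^ (suc ℓ) m = begin
    expSum (ι (suc ℓ)) m           ≡⟨ cong (λ z → expSum z m) (ι-suc ℓ) ⟩
    expSum (1ℚ + ι ℓ) m            ≤⟨ expSum-+-lower (ℚₚ.nonNegative⁻¹ 1ℚ) (ι-nonNeg ℓ) m ⟩
    expSum 1ℚ m * expSum (ι ℓ) m   ≤⟨ *-monoʳ (expSum-nonNeg (ι-nonNeg ℓ) m) (expSum-1≤3 m) ⟩
    ι 3 * expSum (ι ℓ) m           ≤⟨ *-monoˡ (ι-nonNeg 3) (expSum-ι≤3^ ℓ m) ⟩
    ι 3 * ι (3 ℕ.^ ℓ)              ≡⟨ ι-* 3 (3 ℕ.^ ℓ) ⟨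
    ι (3 ℕ.^ suc ℓ)                ∎

open import Defs
open RationalLemmas
open RationalExponential
open Counting using (𝟙; 𝟙-¬; ∑; ∑-+; ∑-cong; ∑-const; length-filter-≡-∑; Leads; failures; failures-rare)
open +-*-Solver

-- Order and multiplication of Cauchy reals.

Eventually : (ℕ → Set) → Set
Eventually P = ∃[ N ] ∀ m → N ℕ.≤ m → P m

both : ∀ {P Q : ℕ → Set} → Eventually P → Eventually Q → Eventually (λ m → P m × Q m)
both (N , p) (M , q) = N ℕ.⊔ M , λ m ≤m → p m (ℕₚ.m⊔n≤o⇒m≤o N M ≤m) , q m (ℕₚ.m⊔n≤o⇒n≤o N M ≤m)

imply : ∀ {P Q : ℕ → Set} → (∀ m → P m → Q m) → Eventually P → Eventually Q
imply f (N , p) = N , λ m ≤m → f m (p m ≤m)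

≃⇒≥ : ∀ {x y} → x ≃ y → y ≤ x
≃⇒≥ {x} {y} eq ε 0<ε = imply (λ m close → subst (seq y m ℚ.≤_) (ℚₚ.+-comm ε (seq x m)) (∣∣≤⇒≥ close)) (eq ε 0<ε)

≤-trans : ∀ {x y z} → x ≤ y → y ≤ z → x ≤ z
≤-trans {x} {y} {z} x≤y y≤z ε 0<ε = imply
  (λ m (p , q) → ℚₚ.≤-trans p (subst (seq y m ℚ.+ ½ ℚ.* ε ℚ.≤_)
    (trans (ℚₚ.+-assoc (seq z m) (½ ℚ.* ε) (½ ℚ.* ε)) (cong (seq z m ℚ.+_) (halves ε))) (ℚₚ.+-monoˡ-≤ (½ ℚ.* ε) q)))
  (both (x≤y (½ ℚ.* ε) (half>0 0<ε)) (y≤z (½ ℚ.* ε) (half>0 0<ε)))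

-- Operations on reals act termwise, so an algebraic identity between reals is a rational identity
-- at each index. This lemma and its mirror image let the ring solver over ℚ rewrite real
-- inequalities.
≤-pointwise-trans : ∀ {x y z} → x ≤ y → (∀ m → seq y m ≡ seq z m) → x ≤ z
≤-pointwise-trans x≤y eq ε 0<ε = imply (λ m → subst (λ q → _ ℚ.≤ q ℚ.+ ε) (eq m)) (x≤y ε 0<ε)

pointwise-≤-trans : ∀ {x y z} → (∀ m → seq x m ≡ seq y m) → y ≤ z → x ≤ z
pointwise-≤-trans eq y≤z ε 0<ε = imply (λ m → subst (ℚ._≤ _) (sym (eq m))) (y≤z ε 0<ε)

<⇒≤ : ∀ {x y} → x < y → x ≤ y
<⇒≤ (δ , 0<δ , N , p) ε 0<ε = N , λ m N≤m → ℚₚ.≤-trans (p≤p+q (ℚₚ.<⇒≤ 0<δ)) (ℚₚ.≤-trans (p m N≤m) (p≤p+q (ℚₚ.<⇒≤ 0<ε)))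

-- The hypotheses hold only up to `δ` at each index, so the expansion starts from
-- `(b - a + δ)(c + δ) ≥ 0`. The resulting error `δ(b - a + c + δ)` is at most `δ K = ε`.
*-monoʳ-≤ : ∀ {a b c} → fromℕ 0 ≤ c → a ≤ b → a * c ≤ b * c
*-monoʳ-≤ {a} {b} {c} 0≤c a≤b ε 0<ε = go (divide K ε 0<K 0<ε)
  where
  A = proj₁ (bounded (b - a))
  0<A = proj₁ (proj₂ (bounded (b - a)))
  bound-A : Eventually (λ m → ∣ seq (b - a) m ∣ ℚ.≤ A)
  bound-A = proj₂ (proj₂ (bounded (b - a)))
  B = proj₁ (bounded c)
  0<B = proj₁ (proj₂ (bounded c))
  bound-B : Eventually (λ m → ∣ seq c m ∣ ℚ.≤ B)
  bound-B = proj₂ (proj₂ (bounded c))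
  -- The summand `1 + ε` bounds the inner `δ`: since `K ≥ ε`, the quotient `δ = ε/K` is at most 1.
  K = A ℚ.+ B ℚ.+ (1ℚ ℚ.+ ε)
  0<1+ε : 0ℚ ℚ.< 1ℚ ℚ.+ ε
  0<1+ε = ℚₚ.+-mono-< (ℚₚ.positive⁻¹ 1ℚ) 0<ε
  0<K : 0ℚ ℚ.< K
  0<K = ℚₚ.+-mono-< (ℚₚ.+-mono-< 0<A 0<B) 0<1+ε
  go : ∃[ δ ] 0ℚ ℚ.< δ × δ ℚ.* K ≡ ε → Eventually (λ m → seq (a * c) m ℚ.≤ seq (b * c) m ℚ.+ ε)
  go (δ , 0<δ , δK≡ε) = imply bound (both (both bound-A bound-B) (both (0≤c δ 0<δ) (a≤b δ 0<δ)))
    where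
    open ℚₚ.≤-Reasoning
    δ≤1 : δ ℚ.≤ 1ℚ
    δ≤1 = ℚₚ.*-cancelʳ-≤-pos K {{ℚ.positive 0<K}} (begin
      δ ℚ.* K    ≡⟨ δK≡ε ⟩
      ε          ≤⟨ p≤q+p (ℚₚ.nonNegative⁻¹ 1ℚ) ⟩
      1ℚ ℚ.+ ε   ≤⟨ p≤q+p (ℚₚ.<⇒≤ (ℚₚ.+-mono-< 0<A 0<B)) ⟩
      K          ≡⟨ ℚₚ.*-identityˡ K ⟨
      1ℚ ℚ.* K   ∎)
    bound : ∀ m → (∣ seq (b - a) m ∣ ℚ.≤ A × ∣ seq c m ∣ ℚ.≤ B) × (0ℚ ℚ.≤ seq c m ℚ.+ δ × seq a m ℚ.≤ seq b m ℚ.+ δ) →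
            seq (a * c) m ℚ.≤ seq (b * c) m ℚ.+ ε
    bound m ((∣b-a∣≤A , ∣c∣≤B) , 0≤c+δ , a≤b+δ) = begin
      α ℚ.* χ
        ≤⟨ p≤p+q (*-nonNeg 0≤b-a+δ 0≤c+δ) ⟩
      α ℚ.* χ ℚ.+ (β ℚ.- α ℚ.+ δ) ℚ.* (χ ℚ.+ δ)
        ≡⟨ solve 4 (λ α β χ δ → α :* χ :+ (β :- α :+ δ) :* (χ :+ δ) := β :* χ :+ δ :* (β :- α :+ χ :+ δ)) refl α β χ δ ⟩
      β ℚ.* χ ℚ.+ δ ℚ.* (β ℚ.- α ℚ.+ χ ℚ.+ δ)
        ≤⟨ ℚₚ.+-monoʳ-≤ (β ℚ.* χ) (*-monoˡ (ℚₚ.<⇒≤ 0<δ) (ℚₚ.+-mono-≤ (ℚₚ.+-mono-≤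
             (ℚₚ.≤-trans (p≤∣p∣ (β ℚ.- α)) ∣b-a∣≤A) (ℚₚ.≤-trans (p≤∣p∣ χ) ∣c∣≤B)) (ℚₚ.≤-trans δ≤1 (p≤p+q (ℚₚ.<⇒≤ 0<ε))))) ⟩
      β ℚ.* χ ℚ.+ δ ℚ.* K
        ≡⟨ cong (β ℚ.* χ ℚ.+_) δK≡ε ⟩
      β ℚ.* χ ℚ.+ ε ∎
      where
      α = seq a m
      β = seq b m
      χ = seq c m
      0≤b-a+δ : 0ℚ ℚ.≤ β ℚ.- α ℚ.+ δ
      0≤b-a+δ = subst₂ ℚ._≤_ (ℚₚ.+-inverseʳ α) (solve 3 (λ β δ α → β :+ δ :- α := β :- α :+ δ) refl β δ α) (ℚₚ.+-monoˡ-≤ (ℚ.- α) a≤b+δ)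

*-nonNegℝ : ∀ {a c} → fromℕ 0 ≤ a → fromℕ 0 ≤ c → fromℕ 0 ≤ a * c
*-nonNegℝ {a} {c} 0≤a 0≤c = pointwise-≤-trans {fromℕ 0} {fromℕ 0 * c} {a * c} (λ m → sym (ℚₚ.*-zeroˡ (seq c m))) (*-monoʳ-≤ {fromℕ 0} {a} {c} 0≤c 0≤a)

ι-mono-≤ : ∀ {a b} → a ℕ.≤ b → ι a ℚ.≤ ι b
ι-mono-≤ {a} a≤b with ℕₚ.m≤n⇒∃[o]m+o≡n a≤b
... | d , refl = subst (λ z → ι a ℚ.≤ ι z) (ℕₚ.+-comm d a) (ι-mono a d)

fromℕ-mono : ∀ {a b} → a ℕ.≤ b → fromℕ a ≤ fromℕ b
fromℕ-mono {a} {b} a≤b ε 0<ε = 0 , λ _ _ → ℚₚ.≤-trans (ι-mono-≤ {a} {b} a≤b) (p≤p+q (ℚₚ.<⇒≤ 0<ε))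

-- A tolerance of one half suffices, since distinct integers are at least 1 apart. This is the
-- passage from real hypotheses back to counting.
fromℕ-cancel-≤ : ∀ {a b} → fromℕ a ≤ fromℕ b → a ℕ.≤ b
fromℕ-cancel-≤ {a} {b} le with a ℕₚ.≤? b
... | yes a≤b = a≤b
... | no a≰b  = contradiction 1≤½ λ { (ℚ.*≤* (ℤ.+≤+ (s≤s ()))) }
  where
  open ℚₚ.≤-Reasoning
  N = proj₁ (le ½ (ℚₚ.positive⁻¹ ½))
  p = proj₂ (le ½ (ℚₚ.positive⁻¹ ½))
  1≤½ : 1ℚ ℚ.≤ ½
  1≤½ = begin
    1ℚ                       ≡⟨ solve 2 (λ o b → o := o :+ b :- b) refl 1ℚ (ι b) ⟩
    1ℚ ℚ.+ ι b ℚ.- ι b       ≡⟨ cong (ℚ._- ι b) (ι-suc b) ⟨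
    ι (suc b) ℚ.- ι b        ≤⟨ p≤r+q⇒p-q≤r (ℚₚ.≤-trans (ι-mono-≤ (ℕₚ.≰⇒> a≰b)) (subst (ι a ℚ.≤_) (ℚₚ.+-comm (ι b) ½) (p N ℕₚ.≤-refl))) ⟩
    ½                        ∎

fromℕ-positive : ∀ n → fromℕ 0 < fromℕ (suc n)
fromℕ-positive n = 1ℚ , ℚₚ.positive⁻¹ 1ℚ , 0 , λ _ _ →
  subst₂ ℚ._≤_ (sym (ℚₚ.+-identityˡ 1ℚ)) (sym (ι-suc n)) (p≤p+q (ι-nonNeg n))

*-cancelʳ-≤ : ∀ {a b} c → a * fromℕ (suc c) ≤ b * fromℕ (suc c) → a ≤ b
*-cancelʳ-≤ {a} {b} c le = pointwise-≤-trans {a} {a * fromℕ (suc c) * inv} {b} (λ m → sym (undo (seq a m)))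
  (≤-pointwise-trans {a * fromℕ (suc c) * inv} {b * fromℕ (suc c) * inv} {b} (*-monoʳ-≤ {a * fromℕ (suc c)} {b * fromℕ (suc c)} {inv} 0≤inv le) (λ m → undo (seq b m)))
  where
  inv = fromℚ (ℤ.+ 1 ℚ./ suc c)
  0≤inv : fromℕ 0 ≤ inv
  0≤inv ε 0<ε = 0 , λ _ _ → ℚₚ.≤-trans (ExpLemmas.recip≥0 c) (p≤p+q (ℚₚ.<⇒≤ 0<ε))
  undo : ∀ p → p ℚ.* ι (suc c) ℚ.* (ℤ.+ 1 ℚ./ suc c) ≡ p
  undo p = trans (ℚₚ.*-assoc p (ι (suc c)) _) (trans (cong (p ℚ.*_) (ι-inv c)) (ℚₚ.*-identityʳ p))

-- Bounds on the logarithm and on `exp (-log n)`.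

ExpAdditive : ℕ → ℕ → ℚ → Set
ExpAdditive b m δ = ∀ p q → ∣ p ∣ ℚ.≤ ι b → ∣ q ∣ ℚ.≤ ι b → ∣ expSum p m ℚ.* expSum q m ℚ.- expSum (p ℚ.+ q) m ∣ ℚ.≤ δ

-- If X ≈ log n were below ℓ by more than ε, then n ≥ 3^ℓ ≥ exp ℓ = exp X exp (ℓ - X) ≥ n (1 + ε).
approximate-log-lower : ∀ n ℓ b m X B ε δ → 3 ℕ.^ ℓ ℕ.≤ n → 2 ℕ.≤ m → 0ℚ ℚ.< ε → 0ℚ ℚ.< δ → δ ℚ.* (ι 3 ℚ.+ ε) ≡ ε →
  ∣ X ∣ ℚ.≤ B → ι ℓ ℚ.+ B ℚ.≤ ι b → ∣ expSum X m ℚ.- ι n ∣ ℚ.≤ δ → ExpAdditive b m δ → ι ℓ ℚ.≤ X ℚ.+ ε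
approximate-log-lower n ℓ b m X B ε δ 3^ℓ≤n 2≤m 0<ε 0<δ δ≡ X≤B ℓ+B≤b close additive =
  ℚₚ.≮⇒≥ (λ X+ε<ℓ → ℚₚ.<-irrefl refl (absurd X+ε<ℓ))
  where
  open ℚₚ.≤-Reasoning
  0≤δ = ℚₚ.<⇒≤ 0<δ
  0≤ε = ℚₚ.<⇒≤ 0<ε
  0<3+ε : 0ℚ ℚ.< ι 3 ℚ.+ ε
  0<3+ε = ℚₚ.+-mono-< (ℚₚ.positive⁻¹ (ι 3)) 0<ε
  δ≤1 : δ ℚ.≤ 1ℚ
  δ≤1 = ℚₚ.*-cancelʳ-≤-pos (ι 3 ℚ.+ ε) {{ℚ.positive 0<3+ε}} (begin
    δ ℚ.* (ι 3 ℚ.+ ε)  ≡⟨ δ≡ ⟩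
    ε                  ≤⟨ p≤q+p (ι-nonNeg 3) ⟩
    ι 3 ℚ.+ ε          ≡⟨ ℚₚ.*-identityˡ (ι 3 ℚ.+ ε) ⟨
    1ℚ ℚ.* (ι 3 ℚ.+ ε) ∎)
  1≤n : 1ℚ ℚ.≤ ι n
  1≤n = ι-mono-≤ {1} {n} (ℕₚ.≤-trans (ℕₚ.m^n>0 3 ℓ) 3^ℓ≤n)
  y = ι ℓ ℚ.- X
  S = expSum X m
  R = expSum y m
  y≤b : ∣ y ∣ ℚ.≤ ι b
  y≤b = begin
    ∣ ι ℓ ℚ.- X ∣         ≤⟨ ℚₚ.∣p-q∣≤∣p∣+∣q∣ (ι ℓ) X ⟩
    ∣ ι ℓ ∣ ℚ.+ ∣ X ∣     ≡⟨ cong (ℚ._+ ∣ X ∣) (ℚₚ.0≤p⇒∣p∣≡p (ι-nonNeg ℓ)) ⟩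
    ι ℓ ℚ.+ ∣ X ∣         ≤⟨ ℚₚ.+-monoʳ-≤ (ι ℓ) X≤B ⟩
    ι ℓ ℚ.+ B             ≤⟨ ℓ+B≤b ⟩
    ι b                   ∎
  X≤b : ∣ X ∣ ℚ.≤ ι b
  X≤b = ℚₚ.≤-trans X≤B (ℚₚ.≤-trans (p≤q+p (ι-nonNeg ℓ)) ℓ+B≤b)
  SR≤ : S ℚ.* R ℚ.≤ δ ℚ.+ ι n
  SR≤ = begin
    S ℚ.* R                      ≤⟨ ∣∣≤⇒≤+ {S ℚ.* R} {expSum (X ℚ.+ y) m} (additive X y X≤b y≤b) ⟩
    δ ℚ.+ expSum (X ℚ.+ y) m     ≡⟨ cong (λ z → δ ℚ.+ expSum z m) (solve 2 (λ X L → X :+ (L :- X) := L) refl X (ι ℓ)) ⟩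
    δ ℚ.+ expSum (ι ℓ) m         ≤⟨ ℚₚ.+-monoʳ-≤ δ (ℚₚ.≤-trans (expSum-ι≤3^ ℓ m) (ι-mono-≤ {3 ℕ.^ ℓ} {n} 3^ℓ≤n)) ⟩
    δ ℚ.+ ι n                    ∎
  1+ε≤R : ε ℚ.≤ y → 1ℚ ℚ.+ ε ℚ.≤ R
  1+ε≤R ε≤y = ℚₚ.≤-trans (ℚₚ.+-monoʳ-≤ 1ℚ ε≤y)
    (subst (λ z → 1ℚ ℚ.+ y ℚ.≤ expSum y z) (ℕₚ.m∸n+n≡m 2≤m) (1+q≤expSum (ℚₚ.≤-trans 0≤ε ε≤y) (m ℕ.∸ 2)))
  n≤δ+S : ι n ℚ.≤ δ ℚ.+ S
  n≤δ+S = ∣∣≤⇒≥ {S} {ι n} close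
  0≤S : 0ℚ ℚ.≤ S
  0≤S = subst₂ ℚ._≤_ (ℚₚ.+-inverseʳ δ) (solve 2 (λ δ S → δ :+ S :- δ := S) refl δ S)
    (ℚₚ.+-monoˡ-≤ (ℚ.- δ) (ℚₚ.≤-trans δ≤1 (ℚₚ.≤-trans 1≤n n≤δ+S)))
  δ<2δ : δ ℚ.< δ ℚ.+ δ
  δ<2δ = subst (ℚ._< δ ℚ.+ δ) (ℚₚ.+-identityʳ δ) (ℚₚ.+-monoʳ-< δ 0<δ)
  -- The choice `δ (3 + ε) = ε` covers `δ (1 + ε)` for replacing `n` by `S`, one `δ` for the failure
  -- of exact additivity, and one more `δ` that makes the chain strict.
  absurd : X ℚ.+ ε ℚ.< ι ℓ → ε ℚ.+ ι n ℚ.< ε ℚ.+ ι n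
  absurd X+ε<ℓ = begin-strict
    ε ℚ.+ ι n                                   ≡⟨ cong (ℚ._+ ι n) (ℚₚ.*-identityˡ ε) ⟨
    1ℚ ℚ.* ε ℚ.+ ι n                            ≤⟨ ℚₚ.+-monoˡ-≤ (ι n) (*-monoʳ 0≤ε 1≤n) ⟩
    ι n ℚ.* ε ℚ.+ ι n                           ≡⟨ solve 2 (λ n ε → n :* ε :+ n := n :* (con 1ℚ :+ ε)) refl (ι n) ε ⟩
    ι n ℚ.* (1ℚ ℚ.+ ε)                          ≤⟨ *-monoʳ (+-nonNeg (ℚₚ.nonNegative⁻¹ 1ℚ) 0≤ε) n≤δ+S ⟩
    (δ ℚ.+ S) ℚ.* (1ℚ ℚ.+ ε)                    ≡⟨ ℚₚ.*-distribʳ-+ (1ℚ ℚ.+ ε) δ S ⟩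
    δ ℚ.* (1ℚ ℚ.+ ε) ℚ.+ S ℚ.* (1ℚ ℚ.+ ε)       ≤⟨ ℚₚ.+-monoʳ-≤ (δ ℚ.* (1ℚ ℚ.+ ε)) (ℚₚ.≤-trans (*-monoˡ 0≤S (1+ε≤R ε≤y)) SR≤) ⟩
    δ ℚ.* (1ℚ ℚ.+ ε) ℚ.+ (δ ℚ.+ ι n)            <⟨ ℚₚ.+-monoʳ-< (δ ℚ.* (1ℚ ℚ.+ ε)) (ℚₚ.+-monoˡ-< (ι n) δ<2δ) ⟩
    δ ℚ.* (1ℚ ℚ.+ ε) ℚ.+ (δ ℚ.+ δ ℚ.+ ι n)      ≡⟨ solve 3 (λ δ ε n → δ :* (con 1ℚ :+ ε) :+ (δ :+ δ :+ n) := δ :* (con (ι 3) :+ ε) :+ n) refl δ ε (ι n) ⟩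
    δ ℚ.* (ι 3 ℚ.+ ε) ℚ.+ ι n                   ≡⟨ cong (ℚ._+ ι n) δ≡ ⟩
    ε ℚ.+ ι n                                   ∎
    where
    ε≤y : ε ℚ.≤ y
    ε≤y = subst (ℚ._≤ y) (solve 2 (λ X ε → X :+ ε :- X := ε) refl X ε) (ℚₚ.+-monoˡ-≤ (ℚ.- X) (ℚₚ.<⇒≤ X+ε<ℓ))

3^≤⇒≤log : ∀ {n ℓ x} → 3 ℕ.^ ℓ ℕ.≤ n → IsLog x (fromℕ n) → fromℕ ℓ ≤ x
3^≤⇒≤log {n} {ℓ} {x} 3^ℓ≤n isLog ε 0<ε = go (bounded x)
  where
  go : (∃[ B ] 0ℚ ℚ.< B × Eventually (λ m → ∣ seq x m ∣ ℚ.≤ B)) → Eventually (λ m → ι ℓ ℚ.≤ seq x m ℚ.+ ε)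
  go (B , _ , bound) = go₂ (archimedean (ι ℓ ℚ.+ B)) (divide (ι 3 ℚ.+ ε) ε (ℚₚ.+-mono-< (ℚₚ.positive⁻¹ (ι 3)) 0<ε) 0<ε)
    where
    go₂ : (∃[ b ] ι ℓ ℚ.+ B ℚ.≤ ι b) → (∃[ δ ] 0ℚ ℚ.< δ × δ ℚ.* (ι 3 ℚ.+ ε) ≡ ε) → Eventually (λ m → ι ℓ ℚ.≤ seq x m ℚ.+ ε)
    go₂ (b , ℓ+B≤b) (δ , 0<δ , δ≡) = imply
      (λ m ((2≤m , X≤B) , (close , additive)) → approximate-log-lower n ℓ b m (seq x m) B ε δ 3^ℓ≤n 2≤m 0<ε 0<δ δ≡ X≤B ℓ+B≤b close additive)
      (both (both (2 , λ _ 2≤m → 2≤m) bound) (both (isLog δ 0<δ) (exp-+ b δ 0<δ)))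

-- exp (-log n) = 1/n, by exp x · exp (-x) = 1.
approximate-exp-log : ∀ n b m X B p ε δ → 1 ℕ.≤ m → 0ℚ ℚ.< ε → 0ℚ ℚ.< δ → δ ℚ.* (1ℚ ℚ.+ B) ≡ ε →
  ι (suc n) ℚ.* (1ℚ ℚ.- p) ℚ.≤ 1ℚ → ∣ X ∣ ℚ.≤ ι b → ∣ expSum (ℚ.- (1ℚ ℚ.* X)) m ∣ ℚ.≤ B →
  ∣ expSum X m ℚ.- ι (suc n) ∣ ℚ.≤ δ → ExpAdditive b m δ → 1ℚ ℚ.- expSum (ℚ.- (1ℚ ℚ.* X)) m ℚ.≤ p ℚ.+ ε
approximate-exp-log n b m@(suc m′) X B p ε δ _ 0<ε 0<δ δ≡ small X≤b u≤B close additive = ℚₚ.*-cancelˡ-≤-pos N {{ι-pos n}} (begin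
  N ℚ.* (1ℚ ℚ.- u)                                   ≡⟨ solve 2 (λ N u → N :* (con 1ℚ :- u) := N :* (con 1ℚ :- u) :+ con 1ℚ :- con 1ℚ) refl N u ⟩
  N ℚ.* (1ℚ ℚ.- u) ℚ.+ 1ℚ ℚ.- 1ℚ                     ≤⟨ ℚₚ.+-monoˡ-≤ (ℚ.- 1ℚ) (ℚₚ.+-monoʳ-≤ (N ℚ.* (1ℚ ℚ.- u)) 1≤Nu+ε) ⟩
  N ℚ.* (1ℚ ℚ.- u) ℚ.+ (N ℚ.* u ℚ.+ ε) ℚ.- 1ℚ        ≡⟨ solve 4 (λ N u ε p → N :* (con 1ℚ :- u) :+ (N :* u :+ ε) :- con 1ℚ := N :* (con 1ℚ :- p) :+ (N :* p :+ con 1ℚ :* ε) :- con 1ℚ) refl N u ε p ⟩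
  N ℚ.* (1ℚ ℚ.- p) ℚ.+ (N ℚ.* p ℚ.+ 1ℚ ℚ.* ε) ℚ.- 1ℚ ≤⟨ ℚₚ.+-monoˡ-≤ (ℚ.- 1ℚ) (ℚₚ.+-mono-≤ small (ℚₚ.+-monoʳ-≤ (N ℚ.* p) (*-monoʳ (ℚₚ.<⇒≤ 0<ε) 1≤N))) ⟩
  1ℚ ℚ.+ (N ℚ.* p ℚ.+ N ℚ.* ε) ℚ.- 1ℚ                ≡⟨ solve 3 (λ N p ε → con 1ℚ :+ (N :* p :+ N :* ε) :- con 1ℚ := N :* (p :+ ε)) refl N p ε ⟩
  N ℚ.* (p ℚ.+ ε)                                    ∎)
  where
  open ℚₚ.≤-Reasoning
  N = ι (suc n)
  1≤N : 1ℚ ℚ.≤ N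
  1≤N = ι-mono-≤ {1} {suc n} (s≤s z≤n)
  z = ℚ.- (1ℚ ℚ.* X)
  u = expSum z m
  S = expSum X m
  z≤b : ∣ z ∣ ℚ.≤ ι b
  z≤b = subst (ℚ._≤ ι b) (sym (trans (cong (λ q → ∣ ℚ.- q ∣) (ℚₚ.*-identityˡ X)) (ℚₚ.∣-p∣≡∣p∣ X))) X≤b
  expSum-X+z : expSum (X ℚ.+ z) m ≡ 1ℚ
  expSum-X+z = trans (cong (λ q → expSum q m) (trans (cong (λ q → X ℚ.+ ℚ.- q) (ℚₚ.*-identityˡ X)) (ℚₚ.+-inverseʳ X))) (expSum-0 m′)
  error : (S ℚ.- N) ℚ.* u ℚ.≤ δ ℚ.* B
  error = begin
    (S ℚ.- N) ℚ.* u          ≤⟨ p≤∣p∣ ((S ℚ.- N) ℚ.* u) ⟩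
    ∣ (S ℚ.- N) ℚ.* u ∣      ≡⟨ ℚₚ.∣p*q∣≡∣p∣*∣q∣ (S ℚ.- N) u ⟩
    ∣ S ℚ.- N ∣ ℚ.* ∣ u ∣    ≤⟨ *-monoʳ (ℚₚ.0≤∣p∣ u) close ⟩
    δ ℚ.* ∣ u ∣              ≤⟨ *-monoˡ (ℚₚ.<⇒≤ 0<δ) u≤B ⟩
    δ ℚ.* B                  ∎
  -- Two errors are collected: `δ` from additivity and `δ B` from replacing `S` by `N` in front of
  -- `u`. Their sum is `δ (1 + B) = ε`.
  1≤Nu+ε : 1ℚ ℚ.≤ N ℚ.* u ℚ.+ ε
  1≤Nu+ε = begin
    1ℚ                                      ≡⟨ expSum-X+z ⟨
    expSum (X ℚ.+ z) m                      ≤⟨ ∣∣≤⇒≥ {S ℚ.* u} {expSum (X ℚ.+ z) m} (additive X z X≤b z≤b) ⟩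
    δ ℚ.+ S ℚ.* u                           ≡⟨ solve 4 (λ δ S u N → δ :+ S :* u := N :* u :+ (δ :+ (S :- N) :* u)) refl δ S u N ⟩
    N ℚ.* u ℚ.+ (δ ℚ.+ (S ℚ.- N) ℚ.* u)     ≤⟨ ℚₚ.+-monoʳ-≤ (N ℚ.* u) (ℚₚ.+-monoʳ-≤ δ error) ⟩
    N ℚ.* u ℚ.+ (δ ℚ.+ δ ℚ.* B)             ≡⟨ cong (N ℚ.* u ℚ.+_) (trans (solve 2 (λ δ B → δ :+ δ :* B := δ :* (con 1ℚ :+ B)) refl δ B) δ≡) ⟩
    N ℚ.* u ℚ.+ ε                           ∎

failure≤exp-log : ∀ {n x} p → IsLog x (fromℕ (suc n)) → ι (suc n) ℚ.* (1ℚ ℚ.- p) ℚ.≤ 1ℚ →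
                  fromℕ 1 - exp (- (fromℕ 1 * x)) ≤ fromℚ p
failure≤exp-log {n} {x} p isLog small ε 0<ε = go (bounded x) (bounded w)
  where
  w = exp (- (fromℕ 1 * x))
  go : (∃[ B ] 0ℚ ℚ.< B × Eventually (λ m → ∣ seq x m ∣ ℚ.≤ B)) → (∃[ B ] 0ℚ ℚ.< B × Eventually (λ m → ∣ seq w m ∣ ℚ.≤ B)) →
       Eventually (λ m → 1ℚ ℚ.- seq w m ℚ.≤ p ℚ.+ ε)
  go (A , _ , bound-x) (B , 0<B , bound-w) = go₂ (archimedean A) (divide (1ℚ ℚ.+ B) ε (ℚₚ.+-mono-< (ℚₚ.positive⁻¹ 1ℚ) 0<B) 0<ε)
    where
    go₂ : (∃[ b ] A ℚ.≤ ι b) → (∃[ δ ] 0ℚ ℚ.< δ × δ ℚ.* (1ℚ ℚ.+ B) ≡ ε) → Eventually (λ m → 1ℚ ℚ.- seq w m ℚ.≤ p ℚ.+ ε)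
    go₂ (b , A≤b) (δ , 0<δ , δ≡) = imply
      (λ m ((1≤m , X≤A , u≤B) , (close , additive)) →
        approximate-exp-log n b m (seq x m) B p ε δ 1≤m 0<ε 0<δ δ≡ small (ℚₚ.≤-trans X≤A A≤b) u≤B close additive)
      (both (both (1 , λ _ 1≤m → 1≤m) (both bound-x bound-w)) (both (isLog δ 0<δ) (exp-+ b δ 0<δ)))

-- From counts of outcomes to probabilities, and from the real hypotheses to integers.

/-*-ι : ∀ a l .{{_ : ℕ.NonZero l}} → (ℤ.+ a ℚ./ l) ℚ.* ι l ≡ ι a
/-*-ι a (suc l) = ℚₚ.toℚᵘ-injective (ℚᵘₚ.≃-trans (ℚₚ.toℚᵘ-homo-* (ℤ.+ a ℚ./ suc l) (ι (suc l)))
  (ℚᵘₚ.≃-trans (ℚᵘₚ.*-cong (ℚₚ.toℚᵘ-fromℚᵘ (ℚᵘ.mkℚᵘ (ℤ.+ a) l)) (ℚₚ.toℚᵘ-fromℚᵘ (ℚᵘ.mkℚᵘ (ℤ.+ suc l) 0)))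
    (ℚᵘₚ.≃-trans (ℚᵘ.*≡* eq) (ℚᵘₚ.≃-sym (ℚₚ.toℚᵘ-fromℚᵘ (ℚᵘ.mkℚᵘ (ℤ.+ a) 0))))))
  where
  eq : (ℤ.+ a ℤ.* ℤ.+ suc l) ℤ.* ℤ.+ 1 ≡ ℤ.+ a ℤ.* ℤ.+ (suc l ℕ.* 1)
  eq = trans (ℤₚ.*-identityʳ _) (cong (λ k → ℤ.+ a ℤ.* ℤ.+ k) (sym (ℕₚ.*-identityʳ (suc l))))

failure-probability : ∀ {A : Set} {P : A → Set} n (xs : List A) .{{_ : ℕ.NonZero (length xs)}} (P? : Decidable P) →
  n ℕ.* ∑ xs (λ x → 𝟙 (¬? (P? x))) ℕ.≤ length xs → ι n ℚ.* (1ℚ ℚ.- uniformProbability xs P?) ℚ.≤ 1ℚ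
failure-probability n xs P? nF≤L = ℚₚ.*-cancelʳ-≤-pos (ι L) {{ι-positive L}} (begin
  ι n ℚ.* (1ℚ ℚ.- p) ℚ.* ι L                ≡⟨ solve 3 (λ n p L → n :* (con 1ℚ :- p) :* L := n :* (L :- p :* L)) refl (ι n) p (ι L) ⟩
  ι n ℚ.* (ι L ℚ.- p ℚ.* ι L)               ≡⟨ cong (λ z → ι n ℚ.* (ι L ℚ.- z)) (/-*-ι a L) ⟩
  ι n ℚ.* (ι L ℚ.- ι a)                     ≡⟨ cong (λ z → ι n ℚ.* (z ℚ.- ι a)) (trans (cong ι (sym split)) (ι-+ F a)) ⟩
  ι n ℚ.* (ι F ℚ.+ ι a ℚ.- ι a)             ≡⟨ solve 3 (λ n F a → n :* (F :+ a :- a) := n :* F) refl (ι n) (ι F) (ι a) ⟩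
  ι n ℚ.* ι F                               ≡⟨ ι-* n F ⟨
  ι (n ℕ.* F)                               ≤⟨ ι-mono-≤ nF≤L ⟩
  ι L                                       ≡⟨ ℚₚ.*-identityˡ (ι L) ⟨
  1ℚ ℚ.* ι L                                ∎)
  where
  open ℚₚ.≤-Reasoning
  L = length xs
  a = length (filter P? xs)
  F = ∑ xs (λ x → 𝟙 (¬? (P? x)))
  p = uniformProbability xs P?
  ι-positive : ∀ l .{{_ : ℕ.NonZero l}} → ℚ.Positive (ι l)
  ι-positive (suc l) = ι-pos l
  split : F ℕ.+ a ≡ L
  split = trans (cong (F ℕ.+_) (length-filter-≡-∑ P? xs)) (trans (sym (∑-+ (λ x → 𝟙 (¬? (P? x))) _ xs))
    (trans (∑-cong xs (λ x → 𝟙-¬ (P? x))) (trans (∑-const 1 xs) (ℕₚ.*-identityʳ L))))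

⌊log₃⌋ : ∀ n → 1 ℕ.≤ n → ∃[ ℓ ] 3 ℕ.^ ℓ ℕ.≤ n × n ℕ.< 3 ℕ.^ suc ℓ
⌊log₃⌋ (suc zero)    _ = 0 , s≤s z≤n , s≤s (s≤s z≤n)
⌊log₃⌋ (suc (suc n)) _ with ⌊log₃⌋ (suc n) (s≤s z≤n)
... | ℓ , lower , upper with suc (suc n) ℕₚ.<? 3 ℕ.^ suc ℓ
...   | yes small = ℓ , ℕₚ.≤-trans lower (ℕₚ.n≤1+n _) , small
...   | no large  = suc ℓ , ℕₚ.≮⇒≥ large , ℕₚ.<-≤-trans (s≤s upper) (ℕₚ.+-mono-≤ {1} (ℕₚ.m^n>0 3 (suc ℓ))
                      (ℕₚ.m≤m+n (3 ℕ.^ suc ℓ) (3 ℕ.^ suc ℓ ℕ.+ 0)))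

largest-lookup : ∀ {k n} (c : Configuration (suc k) n) → lookup (counts c) zero ≡ largest c
largest-lookup c with counts c
... | _ ∷ _ = refl

second≤largest : ∀ {k n} (c : Configuration (suc k) n) → NonIncreasing c → second c ℕ.≤ largest c
second≤largest {zero}  c mono = z≤n
second≤largest {suc k} c mono with counts c | mono
... | _ ∷ _ ∷ _ | mono′ = mono′ zero (suc zero) z≤n

minor≤second : ∀ {k n} (c : Configuration (suc k) n) → NonIncreasing c → ∀ j → j ≢ zero → lookup (counts c) j ℕ.≤ second c
minor≤second {k}     c mono zero    j≢0 = contradiction refl j≢0
minor≤second {suc k} c mono (suc j) j≢0 with counts c | mono
... | _ ∷ _ ∷ _ | mono′ = mono′ (suc zero) (suc j) (s≤s z≤n)

0≤fromℕ : ∀ a → fromℕ 0 ≤ fromℕ a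
0≤fromℕ a = fromℕ-mono {0} {a} z≤n

module _ (n ℓ c : ℕ) (Λ X : ℝ) (0≤Λ : fromℕ 0 ≤ Λ) (ℓ≤X : fromℕ ℓ ≤ X) (n≤cΛ : fromℕ n ≤ fromℕ c * Λ) where

  -- Squaring removes the root: `576 · 2 Λ n X ≤ s²`. Multiplied by `c`, the factor `c Λ` may be
  -- lowered to `n` and `X` to `ℓ`, which eliminates both real parameters.
  squared-bias : ∀ s r → fromℕ 0 ≤ r → r ^ 2 ≃ fromℕ 2 * Λ * fromℕ n * X → fromℕ 24 * r ≤ fromℕ s →
                 1152 ℕ.* (n ℕ.* n ℕ.* ℓ) ℕ.≤ s ℕ.* s ℕ.* c
  squared-bias s r 0≤r r²≃ R≤s = fromℕ-cancel-≤ {1152 ℕ.* (n ℕ.* n ℕ.* ℓ)} {s ℕ.* s ℕ.* c}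
    (pointwise-≤-trans {fromℕ (1152 ℕ.* (n ℕ.* n ℕ.* ℓ))} {fromℕ n * fromℕ K} {Y} (λ _ → e₁)
    (≤-trans {fromℕ n * fromℕ K} {fromℕ c * Λ * fromℕ K} {Y} (*-monoʳ-≤ {fromℕ n} {fromℕ c * Λ} {fromℕ K} (0≤fromℕ K) n≤cΛ)
    (pointwise-≤-trans {fromℕ c * Λ * fromℕ K} {fromℕ ℓ * W} {Y} (λ m → e₂ (seq Λ m))
    (≤-trans {fromℕ ℓ * W} {X * W} {Y} (*-monoʳ-≤ {fromℕ ℓ} {X} {W} 0≤W ℓ≤X)
    (pointwise-≤-trans {X * W} {P * fromℕ 576 * fromℕ c} {Y} (λ m → e₃ (seq X m) (seq Λ m))
    (≤-pointwise-trans {P * fromℕ 576 * fromℕ c} {fromℕ s * fromℕ s * fromℕ c} {Y}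
      (*-monoʳ-≤ {P * fromℕ 576} {fromℕ s * fromℕ s} {fromℕ c} (0≤fromℕ c) P≤s²) (λ _ → sym (trans (ι-* (s ℕ.* s) c) (cong (ℚ._* ι c) (ι-* s s))))))))))
    where
    open ℚₚ.≤-Reasoning
    Y = fromℕ (s ℕ.* s ℕ.* c)
    R = fromℕ 24 * r
    P = fromℕ 2 * Λ * fromℕ n * X
    W = fromℕ c * Λ * fromℕ (1152 ℕ.* n)
    K = 1152 ℕ.* n ℕ.* ℓ
    0≤R : fromℕ 0 ≤ R
    0≤R = *-nonNegℝ {fromℕ 24} {r} (0≤fromℕ 24) 0≤r
    R²≤s² : R * R ≤ fromℕ s * fromℕ s
    R²≤s² = ≤-trans {R * R} {fromℕ s * R} {fromℕ s * fromℕ s} (*-monoʳ-≤ {R} {fromℕ s} {R} 0≤R R≤s)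
      (pointwise-≤-trans {fromℕ s * R} {R * fromℕ s} {fromℕ s * fromℕ s} (λ m → ℚₚ.*-comm (ι s) (seq R m))
        (*-monoʳ-≤ {R} {fromℕ s} {fromℕ s} (0≤fromℕ s) R≤s))
    square : ∀ p → p ℚ.* (p ℚ.* 1ℚ) ℚ.* ι 576 ≡ ι 24 ℚ.* p ℚ.* (ι 24 ℚ.* p)
    square p = begin-equality
      p ℚ.* (p ℚ.* 1ℚ) ℚ.* ι 576            ≡⟨ cong (p ℚ.* (p ℚ.* 1ℚ) ℚ.*_) (ι-* 24 24) ⟩
      p ℚ.* (p ℚ.* 1ℚ) ℚ.* (ι 24 ℚ.* ι 24)  ≡⟨ solve 2 (λ r t → r :* (r :* con 1ℚ) :* (t :* t) := t :* r :* (t :* r)) refl p (ι 24) ⟩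
      ι 24 ℚ.* p ℚ.* (ι 24 ℚ.* p)           ∎
    P≤s² : P * fromℕ 576 ≤ fromℕ s * fromℕ s
    P≤s² = ≤-trans {P * fromℕ 576} {(r ^ 2) * fromℕ 576} {fromℕ s * fromℕ s}
      (*-monoʳ-≤ {P} {r ^ 2} {fromℕ 576} (0≤fromℕ 576) (≃⇒≥ {r ^ 2} {P} r²≃))
      (pointwise-≤-trans {(r ^ 2) * fromℕ 576} {R * R} {fromℕ s * fromℕ s} (λ m → square (seq r m)) R²≤s²)
    0≤W : fromℕ 0 ≤ W
    0≤W = *-nonNegℝ {fromℕ c * Λ} {fromℕ (1152 ℕ.* n)} (*-nonNegℝ {fromℕ c} {Λ} (0≤fromℕ c) 0≤Λ) (0≤fromℕ (1152 ℕ.* n))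
    e₁ : ι (1152 ℕ.* (n ℕ.* n ℕ.* ℓ)) ≡ ι n ℚ.* ι K
    e₁ = trans (cong ι (lemma n ℓ)) (ι-* n K)
      where
      lemma : ∀ n ℓ → 1152 ℕ.* (n ℕ.* n ℕ.* ℓ) ≡ n ℕ.* (1152 ℕ.* n ℕ.* ℓ)
      lemma = solve-∀
    e₂ : ∀ λ′ → ι c ℚ.* λ′ ℚ.* ι K ≡ ι ℓ ℚ.* (ι c ℚ.* λ′ ℚ.* ι (1152 ℕ.* n))
    e₂ λ′ = trans (cong (ι c ℚ.* λ′ ℚ.*_) (ι-* (1152 ℕ.* n) ℓ))
      (solve 3 (λ a b c → a :* (b :* c) := c :* (a :* b)) refl (ι c ℚ.* λ′) (ι (1152 ℕ.* n)) (ι ℓ))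
    e₃ : ∀ y λ′ → y ℚ.* (ι c ℚ.* λ′ ℚ.* ι (1152 ℕ.* n)) ≡ ι 2 ℚ.* λ′ ℚ.* ι n ℚ.* y ℚ.* ι 576 ℚ.* ι c
    e₃ y λ′ = trans (cong (λ z → y ℚ.* (ι c ℚ.* λ′ ℚ.* z)) (trans (ι-* 1152 n) (cong (ℚ._* ι n) (ι-* 576 2))))
      (solve 6 (λ y c l a b n → y :* (c :* l :* (a :* b :* n)) := b :* l :* n :* y :* a :* c) refl y (ι c) λ′ (ι 576) (ι 2) (ι n))

  -- The converse passage: `T c ≤ C n ℓ ≤ C (c Λ) X`, after which `c` cancels.
  rounds-bound : ∀ C T .{{_ : ℕ.NonZero c}} → T ℕ.* c ℕ.≤ C ℕ.* (n ℕ.* ℓ) → fromℕ T ≤ fromℕ C * Λ * X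
  rounds-bound C T Tc≤ = *-cancelʳ-≤ {fromℕ T} {fromℕ C * Λ * X} (ℕ.pred c)
    (subst (λ z → fromℕ T * fromℕ z ≤ fromℕ C * Λ * X * fromℕ z) (sym (ℕₚ.suc-pred c))
    (pointwise-≤-trans {fromℕ T * fromℕ c} {fromℕ (T ℕ.* c)} {Y} (λ _ → sym (ι-* T c))
    (≤-trans {fromℕ (T ℕ.* c)} {fromℕ (C ℕ.* (n ℕ.* ℓ))} {Y} (fromℕ-mono {T ℕ.* c} {C ℕ.* (n ℕ.* ℓ)} Tc≤)
    (pointwise-≤-trans {fromℕ (C ℕ.* (n ℕ.* ℓ))} {fromℕ n * (fromℕ C * fromℕ ℓ)} {Y} (λ _ → e₁)
    (≤-trans {fromℕ n * (fromℕ C * fromℕ ℓ)} {fromℕ c * Λ * (fromℕ C * fromℕ ℓ)} {Y}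
      (*-monoʳ-≤ {fromℕ n} {fromℕ c * Λ} {fromℕ C * fromℕ ℓ} (*-nonNegℝ {fromℕ C} {fromℕ ℓ} (0≤fromℕ C) (0≤fromℕ ℓ)) n≤cΛ)
    (pointwise-≤-trans {fromℕ c * Λ * (fromℕ C * fromℕ ℓ)} {fromℕ ℓ * V} {Y} (λ m → e₂ (ι c) (seq Λ m) (ι C) (ι ℓ))
    (≤-pointwise-trans {fromℕ ℓ * V} {X * V} {Y} (*-monoʳ-≤ {fromℕ ℓ} {X} {V} 0≤V ℓ≤X) (λ m → e₃ (seq X m) (ι c) (seq Λ m) (ι C)))))))))
    where
    Y = fromℕ C * Λ * X * fromℕ c
    V = fromℕ c * Λ * fromℕ C
    0≤V : fromℕ 0 ≤ V
    0≤V = *-nonNegℝ {fromℕ c * Λ} {fromℕ C} (*-nonNegℝ {fromℕ c} {Λ} (0≤fromℕ c) 0≤Λ) (0≤fromℕ C)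
    e₁ : ι (C ℕ.* (n ℕ.* ℓ)) ≡ ι n ℚ.* (ι C ℚ.* ι ℓ)
    e₁ = trans (ι-* C (n ℕ.* ℓ)) (trans (cong (ι C ℚ.*_) (ι-* n ℓ))
      (solve 3 (λ a b c → a :* (b :* c) := b :* (a :* c)) refl (ι C) (ι n) (ι ℓ)))
    e₂ : ∀ a b c d → a ℚ.* b ℚ.* (c ℚ.* d) ≡ d ℚ.* (a ℚ.* b ℚ.* c)
    e₂ = solve 4 (λ a b c d → a :* b :* (c :* d) := d :* (a :* b :* c)) refl
    e₃ : ∀ y a b c → y ℚ.* (a ℚ.* b ℚ.* c) ≡ c ℚ.* b ℚ.* y ℚ.* a
    e₃ = solve 4 (λ y a b c → y :* (a :* b :* c) := c :* b :* y :* a) refl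

bias≡ : ∀ {k n} (c : Configuration (suc k) n) → NonIncreasing c → ∀ m → seq (bias c) m ≡ ι (largest c ℕ.∸ second c)
bias≡ c mono _ = begin-equality
  ι (largest c) ℚ.- ι (second c)            ≡⟨ cong (λ z → ι z ℚ.- ι (second c)) (ℕₚ.m∸n+n≡m (second≤largest c mono)) ⟨
  ι (s ℕ.+ second c) ℚ.- ι (second c)       ≡⟨ cong (ℚ._- ι (second c)) (ι-+ s (second c)) ⟩
  ι s ℚ.+ ι (second c) ℚ.- ι (second c)     ≡⟨ solve 2 (λ a b → a :+ b :- b := a) refl (ι s) (ι (second c)) ⟩
  ι s                                       ∎
  where
  open ℚₚ.≤-Reasoning
  s = largest c ℕ.∸ second c

configuration-leads : ∀ {n k} (c : Configuration (suc k) n) → NonIncreasing c → (x : Coloring n (suc k)) → x HasConfiguration c →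
                      Leads x (largest c ℕ.∸ second c)
configuration-leads c mono x has v x≢ = subst₂ (λ u w → u ℕ.+ (largest c ℕ.∸ second c) ℕ.≤ w) (sym (has (x v)))
  (sym (trans (has zero) (largest-lookup c)))
  (ℕₚ.≤-trans (ℕₚ.+-monoˡ-≤ (largest c ℕ.∸ second c) (minor≤second c mono (x v) x≢)) (ℕₚ.≤-reflexive (ℕₚ.m+[n∸m]≡n (second≤largest c mono))))

consensus-in-ℕ : ∀ {n k} ℓ → 3 ℕ.^ ℓ ℕ.≤ n → n ℕ.< 3 ℕ.^ suc ℓ → 15 ℕ.≤ ℓ →
  (c : Configuration (suc k) n) → NonIncreasing c → (x : Coloring n (suc k)) → x HasConfiguration c →
  1152 ℕ.* (n ℕ.* n ℕ.* ℓ) ℕ.≤ (largest c ℕ.∸ second c) ℕ.* (largest c ℕ.∸ second c) ℕ.* largest c →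
  ∃[ T ] T ℕ.* largest c ℕ.≤ 210 ℕ.* (n ℕ.* ℓ) × n ℕ.* failures x T ℕ.≤ length (outcomes n T)
consensus-in-ℕ {n} {k} ℓ lower upper 15≤ℓ c mono x has =
  subst (λ z → 1152 ℕ.* (n ℕ.* n ℕ.* ℓ) ℕ.≤ s ℕ.* s ℕ.* z → ∃[ T ] T ℕ.* z ℕ.≤ 210 ℕ.* (n ℕ.* ℓ) × n ℕ.* failures x T ℕ.≤ length (outcomes n T))
    count₁ (failures-rare {n} {k} ℓ lower upper 15≤ℓ x s (subst (s ℕ.≤_) (sym count₁) (ℕₚ.m∸n≤m (largest c) (second c))) (configuration-leads c mono x has))
  where
  s = largest c ℕ.∸ second c
  count₁ : colorCount x zero ≡ largest c
  count₁ = trans (has zero) (largest-lookup c)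

nonZero-largest : ∀ n ℓ s c → 1 ℕ.≤ n → 1 ℕ.≤ ℓ → 1152 ℕ.* (n ℕ.* n ℕ.* ℓ) ℕ.≤ s ℕ.* s ℕ.* c → ℕ.NonZero c
nonZero-largest (suc n) (suc ℓ) s zero    _ _ big = contradiction (ℕₚ.≤-trans big (ℕₚ.≤-reflexive (ℕₚ.*-zeroʳ (s ℕ.* s)))) λ ()
nonZero-largest n       ℓ       s (suc c) _ _ _   = _

consensus-time : (n k′ : ℕ) → 3 ℕ.^ 15 ℕ.≤ n →
  (Λ log-n n/Λ √2Λn-log-n : ℝ) →
  fromℕ 0 < Λ →
  IsLog log-n (fromℕ n) →
  IsQuotient n/Λ (fromℕ n) Λ →
  IsRoot 2 √2Λn-log-n (fromℕ 2 * Λ * fromℕ n * log-n) →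
  (c : Configuration (suc k′) n) → NonIncreasing c →
  n/Λ ≤ fromℕ (largest c) →
  fromℕ 24 * √2Λn-log-n ≤ bias c →
  (x : Coloring n (suc k′)) → x HasConfiguration c →
  ∃[ T ] (fromℕ T ≤ fromℕ 210 * Λ * log-n ×
          fromℕ 1 - exp (- (fromℕ 1 * log-n)) ≤ fromℚ (consensusProbability x T))
consensus-time n k′ n₀≤n Λ X q r 0<Λ isLog isQuotient (0≤r , r²≃) c mono q≤c₁ 24r≤bias x has =
  proj₁ core , rounds-bound n ℓ c₁ Λ X 0≤Λ ℓ≤X n≤c₁Λ 210 (proj₁ core) {{nonZero-largest n ℓ s c₁ 1≤n (ℕₚ.≤-trans (s≤s z≤n) 15≤ℓ) big}} (proj₁ (proj₂ core)) ,
  likely n 1≤n x isLog (proj₁ core) (proj₂ (proj₂ core))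
  where
  c₁ = largest c
  s = c₁ ℕ.∸ second c
  1≤n : 1 ℕ.≤ n
  1≤n = ℕₚ.≤-trans (ℕₚ.m^n>0 3 15) n₀≤n
  lg = ⌊log₃⌋ n 1≤n
  ℓ = proj₁ lg
  15≤ℓ : 15 ℕ.≤ ℓ
  15≤ℓ = ℕₚ.≮⇒≥ (λ ℓ<15 → ℕₚ.<⇒≱ (ℕₚ.<-≤-trans (proj₂ (proj₂ lg)) (ℕₚ.^-monoʳ-≤ 3 ℓ<15)) n₀≤n)
  0≤Λ : fromℕ 0 ≤ Λ
  0≤Λ = <⇒≤ {fromℕ 0} {Λ} 0<Λ
  ℓ≤X : fromℕ ℓ ≤ X
  ℓ≤X = 3^≤⇒≤log {n} {ℓ} {X} (proj₁ (proj₂ lg)) isLog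
  n≤c₁Λ : fromℕ n ≤ fromℕ c₁ * Λ
  n≤c₁Λ = ≤-trans {fromℕ n} {q * Λ} {fromℕ c₁ * Λ} (≃⇒≥ {q * Λ} {fromℕ n} isQuotient) (*-monoʳ-≤ {q} {fromℕ c₁} {Λ} 0≤Λ q≤c₁)
  big : 1152 ℕ.* (n ℕ.* n ℕ.* ℓ) ℕ.≤ s ℕ.* s ℕ.* c₁
  big = squared-bias n ℓ c₁ Λ X 0≤Λ ℓ≤X n≤c₁Λ s r 0≤r r²≃
    (≤-pointwise-trans {fromℕ 24 * r} {bias c} {fromℕ s} 24r≤bias (bias≡ c mono))
  core = consensus-in-ℕ ℓ (proj₁ (proj₂ lg)) (proj₂ (proj₂ lg)) 15≤ℓ c mono x has big
  -- Stated for a fresh `n` so that it can be matched as a successor, the form in which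
  -- `failure≤exp-log` divides by it. The exponent `γ = 1` corresponds to the counted bound that `n`
  -- times the failures is at most the number of outcomes.
  likely : ∀ n → 1 ℕ.≤ n → (x : Coloring n (suc k′)) → IsLog X (fromℕ n) → ∀ T → n ℕ.* failures x T ℕ.≤ length (outcomes n T) →
           fromℕ 1 - exp (- (fromℕ 1 * X)) ≤ fromℚ (consensusProbability x T)
  likely (suc n) _ x isLog T rare = failure≤exp-log {n} {X} (consensusProbability x T) isLog
    (failure-probability (suc n) (outcomes (suc n) T) {{outcomes-nonZero (suc n) T}} (reaches? x) rare)

theorem3p1 : ∃[ C ] ∃[ γ ] ∃[ n₀ ] (fromℕ 0 < C × fromℕ 0 < γ ×
    ((n k′ : ℕ) → n₀ ℕ.≤ n →
    (Λ log-n ∛n n/Λ √2Λn-log-n : ℝ) →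
    fromℕ 0 < Λ →
    IsLog log-n (fromℕ n) →
    IsRoot 3 ∛n (fromℕ n) →
    IsQuotient n/Λ (fromℕ n) Λ →
    IsRoot 2 √2Λn-log-n (fromℕ 2 * Λ * fromℕ n * log-n) →
    Λ < ∛n →
    (c : Configuration (suc k′) n) → NonIncreasing c →
    n/Λ ≤ fromℕ (largest c) →
    fromℕ 24 * √2Λn-log-n ≤ bias c →
    (x : Coloring n (suc k′)) → x HasConfiguration c →
    ∃[ T ] (fromℕ T ≤ C * Λ * log-n ×
    fromℕ 1 - exp (- (γ * log-n)) ≤ fromℚ (consensusProbability x T))))
theorem3p1 = fromℕ 210 , fromℕ 1 , 3 ℕ.^ 15 , fromℕ-positive 209 , fromℕ-positive 0 ,
  λ n k′ n₀≤n Λ log-n _ n/Λ √2Λn-log-n 0<Λ isLog _ isQuotient isRoot _ →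
    consensus-time n k′ n₀≤n Λ log-n n/Λ √2Λn-log-n 0<Λ isLog isQuotient isRoot
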